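{- There is a randomized algorithm which takes as input parameters $k \in \mathbb{N}$ and $\epsilon>0$ and has query (oracle) access to an arbitrary function $f:\{ -1,1\}^n \rightarrow \{ -1,1\}$, makes $2^k \cdot \mathrm{poly}(k,1/\epsilon)$ queries to $f$, and with probability at least $2/3$ outputs a number $\widehat{\mathsf{Corr}}_{f,k}$ together with a function $h:\{ -1,1\}^k \rightarrow \{ -1,1\}$ such that \[ \Big| \widehat{\mathsf{Corr}}_{f,k} - \max_{\ell \in \mathcal{J}_{n,k}} \mathbf{E}_{\mathbf{x}}[\ell(\mathbf{x}) f(\mathbf{x})] \Big| \le \epsilon, \] and there is a set of coordinates $\mathcal{T}=\{i_1,\ldots,i_k\}\subseteq[n]$ with \[ \Big| \max_{\ell \in \mathcal{J}_{n,k}} \mathbf{E}_{\mathbf{x}}[\ell(\mathbf{x}) f(\mathbf{x})] - \mathbf{E}_{\mathbf{x}}[h(\mathbf{x}_{i_1},\ldots,\mathbf{x}_{i_k}) f(\mathbf{x})]\Big| \le \epsilon. \]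
   Context: A function $g:\{ -1,1\}^n\to\{ -1,1\}$ is a $k$-junta if there are $k$ coordinates $i_1,\dots,i_k\in[n]$ such that $g(x)$ depends only on $x_{i_1},\dots,x_{i_k}$. $\mathcal{J}_{n,k}$ denotes the class of $k$-juntas on $n$ variables. All expectations are over $\mathbf{x}$ uniform on $\{ -1,1\}^n$. The query complexity is the number of points at which the algorithm evaluates $f$; it must not depend on $n$. -}

module Defs where

open import Data.Bool using (Bool; true; false; if_then_else_; _≟_)
open import Data.Nat as ℕ using (ℕ; zero; suc)
open import Data.Integer using (+_)
open import Data.Rational using (ℚ; _+_; _*_; _-_; _/_; ∣_∣; _≤_; 0ℚ; 1ℚ; ½)
open import Data.Fin using (Fin)
open import Data.Vec using (Vec; []; _∷_; lookup)
open import Data.List using (List; []; _∷_; map; _++_; foldr)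
open import Data.Product using (Σ; _×_; _,_; ∃)
open import Function.Definitions using (Injective)
open import Relation.Binary.PropositionalEquality using (_≡_)

-- Points of {-1,1}^n are encoded as Vec Bool n (true ↔ -1, false ↔ 1, say).
-- Boolean functions {-1,1}^n → {-1,1} are encoded as Vec Bool n → Bool.
Point : ℕ → Set
Point n = Vec Bool n

BoolFun : ℕ → Set
BoolFun n = Point n → Bool

ℕ→ℚ : ℕ → ℚ
ℕ→ℚ n = + n / 1

_^ℚ_ : ℚ → ℕ → ℚ
p ^ℚ zero = 1ℚ
p ^ℚ suc m = p * (p ^ℚ m)

allPoints : (n : ℕ) → List (Point n)
allPoints zero = [] ∷ []
allPoints (suc n) = map (true ∷_) (allPoints n) ++ map (false ∷_) (allPoints n)

sumℚ : List ℚ → ℚ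
sumℚ = foldr _+_ 0ℚ

mul± : Bool → Bool → ℚ
mul± a b = if does (a ≟ b) then 1ℚ else (0ℚ - 1ℚ)
  where open import Relation.Nullary using (does)

corr : {n : ℕ} → BoolFun n → BoolFun n → ℚ
corr {n} g f = (sumℚ (map (λ x → mul± (g x) (f x)) (allPoints n))) * (+ 1 / (2 ℕ.^ n))
  where instance
          nz : ℕ.NonZero (2 ℕ.^ n)
          nz = ℕ.>-nonZero (Data.Nat.Properties.m^n>0 2 n)
            where import Data.Nat.Properties

restrict : {n k : ℕ} → (Fin k → Fin n) → Point n → Point k
restrict {k = k} ι x = Data.Vec.tabulate (λ j → lookup x (ι j))
  where import Data.Vec

IsJunta : (n k : ℕ) → BoolFun n → Set
IsJunta n k g =
  Σ (Fin k → Fin n) λ ι → Injective _≡_ _≡_ ι ×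
    (∀ (x y : Point n) → (∀ j → lookup x (ι j) ≡ lookup y (ι j)) → g x ≡ g y)

IsMaxJuntaCorr : (n k : ℕ) → BoolFun n → ℚ → Set
IsMaxJuntaCorr n k f m =
  (Σ (BoolFun n) λ ℓ → IsJunta n k ℓ × corr ℓ f ≡ m) ×
  (∀ (ℓ : BoolFun n) → IsJunta n k ℓ → corr ℓ f ≤ m)

-- Randomized query algorithms (decision trees with coin flips) with oracle
-- access to a function {-1,1}^n → {-1,1}, returning a value in A.
data QAlg (n : ℕ) (A : Set) : Set where
  ret   : A → QAlg n A
  query : Point n → (Bool → QAlg n A) → QAlg n A
  coin  : (Bool → QAlg n A) → QAlg n A

numQueries : {n : ℕ} {A : Set} → QAlg n A → ℕ
numQueries (ret a) = 0
numQueries (query x c) = suc (numQueries (c true) ℕ.⊔ numQueries (c false))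
numQueries (coin c) = numQueries (c true) ℕ.⊔ numQueries (c false)

prob : {n : ℕ} {A : Set} → BoolFun n → (A → Bool) → QAlg n A → ℚ
prob f S (ret a) = if S a then 1ℚ else 0ℚ
prob f S (query x c) = prob f S (c (f x))
prob f S (coin c) = ½ * (prob f S (c true) + prob f S (c false))

-- Pr[ output satisfies P ] ≥ p  (P is witnessed by a Boolean selector contained in P)
ProbAtLeast : {n : ℕ} {A : Set} → BoolFun n → (A → Set) → QAlg n A → ℚ → Set
ProbAtLeast f P alg p =
  Σ (_ → Bool) λ S → (∀ a → S a ≡ true → P a) × (p ≤ prob f S alg)

Good : (n k : ℕ) → ℚ → BoolFun n → ℚ × (Point k → Bool) → Set
Good n k ε f (c , h) =
  Σ ℚ λ m → IsMaxJuntaCorr n k f m ×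
    (∣ c - m ∣ ≤ ε) ×
    (Σ (Fin k → Fin n) λ ι → Injective _≡_ _≡_ ι ×
        (∣ m - corr (λ x → h (restrict ι x)) f ∣ ≤ ε))

{-# OPTIONS --safe #-}
module Submission where

-- Hash the coordinates into labels and query x with x_i = s_i y_{φ(i)} for random signs s.  As a function of y,
-- the Fourier coefficient at a set U of labels is the sum of f̂(S) χ_S(s) over the S that φ folds to U.
-- For all |U| ≤ k at once, it is within about ε 2^{-k/2} of the contribution of the few S with |S| ≤ k and large
-- f̂(S): a set of more than k coordinates rarely folds to a set of at most k labels, and the small coefficients
-- are controlled by a fourth moment (hypercontractivity in s, collisions in φ).  The number of labels is only
-- exponential in k and 1/ε, so 2^k poly(k, 1/ε) samples suffice to estimate all these coefficients.
-- Since (φ, s) cannot tell a coordinate from one with the same label and the opposite sign, a second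
-- hashing uses (φ(i), s_i) as the label and fresh signs.  Any function g that explains both data sets, and f is one,
-- has the same large low-degree coefficients as f up to a matching of coordinates with equal labels, so an optimal
-- junta for g is almost optimal for f on the matched coordinates.  Only the queries are counted, so g may be found by
-- exhaustive search.

open import Defs
open import Data.Nat using (ℕ; zero; suc; _^_; _≤_; z≤n; s≤s)
import Data.Nat as ℕ
import Data.Nat.Properties as ℕₚ
open import Data.Integer using (+_)
open import Data.Rational using (ℚ; _+_; _*_; _-_; -_; _/_; _<_; 0ℚ; 1ℚ; ½; nonNegative) renaming (_≤_ to _≤ℚ_)
import Data.Rational.Properties as ℚₚ
open import Data.Bool using (Bool; true; false; _∧_; _∨_; not; _xor_; if_then_else_)
import Data.Bool.Properties as Boolₚ
open import Data.Fin using (Fin; zero; suc; inject≤; _↑ˡ_; _↑ʳ_)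
import Data.Fin as Fin
import Data.Fin.Properties as Finₚ
import Data.Rational.Unnormalised as ℚᵘ
import Data.Rational.Unnormalised.Properties as ℚᵘₚ
import Data.Integer as ℤ
import Data.Integer.Properties as ℤₚ
open import Data.Vec using (Vec; []; _∷_; lookup; map; zipWith; replicate; updateAt; tabulate)
open import Data.Vec.Properties using (≡-dec; lookup∘updateAt; lookup∘updateAt′; lookup-map; lookup-zipWith; tabulate-∘; tabulate∘lookup; lookup∘tabulate)
open import Data.Maybe using (Maybe; just; nothing)
open import Data.Product using (Σ; _×_; _,_; proj₁; proj₂; ∃)
open import Data.Sum using (_⊎_; inj₁; inj₂)
open import Data.Empty using (⊥-elim)
import Data.List as List
import Data.List.Properties as Listₚ
import Data.Vec.Properties as Vecₚ
open import Data.List.Relation.Unary.Any using (Any; here; there)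
import Data.List.Relation.Unary.Any as Any
open import Data.List.Membership.Propositional using (_∈_; lose)
open import Data.List.Membership.Propositional.Properties using (∈-cartesianProductWith⁺; ∈-cartesianProduct⁺; ∈-allFin)
import Data.Nat.Tactic.RingSolver as ℕ-Ring
open import Data.Nat.DivMod using (m≡m%n+[m/n]*n; m%n<n)
open import Function using (_∘_)
open import Function.Bundles using (Equivalence)
open import Relation.Nullary using (Dec; yes; no; does; ¬_; _×-dec_; _→-dec_)
open import Relation.Nullary.Decidable using (dec-true; dec-false)
open import Relation.Binary.PropositionalEquality using (_≡_; _≢_; refl; sym; trans; cong; cong₂; subst; subst₂)
import Tactic.RingSolver.Core.AlmostCommutativeRing as ACR
open import Tactic.RingSolver using (solve-∀)

-- The accuracy ε 2^(-k/2) comes from E[h(x_ι) f(x)] = Σ_V ĥ(V) f̂(ι(V)): Parseval for h absorbs one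
-- factor, and the 2^k sets V cost 2^(k/2) in the other. A sample mean of that accuracy takes about
-- 2^k/ε² points. The union bound over all sets of at most k labels is paid by taking many such
-- groups and asking most of them to agree, which multiplies the queries only by the logarithm of
-- the number of sets. Hence thresholds and collision probabilities may be exponentially small in k
-- and 1/ε without harm. A second moment cannot control the small coefficients: their squares may
-- add up to 1, and only the product of the largest square with this total is small, which is what a
-- fourth moment sees. The coordinates of f are never identified. Only a value and a table are
-- returned, so a matching between the coordinates of f and g needs to exist only in the proof. The
-- optimum is carried along it both from f to g and from g to f, each time losing at most ε/2.

private variable
  A A′ A″ : Set
  n L : ℕ

-- Ordered arithmetic in ℚ, signs and indicators

ℚ-ring : ACR.AlmostCommutativeRing _ _
ℚ-ring = ACR.fromCommutativeRing ℚₚ.+-*-commutativeRing isZero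
  where
  isZero : ∀ x → Maybe (0ℚ ≡ x)
  isZero x with 0ℚ ℚₚ.≟ x
  ... | yes p = just p
  ... | no _ = nothing

0≤½ : 0ℚ ≤ℚ ½
0≤½ = ℚₚ.nonNegative⁻¹ ½

0≤1 : 0ℚ ≤ℚ 1ℚ
0≤1 = ℚₚ.nonNegative⁻¹ 1ℚ

0≤-+ : ∀ {x y} → 0ℚ ≤ℚ x → 0ℚ ≤ℚ y → 0ℚ ≤ℚ x + y
0≤-+ = ℚₚ.+-mono-≤

*-monoˡ : ∀ {c x y} → 0ℚ ≤ℚ c → x ≤ℚ y → c * x ≤ℚ c * y
*-monoˡ {c} 0≤c = ℚₚ.*-monoˡ-≤-nonNeg c {{nonNegative 0≤c}}

*-monoʳ : ∀ {c x y} → 0ℚ ≤ℚ c → x ≤ℚ y → x * c ≤ℚ y * c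
*-monoʳ {c} 0≤c = ℚₚ.*-monoʳ-≤-nonNeg c {{nonNegative 0≤c}}

*-mono : ∀ {x y u v} → 0ℚ ≤ℚ x → 0ℚ ≤ℚ v → x ≤ℚ y → u ≤ℚ v → x * u ≤ℚ y * v
*-mono 0≤x 0≤v x≤y u≤v = ℚₚ.≤-trans (*-monoˡ 0≤x u≤v) (*-monoʳ 0≤v x≤y)

0≤-* : ∀ {x y} → 0ℚ ≤ℚ x → 0ℚ ≤ℚ y → 0ℚ ≤ℚ x * y
0≤-* {x} {y} 0≤x 0≤y = subst (_≤ℚ x * y) (ℚₚ.*-zeroʳ x) (*-monoˡ 0≤x 0≤y)

-- Inequalities by certificate: the ring solver checks an identity with an explicit remainder, often
-- a sum of squares, and only the sign of the remainder is argued.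
≤-via : ∀ {x y} e → y ≡ x + e → 0ℚ ≤ℚ e → x ≤ℚ y
≤-via {x} e refl 0≤e = subst (_≤ℚ x + e) (ℚₚ.+-identityʳ x) (ℚₚ.+-monoʳ-≤ x 0≤e)

≤⇒0≤- : ∀ {x y} → x ≤ℚ y → 0ℚ ≤ℚ y - x
≤⇒0≤- {x} {y} x≤y = subst (_≤ℚ y - x) (ℚₚ.+-inverseʳ x) (ℚₚ.+-monoˡ-≤ (- x) x≤y)

0≤-sq : ∀ x → 0ℚ ≤ℚ x * x
0≤-sq x with ℚₚ.≤-total 0ℚ x
... | inj₁ 0≤x = 0≤-* 0≤x 0≤x
... | inj₂ x≤0 = subst (0ℚ ≤ℚ_) (neg-sq x) (0≤-* 0≤-x 0≤-x)
  where
  0≤-x : 0ℚ ≤ℚ - x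
  0≤-x = subst (0ℚ ≤ℚ_) (ℚₚ.+-identityˡ (- x)) (≤⇒0≤- x≤0)
  neg-sq : ∀ x → (- x) * (- x) ≡ x * x
  neg-sq = solve-∀ ℚ-ring

sq-mono : ∀ {x y} → 0ℚ ≤ℚ x → x ≤ℚ y → x * x ≤ℚ y * y
sq-mono 0≤x x≤y = *-mono 0≤x (ℚₚ.≤-trans 0≤x x≤y) x≤y x≤y

sg : Bool → ℚ
sg true = - 1ℚ
sg false = 1ℚ

𝟙 : Bool → ℚ
𝟙 true = 1ℚ
𝟙 false = 0ℚ

0≤𝟙 : ∀ b → 0ℚ ≤ℚ 𝟙 b
0≤𝟙 true = 0≤1
0≤𝟙 false = ℚₚ.≤-refl

𝟙≤1 : ∀ b → 𝟙 b ≤ℚ 1ℚ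
𝟙≤1 true = ℚₚ.≤-refl
𝟙≤1 false = 0≤1

sg-sq : ∀ b → sg b * sg b ≡ 1ℚ
sg-sq true = refl
sg-sq false = refl

sg-xor : ∀ a b → sg (a xor b) ≡ sg a * sg b
sg-xor true true = refl
sg-xor true false = refl
sg-xor false true = refl
sg-xor false false = refl

-- Finite trees as random experiments and as index sets

data Tree (A : Set) : Set where
  nil  : Tree A
  leaf : A → Tree A
  node : Tree A → Tree A → Tree A

-- c = ½ gives the expectation over the coin flips of the tree, c = 1 the sum over its leaves.
∫ : ℚ → Tree A → (A → ℚ) → ℚ
∫ c nil F = 0ℚ
∫ c (leaf a) F = F a
∫ c (node l r) F = c * (∫ c l F + ∫ c r F)

𝔼 : Tree A → (A → ℚ) → ℚ
𝔼 = ∫ ½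

∑ : Tree A → (A → ℚ) → ℚ
∑ = ∫ 1ℚ

_>>=ᵗ_ : Tree A → (A → Tree A′) → Tree A′
nil >>=ᵗ k = nil
leaf a >>=ᵗ k = k a
node l r >>=ᵗ k = node (l >>=ᵗ k) (r >>=ᵗ k)

mapᵗ : (A → A′) → Tree A → Tree A′
mapᵗ g t = t >>=ᵗ (leaf ∘ g)

∫-cong : ∀ c (t : Tree A) {F G : A → ℚ} → (∀ a → F a ≡ G a) → ∫ c t F ≡ ∫ c t G
∫-cong c nil eq = refl
∫-cong c (leaf a) eq = eq a
∫-cong c (node l r) eq = cong (c *_) (cong₂ _+_ (∫-cong c l eq) (∫-cong c r eq))

∫-+ : ∀ c (t : Tree A) (F G : A → ℚ) → ∫ c t (λ a → F a + G a) ≡ ∫ c t F + ∫ c t G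
∫-+ c nil F G = refl
∫-+ c (leaf a) F G = refl
∫-+ c (node l r) F G =
  trans (cong (c *_) (cong₂ _+_ (∫-+ c l F G) (∫-+ c r F G)))
    (shuffle c (∫ c l F) (∫ c l G) (∫ c r F) (∫ c r G))
  where
  shuffle : ∀ c x y u v → c * ((x + y) + (u + v)) ≡ c * (x + u) + c * (y + v)
  shuffle = solve-∀ ℚ-ring

∫-*ˡ : ∀ c (t : Tree A) d (F : A → ℚ) → ∫ c t (λ a → d * F a) ≡ d * ∫ c t F
∫-*ˡ c nil d F = sym (ℚₚ.*-zeroʳ d)
∫-*ˡ c (leaf a) d F = refl
∫-*ˡ c (node l r) d F =
  trans (cong (c *_) (cong₂ _+_ (∫-*ˡ c l d F) (∫-*ˡ c r d F))) (shuffle c d (∫ c l F) (∫ c r F))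
  where
  shuffle : ∀ c d x u → c * (d * x + d * u) ≡ d * (c * (x + u))
  shuffle = solve-∀ ℚ-ring

∫-*ʳ : ∀ c (t : Tree A) d (F : A → ℚ) → ∫ c t (λ a → F a * d) ≡ ∫ c t F * d
∫-*ʳ c t d F = trans (∫-cong c t (λ a → ℚₚ.*-comm (F a) d)) (trans (∫-*ˡ c t d F) (ℚₚ.*-comm d _))

∫-zero : ∀ c (t : Tree A) → ∫ c t (λ _ → 0ℚ) ≡ 0ℚ
∫-zero c t = trans (∫-*ˡ c t 0ℚ (λ _ → 0ℚ)) (ℚₚ.*-zeroˡ (∫ c t (λ _ → 0ℚ)))

∫-mono : ∀ {c} → 0ℚ ≤ℚ c → (t : Tree A) {F G : A → ℚ} → (∀ a → F a ≤ℚ G a) → ∫ c t F ≤ℚ ∫ c t G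
∫-mono 0≤c nil le = ℚₚ.≤-refl
∫-mono 0≤c (leaf a) le = le a
∫-mono 0≤c (node l r) le = *-monoˡ 0≤c (ℚₚ.+-mono-≤ (∫-mono 0≤c l le) (∫-mono 0≤c r le))

𝔼-mono : (t : Tree A) {F G : A → ℚ} → (∀ a → F a ≤ℚ G a) → 𝔼 t F ≤ℚ 𝔼 t G
𝔼-mono = ∫-mono 0≤½

∑-mono : (t : Tree A) {F G : A → ℚ} → (∀ a → F a ≤ℚ G a) → ∑ t F ≤ℚ ∑ t G
∑-mono = ∫-mono 0≤1

∫-nonneg : ∀ {c} → 0ℚ ≤ℚ c → (t : Tree A) {F : A → ℚ} → (∀ a → 0ℚ ≤ℚ F a) → 0ℚ ≤ℚ ∫ c t F
∫-nonneg {c = c} 0≤c t {F} le = subst (_≤ℚ ∫ c t F) (∫-zero c t) (∫-mono 0≤c t le)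

∑-nonneg : (t : Tree A) {F : A → ℚ} → (∀ a → 0ℚ ≤ℚ F a) → 0ℚ ≤ℚ ∑ t F
∑-nonneg = ∫-nonneg 0≤1

∫-swap : ∀ c d (t : Tree A) (u : Tree A′) (F : A → A′ → ℚ) →
  ∫ c t (λ a → ∫ d u (F a)) ≡ ∫ d u (λ b → ∫ c t (λ a → F a b))
∫-swap c d nil u F = sym (∫-zero d u)
∫-swap c d (leaf a) u F = refl
∫-swap c d (node l r) u F =
  trans (cong (c *_) (trans (cong₂ _+_ (∫-swap c d l u F) (∫-swap c d r u F)) (sym (∫-+ d u _ _))))
        (sym (∫-*ˡ d u c _))

∫-bind : ∀ c (t : Tree A) (k : A → Tree A′) (F : A′ → ℚ) → ∫ c (t >>=ᵗ k) F ≡ ∫ c t (λ a → ∫ c (k a) F)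
∫-bind c nil k F = refl
∫-bind c (leaf a) k F = refl
∫-bind c (node l r) k F = cong (c *_) (cong₂ _+_ (∫-bind c l k F) (∫-bind c r k F))

-- Sums over empty index sets require `nil`, which loses mass under 𝔼; total mass one is therefore a
-- separate property.
IsProb : Tree A → Set
IsProb t = 𝔼 t (λ _ → 1ℚ) ≡ 1ℚ

𝔼-const : (t : Tree A) → IsProb t → ∀ d → 𝔼 t (λ _ → d) ≡ d
𝔼-const t p d = trans (∫-cong ½ t (λ _ → sym (ℚₚ.*-identityʳ d)))
  (trans (∫-*ˡ ½ t d (λ _ → 1ℚ)) (trans (cong (d *_) p) (ℚₚ.*-identityʳ d)))

IsProb-bind : (t : Tree A) (k : A → Tree A′) → IsProb t → (∀ a → IsProb (k a)) → IsProb (t >>=ᵗ k)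
IsProb-bind t k p q = trans (∫-bind ½ t k _) (trans (∫-cong ½ t q) p)

𝔼-≤const : (t : Tree A) → IsProb t → ∀ {d} {F : A → ℚ} → (∀ a → F a ≤ℚ d) → 𝔼 t F ≤ℚ d
𝔼-≤const t p {d} {F} le = subst (𝔼 t F ≤ℚ_) (𝔼-const t p d) (𝔼-mono t le)

vec : Tree A → ∀ n → Tree (Vec A n)
vec t zero = leaf []
vec t (suc n) = t >>=ᵗ λ a → mapᵗ (a ∷_) (vec t n)

∫-vec : ∀ c (t : Tree A) n (F : Vec A (suc n) → ℚ) →
  ∫ c (vec t (suc n)) F ≡ ∫ c t (λ a → ∫ c (vec t n) (λ v → F (a ∷ v)))
∫-vec c t n F = trans (∫-bind c t _ F) (∫-cong c t (λ a → ∫-bind c (vec t n) _ F))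

IsProb-vec : (t : Tree A) → IsProb t → ∀ n → IsProb (vec t n)
IsProb-vec t p zero = refl
IsProb-vec t p (suc n) =
  IsProb-bind t _ p (λ a → IsProb-bind (vec t n) _ (IsProb-vec t p n) (λ _ → refl))

pairWith : (A → A′ → A″) → Tree A → Tree A′ → Tree A″
pairWith g t u = t >>=ᵗ λ a → mapᵗ (g a) u

∫-pairWith : ∀ c (g : A → A′ → A″) (t : Tree A) (u : Tree A′) F →
  ∫ c (pairWith g t u) F ≡ ∫ c t (λ a → ∫ c u (λ b → F (g a b)))
∫-pairWith c g t u F = trans (∫-bind c t _ F) (∫-cong c t (λ a → ∫-bind c u _ F))

-- Independent vectors, zipped, have the law of one vector of independent pairs. With a label and a
-- sign as the pair, the merged labelling of the second data set is again uniformly random.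
∫-zipWith : ∀ c (g : A → A′ → A″) (t : Tree A) (u : Tree A′) n (F : Vec A″ n → ℚ) →
  ∫ c (vec t n) (λ as → ∫ c (vec u n) (λ bs → F (zipWith g as bs))) ≡ ∫ c (vec (pairWith g t u) n) F
∫-zipWith c g t u zero F = refl
∫-zipWith c g t u (suc n) F =
  trans (∫-vec c t n _)
  (trans (∫-cong c t λ a → trans (∫-cong c (vec t n) λ as → ∫-vec c u n _)
     (trans (∫-swap c c (vec t n) u _)
       (∫-cong c u λ b → ∫-zipWith c g t u n (λ v → F (g a b ∷ v)))))
  (trans (sym (∫-pairWith c g t u (λ x → ∫ c (vec (pairWith g t u) n) (λ v → F (x ∷ v)))))
    (sym (∫-vec c (pairWith g t u) n F))))

flips : Tree Bool
flips = node (leaf true) (leaf false)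

bits : ∀ n → Tree (Vec Bool n)
bits = vec flips

IsProb-bits : ∀ n → IsProb (bits n)
IsProb-bits = IsProb-vec flips refl

∫-bits : ∀ c n (F : Vec Bool (suc n) → ℚ) →
  ∫ c (bits (suc n)) F ≡ c * (∫ c (bits n) (λ x → F (true ∷ x)) + ∫ c (bits n) (λ x → F (false ∷ x)))
∫-bits c n F = ∫-vec c flips n F

∑-bits : ∀ n (F : Vec Bool (suc n) → ℚ) →
  ∑ (bits (suc n)) F ≡ ∑ (bits n) (λ x → F (true ∷ x)) + ∑ (bits n) (λ x → F (false ∷ x))
∑-bits n F = trans (∫-bits 1ℚ n F) (ℚₚ.*-identityˡ _)

_==_ : Vec Bool n → Vec Bool n → Bool
U == W = does (≡-dec Boolₚ._≟_ U W)

==-refl : (U : Vec Bool n) → (U == U) ≡ true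
==-refl [] = refl
==-refl (true ∷ U) = ==-refl U
==-refl (false ∷ U) = ==-refl U

==-sound : (U W : Vec Bool n) → (U == W) ≡ true → U ≡ W
==-sound U W eq with ≡-dec Boolₚ._≟_ U W
... | yes p = p
... | no _ = case-false eq
  where
  case-false : false ≡ true → U ≡ W
  case-false ()

==-false : (U W : Vec Bool n) → U ≢ W → (U == W) ≡ false
==-false U W ne with U == W in eq
... | true = ⊥-elim (ne (==-sound U W eq))
... | false = refl

∑-point : ∀ n (W : Vec Bool n) (G : Vec Bool n → ℚ) → ∑ (bits n) (λ U → G U * 𝟙 (W == U)) ≡ G W
∑-point zero [] G = ℚₚ.*-identityʳ (G [])
∑-point (suc n) (true ∷ W) G =
  trans (∑-bits n _) (trans (cong₂ _+_ (∑-point n W (λ U → G (true ∷ U)))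
    (trans (∫-cong 1ℚ (bits n) (λ U → ℚₚ.*-zeroʳ (G (false ∷ U)))) (∫-zero 1ℚ (bits n)))) (ℚₚ.+-identityʳ _))
∑-point (suc n) (false ∷ W) G =
  trans (∑-bits n _) (trans (cong₂ _+_ (trans (∫-cong 1ℚ (bits n) (λ U → ℚₚ.*-zeroʳ (G (true ∷ U)))) (∫-zero 1ℚ (bits n)))
    (∑-point n W (λ U → G (false ∷ U)))) (ℚₚ.+-identityˡ _))

-- Fourier analysis on the cube

χ : Vec Bool n → Vec Bool n → ℚ
χ [] [] = 1ℚ
χ (b ∷ S) (x ∷ xs) = sg (b ∧ x) * χ S xs

χ-sq : (S x : Vec Bool n) → χ S x * χ S x ≡ 1ℚ
χ-sq [] [] = refl
χ-sq (b ∷ S) (x ∷ xs) = trans (interchange (sg (b ∧ x)) (χ S xs)) (cong₂ _*_ (sg-sq (b ∧ x)) (χ-sq S xs))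
  where
  interchange : ∀ a c → (a * c) * (a * c) ≡ (a * a) * (c * c)
  interchange = solve-∀ ℚ-ring

infixl 6 _⊕_
_⊕_ : Vec Bool n → Vec Bool n → Vec Bool n
_⊕_ = zipWith _xor_

χ-⊕ : (S x y : Vec Bool n) → χ S (x ⊕ y) ≡ χ S x * χ S y
χ-⊕ [] [] [] = refl
χ-⊕ (b ∷ S) (x ∷ xs) (y ∷ ys) =
  trans (cong₂ _*_ (trans (cong sg (Boolₚ.∧-distribˡ-xor b x y)) (sg-xor (b ∧ x) (b ∧ y))) (χ-⊕ S xs ys))
        (interchange (sg (b ∧ x)) (sg (b ∧ y)) (χ S xs) (χ S ys))
  where
  interchange : ∀ a b c d → (a * b) * (c * d) ≡ (a * c) * (b * d)
  interchange = solve-∀ ℚ-ring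

hat : (Vec Bool n → ℚ) → Vec Bool n → ℚ
hat {n} g S = 𝔼 (bits n) (λ x → g x * χ S x)

synth : (Vec Bool n → ℚ) → Vec Bool n → ℚ
synth {n} a x = ∑ (bits n) (λ S → a S * χ S x)

hat-∷ : ∀ (g : Vec Bool (suc n) → ℚ) c S →
  hat g (c ∷ S) ≡ ½ * (sg (c ∧ true) * hat (λ x → g (true ∷ x)) S + sg (c ∧ false) * hat (λ x → g (false ∷ x)) S)
hat-∷ {n} g c S = trans (∫-bits ½ n _) (cong (½ *_) (cong₂ _+_ (half true) (half false)))
  where
  assoc′ : ∀ u v w → u * (v * w) ≡ v * (u * w)
  assoc′ = solve-∀ ℚ-ring
  half : ∀ b → 𝔼 (bits n) (λ x → g (b ∷ x) * (sg (c ∧ b) * χ S x)) ≡ sg (c ∧ b) * hat (λ x → g (b ∷ x)) S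
  half b = trans (∫-cong ½ (bits n) (λ x → assoc′ (g (b ∷ x)) (sg (c ∧ b)) (χ S x))) (∫-*ˡ ½ (bits n) (sg (c ∧ b)) _)

synth-∷ : ∀ (a : Vec Bool (suc n) → ℚ) b x →
  synth a (b ∷ x) ≡ synth (λ S → a (false ∷ S)) x + sg b * synth (λ S → a (true ∷ S)) x
synth-∷ {n} a b x =
  trans (∑-bits n _)
  (trans (cong₂ _+_ (trans (∫-cong 1ℚ (bits n) (λ S → pull (a (true ∷ S)) (sg b) (χ S x))) (∫-*ˡ 1ℚ (bits n) (sg b) _))
                    (∫-cong 1ℚ (bits n) (λ S → cong (a (false ∷ S) *_) (ℚₚ.*-identityˡ (χ S x)))))
         (ℚₚ.+-comm (sg b * synth (λ S → a (true ∷ S)) x) (synth (λ S → a (false ∷ S)) x)))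
  where
  pull : ∀ u v w → u * (v * w) ≡ v * (u * w)
  pull = solve-∀ ℚ-ring

synth-cong : ∀ {a b : Vec Bool n → ℚ} → (∀ S → a S ≡ b S) → ∀ x → synth a x ≡ synth b x
synth-cong {n} eq x = ∫-cong 1ℚ (bits n) (λ S → cong (_* χ S x) (eq S))

synth-+ : ∀ (a b : Vec Bool n → ℚ) x → synth (λ S → a S + b S) x ≡ synth a x + synth b x
synth-+ {n} a b x = trans (∫-cong 1ℚ (bits n) (λ S → ℚₚ.*-distribʳ-+ (χ S x) (a S) (b S))) (∫-+ 1ℚ (bits n) _ _)

synth-*ˡ : ∀ d (a : Vec Bool n → ℚ) x → synth (λ S → d * a S) x ≡ d * synth a x
synth-*ˡ {n} d a x = trans (∫-cong 1ℚ (bits n) (λ S → ℚₚ.*-assoc d (a S) (χ S x))) (∫-*ˡ 1ℚ (bits n) d _)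

inversion : ∀ (g : Vec Bool n → ℚ) x → synth (hat g) x ≡ g x
inversion {zero} g [] = trans (ℚₚ.*-identityʳ _) (ℚₚ.*-identityʳ _)
inversion {suc n} g (b ∷ x) =
  trans (synth-∷ (hat g) b x)
  (trans (cong₂ (λ u v → u + sg b * v) (part false) (part true)) (finish b))
  where
  h : Bool → ℚ
  h c = g (c ∷ x)
  part : ∀ c → synth (λ S → hat g (c ∷ S)) x ≡ ½ * (sg (c ∧ true) * h true + sg (c ∧ false) * h false)
  part c =
    trans (synth-cong (hat-∷ g c) x)
    (trans (synth-*ˡ ½ (λ S → sg (c ∧ true) * ĝ true S + sg (c ∧ false) * ĝ false S) x)
    (cong (½ *_) (trans (synth-+ (λ S → sg (c ∧ true) * ĝ true S) (λ S → sg (c ∧ false) * ĝ false S) x)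
      (cong₂ _+_ (trans (synth-*ˡ (sg (c ∧ true)) (ĝ true) x) (cong (sg (c ∧ true) *_) (inversion (λ y → g (true ∷ y)) x)))
                 (trans (synth-*ˡ (sg (c ∧ false)) (ĝ false) x) (cong (sg (c ∧ false) *_) (inversion (λ y → g (false ∷ y)) x)))))))
    where
    ĝ : Bool → Vec Bool n → ℚ
    ĝ d = hat (λ y → g (d ∷ y))
  eq-t : ∀ u v → ½ * (1ℚ * u + 1ℚ * v) + (- 1ℚ) * (½ * ((- 1ℚ) * u + 1ℚ * v)) ≡ u
  eq-t = solve-∀ ℚ-ring
  eq-f : ∀ u v → ½ * (1ℚ * u + 1ℚ * v) + 1ℚ * (½ * ((- 1ℚ) * u + 1ℚ * v)) ≡ v
  eq-f = solve-∀ ℚ-ring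
  finish : ∀ b → ½ * (sg (false ∧ true) * h true + sg (false ∧ false) * h false)
                 + sg b * (½ * (sg (true ∧ true) * h true + sg (true ∧ false) * h false)) ≡ h b
  finish true = eq-t (h true) (h false)
  finish false = eq-f (h true) (h false)

χ-orthogonal : (U W : Vec Bool n) → 𝔼 (bits n) (λ y → χ U y * χ W y) ≡ 𝟙 (W == U)
χ-orthogonal [] [] = refl
χ-orthogonal {suc n} (u ∷ U) (w ∷ W) =
  trans (∫-bits ½ n _) (trans (cong (½ *_) (cong₂ _+_ (half true) (half false))) (finish u w))
  where
  c : Bool → ℚ
  c b = sg (u ∧ b) * sg (w ∧ b)
  shuffle : ∀ p q r s → (p * q) * (r * s) ≡ (p * r) * (q * s)
  shuffle = solve-∀ ℚ-ring
  half : ∀ b → 𝔼 (bits n) (λ y → (sg (u ∧ b) * χ U y) * (sg (w ∧ b) * χ W y)) ≡ c b * 𝟙 (W == U)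
  half b = trans (∫-cong ½ (bits n) (λ y → shuffle (sg (u ∧ b)) (χ U y) (sg (w ∧ b)) (χ W y)))
    (trans (∫-*ˡ ½ (bits n) (c b) _) (cong (c b *_) (χ-orthogonal U W)))
  same : ∀ z → ½ * (1ℚ * z + 1ℚ * z) ≡ z
  same = solve-∀ ℚ-ring
  diff : ∀ z → ½ * ((- 1ℚ) * z + 1ℚ * z) ≡ 0ℚ
  diff = solve-∀ ℚ-ring
  finish : ∀ u w → ½ * ((sg (u ∧ true) * sg (w ∧ true)) * 𝟙 (W == U) + (sg (u ∧ false) * sg (w ∧ false)) * 𝟙 (W == U))
    ≡ 𝟙 ((w ∷ W) == (u ∷ U))
  finish true true = same (𝟙 (W == U))
  finish true false = diff (𝟙 (W == U))
  finish false true = diff (𝟙 (W == U))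
  finish false false = same (𝟙 (W == U))

𝔼-synth-sq : (a : Vec Bool n → ℚ) → 𝔼 (bits n) (λ s → synth a s * synth a s) ≡ ∑ (bits n) (λ S → a S * a S)
𝔼-synth-sq {zero} a = cong₂ _*_ (ℚₚ.*-identityʳ (a [])) (ℚₚ.*-identityʳ (a []))
𝔼-synth-sq {suc n} a =
  trans (∫-bits ½ n _)
  (trans (cong (½ *_) (sym (∫-+ ½ (bits n) _ _)))
  (trans (sym (∫-*ˡ ½ (bits n) ½ _))
  (trans (∫-cong ½ (bits n) pointwise)
  (trans (∫-+ ½ (bits n) (λ s → r s * r s) (λ s → q s * q s))
  (trans (cong₂ _+_ (𝔼-synth-sq (λ S → a (true ∷ S))) (𝔼-synth-sq (λ S → a (false ∷ S))))
  (sym (∑-bits n _)))))))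
  where
  q r : Vec Bool n → ℚ
  q = synth (λ S → a (false ∷ S))
  r = synth (λ S → a (true ∷ S))
  parallelogram : ∀ q r → ½ * ((q + (- 1ℚ) * r) * (q + (- 1ℚ) * r) + (q + 1ℚ * r) * (q + 1ℚ * r)) ≡ r * r + q * q
  parallelogram = solve-∀ ℚ-ring
  pointwise : ∀ s → ½ * (synth a (true ∷ s) * synth a (true ∷ s) + synth a (false ∷ s) * synth a (false ∷ s)) ≡ r s * r s + q s * q s
  pointwise s = trans (cong₂ (λ u v → ½ * (u * u + v * v)) (synth-∷ a true s) (synth-∷ a false s)) (parallelogram (q s) (r s))

parseval : (g : Vec Bool n → ℚ) → ∑ (bits n) (λ S → hat g S * hat g S) ≡ 𝔼 (bits n) (λ x → g x * g x)
parseval {n} g = trans (sym (𝔼-synth-sq (hat g))) (∫-cong ½ (bits n) (λ x → cong₂ _*_ (inversion g x) (inversion g x)))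

-- Hypercontractivity

3ℚ : ℚ
3ℚ = + 3 / 1

3^∣_∣ : Vec Bool n → ℚ
3^∣ [] ∣ = 1ℚ
3^∣ true ∷ S ∣ = 3ℚ * 3^∣ S ∣
3^∣ false ∷ S ∣ = 3^∣ S ∣

-- The squared 2-norm of the function that the noise operator of rate 1/√3 sends to `synth a`.
norm₃ : (Vec Bool n → ℚ) → ℚ
norm₃ {n} a = ∑ (bits n) (λ S → 3^∣ S ∣ * (a S * a S))

norm₃-∷ : (a : Vec Bool (suc n) → ℚ) → norm₃ a ≡ 3ℚ * norm₃ (λ S → a (true ∷ S)) + norm₃ (λ S → a (false ∷ S))
norm₃-∷ {n} a = trans (∑-bits n _) (cong (_+ norm₃ (λ S → a (false ∷ S)))
  (trans (∫-cong 1ℚ (bits n) (λ S → ℚₚ.*-assoc 3ℚ (3^∣ S ∣) (a (true ∷ S) * a (true ∷ S)))) (∫-*ˡ 1ℚ (bits n) 3ℚ _)))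

0≤3ℚ : 0ℚ ≤ℚ 3ℚ
0≤3ℚ = ℚₚ.nonNegative⁻¹ 3ℚ

0≤3^ : (S : Vec Bool n) → 0ℚ ≤ℚ 3^∣ S ∣
0≤3^ [] = 0≤1
0≤3^ (true ∷ S) = 0≤-* 0≤3ℚ (0≤3^ S)
0≤3^ (false ∷ S) = 0≤3^ S

0≤norm₃ : (a : Vec Bool n → ℚ) → 0ℚ ≤ℚ norm₃ a
0≤norm₃ {n} a = ∑-nonneg (bits n) (λ S → 0≤-* (0≤3^ S) (0≤-sq (a S)))

-- Bonami's (2,4)-hypercontractive inequality, polarised so that the induction on n needs no Cauchy–Schwarz.
bonami : (a b : Vec Bool n → ℚ) →
  𝔼 (bits n) (λ s → (synth a s * synth a s) * (synth b s * synth b s)) ≤ℚ norm₃ a * norm₃ b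
bonami {zero} a b = ℚₚ.≤-reflexive (unit (a []) (b []))
  where
  unit : ∀ u v → ((u * 1ℚ) * (u * 1ℚ)) * ((v * 1ℚ) * (v * 1ℚ)) ≡ (1ℚ * (u * u)) * (1ℚ * (v * v))
  unit = solve-∀ ℚ-ring
bonami {suc n} a b = begin
  𝔼 (bits (suc n)) (λ s → (synth a s * synth a s) * (synth b s * synth b s))
    ≡⟨ trans (∫-bits ½ n _) (trans (cong (½ *_) (sym (∫-+ ½ (bits n) _ _))) (sym (∫-*ˡ ½ (bits n) ½ _))) ⟩
  𝔼 (bits n) (λ s → ½ * (F (true ∷ s) + F (false ∷ s)))
    ≤⟨ 𝔼-mono (bits n) pointwise ⟩
  𝔼 (bits n) (λ s → (q0r0 s + 3ℚ * q0r1 s) + (3ℚ * q1r0 s + q1r1 s))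
    ≡⟨ trans (∫-+ ½ (bits n) _ _) (cong₂ _+_
         (trans (∫-+ ½ (bits n) _ _) (cong (λ z → 𝔼 (bits n) q0r0 + z) (∫-*ˡ ½ (bits n) 3ℚ q0r1)))
         (trans (∫-+ ½ (bits n) _ _) (cong (λ z → z + 𝔼 (bits n) q1r1) (∫-*ˡ ½ (bits n) 3ℚ q1r0)))) ⟩
  (𝔼 (bits n) q0r0 + 3ℚ * 𝔼 (bits n) q0r1) + (3ℚ * 𝔼 (bits n) q1r0 + 𝔼 (bits n) q1r1)
    ≤⟨ ℚₚ.+-mono-≤ (ℚₚ.+-mono-≤ (bonami a0 b0) (*-monoˡ 0≤3ℚ (bonami a0 b1)))
                   (ℚₚ.+-mono-≤ (*-monoˡ 0≤3ℚ (bonami a1 b0)) (bonami a1 b1)) ⟩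
  (A0 * B0 + 3ℚ * (A0 * B1)) + (3ℚ * (A1 * B0) + A1 * B1)
    -- The product on the right offers 9 times A1 * B1, and only one copy is used.
    ≤⟨ ≤-via (8ℚ * (A1 * B1)) (expand A0 A1 B0 B1) (0≤-* (ℚₚ.nonNegative⁻¹ 8ℚ) (0≤-* (0≤norm₃ a1) (0≤norm₃ b1))) ⟩
  (3ℚ * A1 + A0) * (3ℚ * B1 + B0)
    ≡⟨ sym (cong₂ _*_ (norm₃-∷ a) (norm₃-∷ b)) ⟩
  norm₃ a * norm₃ b ∎
  where
  open ℚₚ.≤-Reasoning
  a0 a1 b0 b1 q0 q1 r0 r1 q0r0 q0r1 q1r0 q1r1 : Vec Bool n → ℚ
  a0 S = a (false ∷ S)
  a1 S = a (true ∷ S)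
  b0 S = b (false ∷ S)
  b1 S = b (true ∷ S)
  q0 = synth a0
  q1 = synth a1
  r0 = synth b0
  r1 = synth b1
  q0r0 s = (q0 s * q0 s) * (r0 s * r0 s)
  q0r1 s = (q0 s * q0 s) * (r1 s * r1 s)
  q1r0 s = (q1 s * q1 s) * (r0 s * r0 s)
  q1r1 s = (q1 s * q1 s) * (r1 s * r1 s)
  A0 A1 B0 B1 8ℚ 2ℚ : ℚ
  A0 = norm₃ a0
  A1 = norm₃ a1
  B0 = norm₃ b0
  B1 = norm₃ b1
  8ℚ = + 8 / 1
  2ℚ = + 2 / 1
  F : Vec Bool (suc n) → ℚ
  F s = (synth a s * synth a s) * (synth b s * synth b s)
  expand : ∀ A0 A1 B0 B1 → (3ℚ * A1 + A0) * (3ℚ * B1 + B0)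
    ≡ ((A0 * B0 + 3ℚ * (A0 * B1)) + (3ℚ * (A1 * B0) + A1 * B1)) + (+ 8 / 1) * (A1 * B1)
  expand = solve-∀ ℚ-ring
  -- Averaging over the first sign leaves (p² + q²)(r² + t²) + 4pqrt. The mixed term is at most
  -- 2(p²t² + q²r²), with defect 2(pt - qr)².
  slack : ∀ p q r t →
    ((p * p) * (r * r) + 3ℚ * ((p * p) * (t * t))) + (3ℚ * ((q * q) * (r * r)) + (q * q) * (t * t))
    ≡ ½ * (((p + (- 1ℚ) * q) * (p + (- 1ℚ) * q)) * ((r + (- 1ℚ) * t) * (r + (- 1ℚ) * t))
           + ((p + 1ℚ * q) * (p + 1ℚ * q)) * ((r + 1ℚ * t) * (r + 1ℚ * t)))
      + (+ 2 / 1) * ((p * t - q * r) * (p * t - q * r))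
  slack = solve-∀ ℚ-ring
  split : ∀ c s → F (c ∷ s) ≡ ((q0 s + sg c * q1 s) * (q0 s + sg c * q1 s)) * ((r0 s + sg c * r1 s) * (r0 s + sg c * r1 s))
  split c s = cong₂ (λ u v → (u * u) * (v * v)) (synth-∷ a c s) (synth-∷ b c s)
  pointwise : ∀ s → ½ * (F (true ∷ s) + F (false ∷ s)) ≤ℚ (q0r0 s + 3ℚ * q0r1 s) + (3ℚ * q1r0 s + q1r1 s)
  pointwise s = ≤-via (2ℚ * (d * d))
    (trans (slack (q0 s) (q1 s) (r0 s) (r1 s)) (cong (_+ 2ℚ * (d * d)) (cong (½ *_) (sym (cong₂ _+_ (split true s) (split false s))))))
    (0≤-* (ℚₚ.nonNegative⁻¹ 2ℚ) (0≤-sq d))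
    where
    d = q0 s * r1 s - q1 s * r0 s

-- Natural numbers in ℚ, weights, sums over labels

ℕ→ℚ-+ : ∀ m n → ℕ→ℚ (m ℕ.+ n) ≡ ℕ→ℚ m + ℕ→ℚ n
ℕ→ℚ-+ m n = ℚₚ.toℚᵘ-injective (ℚᵘₚ.≃-trans (ℚₚ.toℚᵘ-fromℚᵘ (ℚᵘ.mkℚᵘ (+ (m ℕ.+ n)) 0))
  (ℚᵘₚ.≃-trans (ℚᵘ.*≡* (cong (λ z → z ℤ.* + 1) (sym (cong₂ ℤ._+_ (ℤₚ.*-identityʳ (+ m)) (ℤₚ.*-identityʳ (+ n))))))
  (ℚᵘₚ.≃-trans (ℚᵘₚ.+-cong (ℚᵘₚ.≃-sym (ℚₚ.toℚᵘ-fromℚᵘ (ℚᵘ.mkℚᵘ (+ m) 0))) (ℚᵘₚ.≃-sym (ℚₚ.toℚᵘ-fromℚᵘ (ℚᵘ.mkℚᵘ (+ n) 0))))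
  (ℚᵘₚ.≃-sym (ℚₚ.toℚᵘ-homo-+ (ℕ→ℚ m) (ℕ→ℚ n))))))

ℕ→ℚ-* : ∀ m n → ℕ→ℚ (m ℕ.* n) ≡ ℕ→ℚ m * ℕ→ℚ n
ℕ→ℚ-* m n = ℚₚ.toℚᵘ-injective (ℚᵘₚ.≃-trans (ℚₚ.toℚᵘ-fromℚᵘ (ℚᵘ.mkℚᵘ (+ (m ℕ.* n)) 0))
  (ℚᵘₚ.≃-trans (ℚᵘ.*≡* (cong (λ z → z ℤ.* + 1) (ℤₚ.pos-* m n)))
  (ℚᵘₚ.≃-trans (ℚᵘₚ.*-cong (ℚᵘₚ.≃-sym (ℚₚ.toℚᵘ-fromℚᵘ (ℚᵘ.mkℚᵘ (+ m) 0))) (ℚᵘₚ.≃-sym (ℚₚ.toℚᵘ-fromℚᵘ (ℚᵘ.mkℚᵘ (+ n) 0))))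
  (ℚᵘₚ.≃-sym (ℚₚ.toℚᵘ-homo-* (ℕ→ℚ m) (ℕ→ℚ n))))))

ℕ→ℚ-suc : ∀ m → ℕ→ℚ (suc m) ≡ 1ℚ + ℕ→ℚ m
ℕ→ℚ-suc m = ℕ→ℚ-+ 1 m

0≤ℕ→ℚ : ∀ m → 0ℚ ≤ℚ ℕ→ℚ m
0≤ℕ→ℚ zero = ℚₚ.≤-refl
0≤ℕ→ℚ (suc m) = subst (0ℚ ≤ℚ_) (sym (ℕ→ℚ-suc m)) (0≤-+ 0≤1 (0≤ℕ→ℚ m))

ℕ→ℚ-mono : ∀ {m n} → m ≤ n → ℕ→ℚ m ≤ℚ ℕ→ℚ n
ℕ→ℚ-mono {m} {n} m≤n =
  ≤-via (ℕ→ℚ (n ℕ.∸ m)) (trans (cong ℕ→ℚ (sym (ℕₚ.m+[n∸m]≡n m≤n))) (ℕ→ℚ-+ m (n ℕ.∸ m))) (0≤ℕ→ℚ (n ℕ.∸ m))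

fins : ∀ L → Tree (Fin L)
fins zero = nil
fins (suc L) = node (leaf zero) (mapᵗ suc (fins L))

∑-fins : ∀ L (F : Fin (suc L) → ℚ) → ∑ (fins (suc L)) F ≡ F zero + ∑ (fins L) (λ i → F (suc i))
∑-fins L F = trans (ℚₚ.*-identityˡ (F zero + ∑ (mapᵗ suc (fins L)) F)) (cong (λ z → F zero + z) (∫-bind 1ℚ (fins L) (λ i → leaf (suc i)) F))

weight : Vec Bool n → ℕ
weight [] = 0
weight (true ∷ S) = suc (weight S)
weight (false ∷ S) = weight S

∑-lookup : (v : Vec Bool L) → ∑ (fins L) (λ i → 𝟙 (lookup v i)) ≡ ℕ→ℚ (weight v)
∑-lookup [] = refl
∑-lookup {suc L} (true ∷ v) = trans (∑-fins L (λ i → 𝟙 (lookup (true ∷ v) i))) (trans (cong (λ z → 1ℚ + z) (∑-lookup v)) (sym (ℕ→ℚ-suc (weight v))))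
∑-lookup {suc L} (false ∷ v) = trans (∑-fins L (λ i → 𝟙 (lookup (false ∷ v) i))) (trans (cong (λ z → 0ℚ + z) (∑-lookup v)) (ℚₚ.+-identityˡ _))

_≟ᵇ_ : Fin L → Fin L → Bool
i ≟ᵇ j = does (i Fin.≟ j)

∑-fin-point : ∀ L (w : Fin L) (G : Fin L → ℚ) → ∑ (fins L) (λ i → G i * 𝟙 (w ≟ᵇ i)) ≡ G w
∑-fin-point (suc L) zero G =
  trans (∑-fins L (λ i → G i * 𝟙 (zero ≟ᵇ i))) (trans (cong₂ _+_ (ℚₚ.*-identityʳ (G zero))
    (trans (∫-cong 1ℚ (fins L) (λ i → ℚₚ.*-zeroʳ (G (suc i)))) (∫-zero 1ℚ (fins L)))) (ℚₚ.+-identityʳ (G zero)))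
∑-fin-point (suc L) (suc w) G =
  trans (∑-fins L (λ i → G i * 𝟙 (suc w ≟ᵇ i))) (trans (cong₂ _+_ (ℚₚ.*-zeroʳ (G zero)) (∑-fin-point L w (λ i → G (suc i)))) (ℚₚ.+-identityˡ (G (suc w))))

-- Folding sets of coordinates along a labelling

flipIf : Bool → Fin L → Vec Bool L → Vec Bool L
flipIf b w v = updateAt v w (b xor_)

-- The labels that occur an odd number of times on S.
push : Vec (Fin L) n → Vec Bool n → Vec Bool L
push [] [] = replicate _ false
push (w ∷ φ) (b ∷ S) = flipIf b w (push φ S)

gather : Vec (Fin L) n → Vec Bool L → Vec Bool n
gather φ y = map (lookup y) φ

χ-∅ : (y : Vec Bool L) → χ (replicate L false) y ≡ 1ℚ
χ-∅ [] = refl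
χ-∅ (y ∷ ys) = trans (ℚₚ.*-identityˡ _) (χ-∅ ys)

χ-flipIf : ∀ b (w : Fin L) v y → χ (flipIf b w v) y ≡ sg (b ∧ lookup y w) * χ v y
χ-flipIf b zero (c ∷ v) (y ∷ ys) =
  trans (cong (_* χ v ys) (trans (cong sg (Boolₚ.∧-distribʳ-xor y b c)) (sg-xor (b ∧ y) (c ∧ y))))
        (ℚₚ.*-assoc (sg (b ∧ y)) (sg (c ∧ y)) (χ v ys))
χ-flipIf b (suc w) (c ∷ v) (y ∷ ys) =
  trans (cong (sg (c ∧ y) *_) (χ-flipIf b w v ys)) (pull (sg (c ∧ y)) (sg (b ∧ lookup ys w)) (χ v ys))
  where
  pull : ∀ u v w → u * (v * w) ≡ v * (u * w)
  pull = solve-∀ ℚ-ring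

χ-push : (φ : Vec (Fin L) n) (S : Vec Bool n) (y : Vec Bool L) → χ (push φ S) y ≡ χ S (gather φ y)
χ-push [] [] y = χ-∅ y
χ-push (w ∷ φ) (b ∷ S) y = trans (χ-flipIf b w (push φ S) y) (cong (sg (b ∧ lookup y w) *_) (χ-push φ S y))

flipIf-false : ∀ (w : Fin L) v → flipIf false w v ≡ v
flipIf-false zero (x ∷ v) = refl
flipIf-false (suc w) (x ∷ v) = cong (x ∷_) (flipIf-false w v)

flipIf-comm : ∀ b c (i j : Fin L) v → flipIf b i (flipIf c j v) ≡ flipIf c j (flipIf b i v)
flipIf-comm b c zero zero (x ∷ v) = cong (_∷ v) (xor-swap b c x)
  where
  xor-swap : ∀ b c x → b xor (c xor x) ≡ c xor (b xor x)
  xor-swap true true x = refl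
  xor-swap true false x = refl
  xor-swap false true x = refl
  xor-swap false false x = refl
flipIf-comm b c zero (suc j) (x ∷ v) = refl
flipIf-comm b c (suc i) zero (x ∷ v) = refl
flipIf-comm b c (suc i) (suc j) (x ∷ v) = cong (x ∷_) (flipIf-comm b c i j v)

flipIf-merge : ∀ b c (i : Fin L) v → flipIf (b xor c) i v ≡ flipIf b i (flipIf c i v)
flipIf-merge b c zero (x ∷ v) = cong (_∷ v) (Boolₚ.xor-assoc b c x)
flipIf-merge b c (suc i) (x ∷ v) = cong (x ∷_) (flipIf-merge b c i v)

push-flipIf : ∀ (φ : Vec (Fin L) n) b i S → push φ (flipIf b i S) ≡ flipIf b (lookup φ i) (push φ S)
push-flipIf (w ∷ φ) b zero (c ∷ S) = flipIf-merge b c w (push φ S)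
push-flipIf (w ∷ φ) b (suc i) (c ∷ S) =
  trans (cong (flipIf c w) (push-flipIf φ b i S)) (flipIf-comm c b w (lookup φ i) (push φ S))

push-∅ : (φ : Vec (Fin L) n) → push φ (replicate n false) ≡ replicate L false
push-∅ [] = refl
push-∅ (w ∷ φ) = trans (flipIf-false w _) (push-∅ φ)

-- A choice ι of k coordinates is itself a labelling, of k points by coordinates, and for injective
-- ι the set `push ι V` is the image of V. Folding is functorial, so folding this image depends only
-- on the labels of the chosen coordinates.
push-push : ∀ {k} (φ : Vec (Fin L) n) (ι : Vec (Fin n) k) V → push φ (push ι V) ≡ push (map (lookup φ) ι) V
push-push φ [] [] = push-∅ φ
push-push φ (i ∷ ι) (b ∷ V) = trans (push-flipIf φ b i (push ι V)) (cong (flipIf b (lookup φ i)) (push-push φ ι V))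

flipIf-⊕ : ∀ b c (w : Fin L) u v → flipIf (b xor c) w (u ⊕ v) ≡ flipIf b w u ⊕ flipIf c w v
flipIf-⊕ b c zero (x ∷ u) (y ∷ v) = cong (_∷ (u ⊕ v)) (interchange b c x y)
  where
  interchange : ∀ b c x y → (b xor c) xor (x xor y) ≡ (b xor x) xor (c xor y)
  interchange true true true y = refl
  interchange true true false y = sym (Boolₚ.not-involutive y)
  interchange true false true y = Boolₚ.not-involutive y
  interchange true false false y = refl
  interchange false true true y = refl
  interchange false true false y = refl
  interchange false false true y = refl
  interchange false false false y = refl
flipIf-⊕ b c (suc w) (x ∷ u) (y ∷ v) = cong ((x xor y) ∷_) (flipIf-⊕ b c w u v)

∅-⊕-∅ : ∀ L → replicate L false ≡ replicate L false ⊕ replicate L false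
∅-⊕-∅ zero = refl
∅-⊕-∅ (suc L) = cong (false ∷_) (∅-⊕-∅ L)

push-⊕ : (φ : Vec (Fin L) n) (S T : Vec Bool n) → push φ (S ⊕ T) ≡ push φ S ⊕ push φ T
push-⊕ [] [] [] = ∅-⊕-∅ _
push-⊕ (w ∷ φ) (b ∷ S) (c ∷ T) = trans (cong (flipIf (b xor c) w) (push-⊕ φ S T)) (flipIf-⊕ b c w (push φ S) (push φ T))

weight-flip-set : ∀ (w : Fin L) v → lookup v w ≡ true → suc (weight (flipIf true w v)) ≡ weight v
weight-flip-set zero (true ∷ v) eq = refl
weight-flip-set (suc w) (true ∷ v) eq = cong suc (weight-flip-set w v eq)
weight-flip-set (suc w) (false ∷ v) eq = weight-flip-set w v eq

weight-flip-unset : ∀ (w : Fin L) v → lookup v w ≡ false → weight (flipIf true w v) ≡ suc (weight v)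
weight-flip-unset zero (false ∷ v) eq = refl
weight-flip-unset (suc w) (true ∷ v) eq = cong suc (weight-flip-unset w v eq)
weight-flip-unset (suc w) (false ∷ v) eq = weight-flip-unset w v eq

weight-∅ : ∀ L → weight (replicate L false) ≡ 0
weight-∅ zero = refl
weight-∅ (suc L) = weight-∅ L

weight-push : (φ : Vec (Fin L) n) (S : Vec Bool n) → weight (push φ S) ≤ weight S
weight-push {L} [] [] = ℕₚ.≤-reflexive (weight-∅ L)
weight-push (w ∷ φ) (false ∷ S) = subst (λ v → weight v ≤ weight S) (sym (flipIf-false w (push φ S))) (weight-push φ S)
weight-push (w ∷ φ) (true ∷ S) with lookup (push φ S) w in eq
... | true = ℕₚ.≤-trans (ℕₚ.n≤1+n _) (ℕₚ.≤-trans (ℕₚ.≤-reflexive (weight-flip-set w (push φ S) eq))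
               (ℕₚ.≤-trans (weight-push φ S) (ℕₚ.n≤1+n _)))
... | false = ℕₚ.≤-trans (ℕₚ.≤-reflexive (weight-flip-unset w (push φ S) eq)) (s≤s (weight-push φ S))

weight≤ : (v : Vec Bool n) → weight v ≤ n
weight≤ [] = z≤n
weight≤ (true ∷ v) = s≤s (weight≤ v)
weight≤ (false ∷ v) = ℕₚ.m≤n⇒m≤1+n (weight≤ v)

true≢false : ∀ {A : Set} → true ≡ false → A
true≢false ()

lookup-∅ : ∀ (w : Fin L) → lookup (replicate L false) w ≡ false
lookup-∅ zero = refl
lookup-∅ (suc w) = lookup-∅ w

push-witness : ∀ (φ : Vec (Fin L) n) S w → lookup (push φ S) w ≡ true → ∃ λ j → lookup S j ≡ true × lookup φ j ≡ w
push-witness [] [] w eq = true≢false (trans (sym eq) (lookup-∅ w))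
push-witness (w′ ∷ φ) (b ∷ S) w eq with w′ Fin.≟ w | b in b-eq
... | yes refl | true = zero , refl , refl
... | yes refl | false with push-witness φ S w (trans (sym (lookup∘updateAt w (push φ S))) eq)
...   | j , j∈S , φj≡w = suc j , j∈S , φj≡w
push-witness (w′ ∷ φ) (b ∷ S) w eq | no w′≢w | _
  with push-witness φ S w (trans (sym (lookup∘updateAt′ w w′ (w′≢w ∘ sym) (push φ S))) eq)
... | j , j∈S , φj≡w = suc j , j∈S , φj≡w

-- A label carried by a single element of S occurs once, hence an odd number of times.
push-hit : ∀ (φ : Vec (Fin L) n) S i → lookup S i ≡ true →
  (∀ j → lookup S j ≡ true → lookup φ j ≡ lookup φ i → j ≡ i) → lookup (push φ S) (lookup φ i) ≡ true
push-hit (w ∷ φ) (true ∷ S) zero refl uniq with lookup (push φ S) w in eq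
... | false = trans (lookup∘updateAt w (push φ S)) (cong not eq)
... | true with push-witness φ S w eq
...   | j , j∈S , φj≡w with uniq (suc j) j∈S φj≡w
...     | ()
push-hit (w ∷ φ) (false ∷ S) (suc i) i∈S uniq =
  trans (cong (λ v → lookup v (lookup φ i)) (flipIf-false w (push φ S)))
        (push-hit φ S i i∈S (λ j j∈S eq → Finₚ.suc-injective (uniq (suc j) j∈S eq)))
push-hit (w ∷ φ) (true ∷ S) (suc i) i∈S uniq =
  trans (lookup∘updateAt′ (lookup φ i) w distinct (push φ S))
        (push-hit φ S i i∈S (λ j j∈S eq → Finₚ.suc-injective (uniq (suc j) j∈S eq)))
  where
  distinct : lookup φ i ≢ w
  distinct eq with uniq zero refl (sym eq)
  ... | ()

InjectiveOn : (Fin n → Bool) → Vec (Fin L) n → Set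
InjectiveOn A φ = ∀ i j → A i ≡ true → A j ≡ true → lookup φ i ≡ lookup φ j → i ≡ j

_⊆_ : Vec Bool n → (Fin n → Bool) → Set
S ⊆ A = ∀ i → lookup S i ≡ true → A i ≡ true

bits-ext : (S T : Vec Bool n) → (∀ i → lookup S i ≡ true → lookup T i ≡ true) →
  (∀ i → lookup T i ≡ true → lookup S i ≡ true) → S ≡ T
bits-ext [] [] f g = refl
bits-ext (s ∷ S) (t ∷ T) f g = cong₂ _∷_ (heads s t (f zero) (g zero)) (bits-ext S T (λ i → f (suc i)) (λ i → g (suc i)))
  where
  heads : ∀ s t → (s ≡ true → t ≡ true) → (t ≡ true → s ≡ true) → s ≡ t
  heads true true f g = refl
  heads true false f g = sym (f refl)
  heads false true f g = g refl
  heads false false f g = refl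

-- Every element of S leaves its label in the folded set; in T that label must come from an element
-- of A, and injectivity on A makes it the same element.
push-injective : ∀ {A} (φ : Vec (Fin L) n) → InjectiveOn A φ → ∀ S T → S ⊆ A → T ⊆ A → push φ S ≡ push φ T → S ≡ T
push-injective {A = A} φ inj S T S⊆A T⊆A eq = bits-ext S T (half S T S⊆A T⊆A eq) (half T S T⊆A S⊆A (sym eq))
  where
  half : ∀ S T → S ⊆ A → T ⊆ A → push φ S ≡ push φ T → ∀ i → lookup S i ≡ true → lookup T i ≡ true
  half S T S⊆A T⊆A eq i i∈S
    with push-witness φ T (lookup φ i)
           (subst (λ U → lookup U (lookup φ i) ≡ true) eq
             (push-hit φ S i i∈S (λ j j∈S → inj j i (S⊆A j j∈S) (S⊆A i i∈S))))
  ... | j , j∈T , φj≡φi with inj j i (T⊆A j j∈T) (S⊆A i i∈S) φj≡φi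
  ...   | refl = j∈T

push-agree : ∀ (φ ψ : Vec (Fin L) n) S → (∀ i → lookup S i ≡ true → lookup φ i ≡ lookup ψ i) → push φ S ≡ push ψ S
push-agree [] [] [] agree = refl
push-agree (v ∷ φ) (w ∷ ψ) (true ∷ S) agree = cong₂ (flipIf true) (agree zero refl) (push-agree φ ψ S (λ i → agree (suc i)))
push-agree (v ∷ φ) (w ∷ ψ) (false ∷ S) agree =
  trans (flipIf-false v _) (trans (push-agree φ ψ S (λ i → agree (suc i))) (sym (flipIf-false w _)))

χ-agree : ∀ (S x y : Vec Bool n) → (∀ i → lookup S i ≡ true → lookup x i ≡ lookup y i) → χ S x ≡ χ S y
χ-agree [] [] [] agree = refl
χ-agree (true ∷ S) (x ∷ xs) (y ∷ ys) agree = cong₂ (λ b z → sg b * z) (agree zero refl) (χ-agree S xs ys (λ i → agree (suc i)))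
χ-agree (false ∷ S) (x ∷ xs) (y ∷ ys) agree = cong (1ℚ *_) (χ-agree S xs ys (λ i → agree (suc i)))

⊕-self : (U : Vec Bool n) → weight (U ⊕ U) ≡ 0
⊕-self [] = refl
⊕-self (true ∷ U) = ⊕-self U
⊕-self (false ∷ U) = ⊕-self U

⊕-distinct : (S T : Vec Bool n) → S ≢ T → 1 ≤ weight (S ⊕ T)
⊕-distinct [] [] ne = ⊥-elim (ne refl)
⊕-distinct (true ∷ S) (true ∷ T) ne = ⊕-distinct S T (λ eq → ne (cong (true ∷_) eq))
⊕-distinct (true ∷ S) (false ∷ T) ne = s≤s z≤n
⊕-distinct (false ∷ S) (true ∷ T) ne = s≤s z≤n
⊕-distinct (false ∷ S) (false ∷ T) ne = ⊕-distinct S T (λ eq → ne (cong (false ∷_) eq))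

-- Random labels: loss of weight and collisions

module RandomLabels (R : Tree (Fin L)) (R-prob : IsProb R) (p : ℚ) (0≤p : 0ℚ ≤ℚ p)
                    (R-point : ∀ w → 𝔼 R (λ v → 𝟙 (v ≟ᵇ w)) ≤ℚ p) where

  𝔼-lookup : (v : Vec Bool L) → 𝔼 R (λ w → 𝟙 (lookup v w)) ≤ℚ ℕ→ℚ (weight v) * p
  𝔼-lookup v = begin
    𝔼 R (λ w → 𝟙 (lookup v w))
      ≡⟨ ∫-cong ½ R (λ w → sym (∑-fin-point L w (λ i → 𝟙 (lookup v i)))) ⟩
    𝔼 R (λ w → ∑ (fins L) (λ i → 𝟙 (lookup v i) * 𝟙 (w ≟ᵇ i)))
      ≡⟨ ∫-swap ½ 1ℚ R (fins L) (λ w i → 𝟙 (lookup v i) * 𝟙 (w ≟ᵇ i)) ⟩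
    ∑ (fins L) (λ i → 𝔼 R (λ w → 𝟙 (lookup v i) * 𝟙 (w ≟ᵇ i)))
      ≡⟨ ∫-cong 1ℚ (fins L) (λ i → ∫-*ˡ ½ R (𝟙 (lookup v i)) (λ w → 𝟙 (w ≟ᵇ i))) ⟩
    ∑ (fins L) (λ i → 𝟙 (lookup v i) * 𝔼 R (λ w → 𝟙 (w ≟ᵇ i)))
      ≤⟨ ∑-mono (fins L) (λ i → *-monoˡ (0≤𝟙 (lookup v i)) (R-point i)) ⟩
    ∑ (fins L) (λ i → 𝟙 (lookup v i) * p)
      ≡⟨ trans (∫-*ʳ 1ℚ (fins L) p (λ i → 𝟙 (lookup v i))) (cong (_* p) (∑-lookup v)) ⟩
    ℕ→ℚ (weight v) * p ∎
    where open ℚₚ.≤-Reasoning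

  private
    -- A fresh label raises the weight by one and a repeated one lowers it. The cap
    -- `weight v ≤ᵇ suc κ` is kept in the second case because the new label is then one of at most κ
    -- + 1, however large S is.
    step : ∀ κ (v : Vec Bool L) (w : Fin L) →
      𝟙 (weight (flipIf true w v) ℕ.<ᵇ suc κ) ≤ℚ 𝟙 (weight v ℕ.<ᵇ κ) + 𝟙 (weight v ℕ.≤ᵇ suc κ) * 𝟙 (lookup v w)
    step κ v w with lookup v w in eq
    ... | false = ℚₚ.≤-reflexive (trans (cong (λ m → 𝟙 (m ℕ.<ᵇ suc κ)) (weight-flip-unset w v eq))
                    (sym (trans (cong (λ z → 𝟙 (weight v ℕ.<ᵇ κ) + z) (ℚₚ.*-zeroʳ (𝟙 (weight v ℕ.≤ᵇ suc κ)))) (ℚₚ.+-identityʳ _))))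
    ... | true = ≤-via (𝟙 (weight v ℕ.<ᵇ κ)) (trans (ℚₚ.+-comm (𝟙 (weight v ℕ.<ᵇ κ)) _)
                   (cong (_+ 𝟙 (weight v ℕ.<ᵇ κ)) (trans (ℚₚ.*-identityʳ (𝟙 (weight v ℕ.≤ᵇ suc κ)))
                     (cong (λ m → 𝟙 (m ℕ.≤ᵇ suc κ)) (sym (weight-flip-set w v eq)))))) (0≤𝟙 (weight v ℕ.<ᵇ κ))

    capped : ∀ κ m → 𝟙 (m ℕ.≤ᵇ κ) * (ℕ→ℚ m * p) ≤ℚ ℕ→ℚ κ * p
    capped κ m with m ℕ.≤ᵇ κ in eq
    ... | false = subst (_≤ℚ ℕ→ℚ κ * p) (sym (ℚₚ.*-zeroˡ (ℕ→ℚ m * p))) (0≤-* (0≤ℕ→ℚ κ) 0≤p)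
    ... | true = subst (_≤ℚ ℕ→ℚ κ * p) (sym (ℚₚ.*-identityˡ (ℕ→ℚ m * p)))
                   (*-monoʳ 0≤p (ℕ→ℚ-mono (ℕₚ.≤ᵇ⇒≤ m κ (subst Data.Bool.T (sym eq) _))))

  -- When one label at a time is added, the weight goes down only if the new label repeats a present one.
  light-push : ∀ κ (S : Vec Bool n) → κ ≤ weight S →
    𝔼 (vec R n) (λ φ → 𝟙 (weight (push φ S) ℕ.<ᵇ κ)) ≤ℚ (ℕ→ℚ κ * ℕ→ℚ κ) * p
  light-push {n} zero S _ = ℚₚ.≤-trans (ℚₚ.≤-reflexive (∫-zero ½ (vec R n))) (0≤-* (0≤-sq (ℕ→ℚ 0)) 0≤p)
  light-push {suc n} (suc κ) (false ∷ S) κ≤ =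
    ℚₚ.≤-trans (ℚₚ.≤-reflexive (trans (∫-vec ½ R n _) (trans (∫-cong ½ R (λ w → ∫-cong ½ (vec R n)
        (λ φ → cong (λ v → 𝟙 (weight v ℕ.<ᵇ suc κ)) (flipIf-false w (push φ S))))) (𝔼-const R R-prob _))))
      (light-push (suc κ) S κ≤)
  light-push {suc n} (suc κ) (true ∷ S) (s≤s κ≤) = begin
    𝔼 (vec R (suc n)) (λ φ → 𝟙 (weight (push φ (true ∷ S)) ℕ.<ᵇ suc κ))
      ≡⟨ trans (∫-vec ½ R n _) (∫-swap ½ ½ R (vec R n) _) ⟩
    𝔼 (vec R n) (λ φ → 𝔼 R (λ w → 𝟙 (weight (flipIf true w (push φ S)) ℕ.<ᵇ suc κ)))
      ≤⟨ 𝔼-mono (vec R n) (λ φ → inner (push φ S)) ⟩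
    𝔼 (vec R n) (λ φ → 𝟙 (weight (push φ S) ℕ.<ᵇ κ) + ℕ→ℚ (suc κ) * p)
      ≡⟨ trans (∫-+ ½ (vec R n) _ _) (cong (λ z → 𝔼 (vec R n) _ + z) (𝔼-const (vec R n) (IsProb-vec R R-prob n) (ℕ→ℚ (suc κ) * p))) ⟩
    𝔼 (vec R n) (λ φ → 𝟙 (weight (push φ S) ℕ.<ᵇ κ)) + ℕ→ℚ (suc κ) * p
      ≤⟨ ℚₚ.+-monoˡ-≤ (ℕ→ℚ (suc κ) * p) (light-push κ S κ≤) ⟩
    (ℕ→ℚ κ * ℕ→ℚ κ) * p + ℕ→ℚ (suc κ) * p
      ≡⟨ cong (λ z → (ℕ→ℚ κ * ℕ→ℚ κ) * p + z * p) (ℕ→ℚ-suc κ) ⟩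
    (ℕ→ℚ κ * ℕ→ℚ κ) * p + (1ℚ + ℕ→ℚ κ) * p
      ≤⟨ ≤-via (ℕ→ℚ κ * p) (expand (ℕ→ℚ κ) p) (0≤-* (0≤ℕ→ℚ κ) 0≤p) ⟩
    ((1ℚ + ℕ→ℚ κ) * (1ℚ + ℕ→ℚ κ)) * p
      ≡⟨ cong (λ z → (z * z) * p) (sym (ℕ→ℚ-suc κ)) ⟩
    (ℕ→ℚ (suc κ) * ℕ→ℚ (suc κ)) * p ∎
    where
    open ℚₚ.≤-Reasoning
    expand : ∀ x p → ((1ℚ + x) * (1ℚ + x)) * p ≡ ((x * x) * p + (1ℚ + x) * p) + x * p
    expand = solve-∀ ℚ-ring
    inner : ∀ v → 𝔼 R (λ w → 𝟙 (weight (flipIf true w v) ℕ.<ᵇ suc κ)) ≤ℚ 𝟙 (weight v ℕ.<ᵇ κ) + ℕ→ℚ (suc κ) * p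
    inner v = begin
      𝔼 R (λ w → 𝟙 (weight (flipIf true w v) ℕ.<ᵇ suc κ))
        ≤⟨ 𝔼-mono R (step κ v) ⟩
      𝔼 R (λ w → 𝟙 (weight v ℕ.<ᵇ κ) + 𝟙 (weight v ℕ.≤ᵇ suc κ) * 𝟙 (lookup v w))
        ≡⟨ trans (∫-+ ½ R (λ _ → 𝟙 (weight v ℕ.<ᵇ κ)) _)
             (cong₂ _+_ (𝔼-const R R-prob (𝟙 (weight v ℕ.<ᵇ κ))) (∫-*ˡ ½ R (𝟙 (weight v ℕ.≤ᵇ suc κ)) (λ w → 𝟙 (lookup v w)))) ⟩
      𝟙 (weight v ℕ.<ᵇ κ) + 𝟙 (weight v ℕ.≤ᵇ suc κ) * 𝔼 R (λ w → 𝟙 (lookup v w))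
        ≤⟨ ℚₚ.+-monoʳ-≤ (𝟙 (weight v ℕ.<ᵇ κ)) (ℚₚ.≤-trans (*-monoˡ (0≤𝟙 (weight v ℕ.≤ᵇ suc κ)) (𝔼-lookup v)) (capped (suc κ) (weight v))) ⟩
      𝟙 (weight v ℕ.<ᵇ κ) + ℕ→ℚ (suc κ) * p ∎

  -- Folding is linear, so S and T collide exactly when S ⊕ T folds to the empty set. This is the
  -- case κ = 1 of `light-push`.
  push-collision : (S T : Vec Bool n) → S ≢ T → 𝔼 (vec R n) (λ φ → 𝟙 (push φ S == push φ T)) ≤ℚ p
  push-collision {n} S T S≢T = begin
    𝔼 (vec R n) (λ φ → 𝟙 (push φ S == push φ T))
      ≤⟨ 𝔼-mono (vec R n) pointwise ⟩
    𝔼 (vec R n) (λ φ → 𝟙 (weight (push φ (S ⊕ T)) ℕ.<ᵇ 1))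
      ≤⟨ light-push 1 (S ⊕ T) (⊕-distinct S T S≢T) ⟩
    (1ℚ * 1ℚ) * p
      ≡⟨ ℚₚ.*-identityˡ p ⟩
    p ∎
    where
    open ℚₚ.≤-Reasoning
    pointwise : ∀ φ → 𝟙 (push φ S == push φ T) ≤ℚ 𝟙 (weight (push φ (S ⊕ T)) ℕ.<ᵇ 1)
    pointwise φ with push φ S == push φ T in eq
    ... | false = 0≤𝟙 (weight (push φ (S ⊕ T)) ℕ.<ᵇ 1)
    ... | true = ℚₚ.≤-reflexive (cong (λ m → 𝟙 (m ℕ.<ᵇ 1)) (sym
      (trans (cong weight (trans (push-⊕ φ S T) (cong (_⊕ push φ T) (==-sound (push φ S) (push φ T) eq)))) (⊕-self (push φ T)))))

-- Folded Fourier coefficients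

∑-term : ∀ n {F : Vec Bool n → ℚ} → (∀ U → 0ℚ ≤ℚ F U) → ∀ U → F U ≤ℚ ∑ (bits n) F
∑-term n {F} 0≤F U = subst (_≤ℚ ∑ (bits n) F) (∑-point n U F) (∑-mono (bits n) pointwise)
  where
  pointwise : ∀ W → F W * 𝟙 (U == W) ≤ℚ F W
  pointwise W = subst (F W * 𝟙 (U == W) ≤ℚ_) (ℚₚ.*-identityʳ (F W)) (*-monoˡ (0≤F W) (𝟙≤1 (U == W)))

𝟙-sq : ∀ b → 𝟙 b * 𝟙 b ≡ 𝟙 b
𝟙-sq true = refl
𝟙-sq false = refl

3^-weight : (S : Vec Bool n) → 3^∣ S ∣ ≡ ℕ→ℚ (3 ^ weight S)
3^-weight [] = refl
3^-weight (true ∷ S) = trans (cong (3ℚ *_) (3^-weight S)) (sym (ℕ→ℚ-* 3 (3 ^ weight S)))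
3^-weight (false ∷ S) = 3^-weight S

fibre : Vec (Fin L) n → Vec Bool L → (Vec Bool n → ℚ) → Vec Bool n → ℚ
fibre φ U a S = a S * 𝟙 (push φ S == U)

-- The Fourier coefficient at U of y ↦ synth a (s ⊕ gather φ y), see fold-spectrum.
fold : Vec (Fin L) n → Vec Bool n → Vec Bool L → (Vec Bool n → ℚ) → ℚ
fold φ s U a = synth (fibre φ U a) s

fold-cong : ∀ (φ : Vec (Fin L) n) s U {a b} → (∀ S → a S ≡ b S) → fold φ s U a ≡ fold φ s U b
fold-cong φ s U eq = synth-cong (λ S → cong (_* 𝟙 (push φ S == U)) (eq S)) s

fold-+ : ∀ (φ : Vec (Fin L) n) s U a b → fold φ s U (λ S → a S + b S) ≡ fold φ s U a + fold φ s U b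
fold-+ φ s U a b = trans (synth-cong (λ S → ℚₚ.*-distribʳ-+ (𝟙 (push φ S == U)) (a S) (b S)) s)
  (synth-+ (fibre φ U a) (fibre φ U b) s)

-- A character factors on the queried point: χ_S(s ⊕ gather φ y) = χ_S(s) χ_(push φ S)(y).
-- Orthogonality in y keeps the sets that fold to U. The folded coefficient is thereby a mean over
-- query answers and can be sampled.
fold-spectrum : ∀ (g : Vec Bool n → ℚ) (φ : Vec (Fin L) n) s U →
  𝔼 (bits L) (λ y → χ U y * g (s ⊕ gather φ y)) ≡ fold φ s U (hat g)
fold-spectrum {n} {L} g φ s U = begin-equality
  𝔼 (bits L) (λ y → χ U y * g (s ⊕ gather φ y))
    ≡⟨ ∫-cong ½ (bits L) (λ y → cong (χ U y *_) (sym (inversion g (s ⊕ gather φ y)))) ⟩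
  𝔼 (bits L) (λ y → χ U y * ∑ (bits n) (λ S → hat g S * χ S (s ⊕ gather φ y)))
    ≡⟨ ∫-cong ½ (bits L) (λ y → sym (∫-*ˡ 1ℚ (bits n) (χ U y) (λ S → hat g S * χ S (s ⊕ gather φ y)))) ⟩
  𝔼 (bits L) (λ y → ∑ (bits n) (λ S → χ U y * (hat g S * χ S (s ⊕ gather φ y))))
    ≡⟨ ∫-swap ½ 1ℚ (bits L) (bits n) (λ y S → χ U y * (hat g S * χ S (s ⊕ gather φ y))) ⟩
  ∑ (bits n) (λ S → 𝔼 (bits L) (λ y → χ U y * (hat g S * χ S (s ⊕ gather φ y))))
    ≡⟨ ∫-cong 1ℚ (bits n) inner ⟩
  fold φ s U (hat g) ∎
  where
  open ℚₚ.≤-Reasoning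
  shuffle : ∀ c a x y → c * (a * (x * y)) ≡ (a * x) * (c * y)
  shuffle = solve-∀ ℚ-ring
  swap-last : ∀ a x y → (a * x) * y ≡ (a * y) * x
  swap-last = solve-∀ ℚ-ring
  inner : ∀ S → 𝔼 (bits L) (λ y → χ U y * (hat g S * χ S (s ⊕ gather φ y))) ≡ fibre φ U (hat g) S * χ S s
  inner S =
    trans (∫-cong ½ (bits L) (λ y → trans
      (cong (λ z → χ U y * (hat g S * z)) (trans (χ-⊕ S s (gather φ y)) (cong (χ S s *_) (sym (χ-push φ S y)))))
      (shuffle (χ U y) (hat g S) (χ S s) (χ (push φ S) y))))
    (trans (∫-*ˡ ½ (bits L) (hat g S * χ S s) (λ y → χ U y * χ (push φ S) y))
    (trans (cong ((hat g S * χ S s) *_) (χ-orthogonal U (push φ S)))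
           (swap-last (hat g S) (χ S s) (𝟙 (push φ S == U)))))

-- Moments of folded coefficients

module HashedSpectrum (R : Tree (Fin L)) (R-prob : IsProb R) (p : ℚ) (0≤p : 0ℚ ≤ℚ p)
                      (R-point : ∀ w → 𝔼 R (λ v → 𝟙 (v ≟ᵇ w)) ≤ℚ p) where
  open RandomLabels R R-prob p 0≤p R-point
  open ℚₚ.≤-Reasoning

  -- Averaging over s removes the cross terms, so each set S contributes its own square, weighted by
  -- the probability that it folds to fewer than κ labels, and `light-push` bounds that probability.
  heavy-part : ∀ κ (a : Vec Bool n → ℚ) → (∀ S → a S ≡ 0ℚ ⊎ κ ≤ weight S) →
    𝔼 (vec R n) (λ φ → 𝔼 (bits n) (λ s → ∑ (bits L) (λ U → 𝟙 (weight U ℕ.<ᵇ κ) * (fold φ s U a * fold φ s U a))))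
      ≤ℚ ((ℕ→ℚ κ * ℕ→ℚ κ) * p) * ∑ (bits n) (λ S → a S * a S)
  heavy-part {n} κ a supp = begin
    𝔼 (vec R n) (λ φ → 𝔼 (bits n) (λ s → ∑ (bits L) (λ U → 𝟙 (weight U ℕ.<ᵇ κ) * (fold φ s U a * fold φ s U a))))
      ≡⟨ ∫-cong ½ (vec R n) average-signs ⟩
    𝔼 (vec R n) (λ φ → ∑ (bits n) (λ S → (a S * a S) * 𝟙 (weight (push φ S) ℕ.<ᵇ κ)))
      ≡⟨ ∫-swap ½ 1ℚ (vec R n) (bits n) (λ φ S → (a S * a S) * 𝟙 (weight (push φ S) ℕ.<ᵇ κ)) ⟩
    ∑ (bits n) (λ S → 𝔼 (vec R n) (λ φ → (a S * a S) * 𝟙 (weight (push φ S) ℕ.<ᵇ κ)))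
      ≤⟨ ∑-mono (bits n) (λ S → average-labels S (supp S)) ⟩
    ∑ (bits n) (λ S → ((ℕ→ℚ κ * ℕ→ℚ κ) * p) * (a S * a S))
      ≡⟨ ∫-*ˡ 1ℚ (bits n) ((ℕ→ℚ κ * ℕ→ℚ κ) * p) (λ S → a S * a S) ⟩
    ((ℕ→ℚ κ * ℕ→ℚ κ) * p) * ∑ (bits n) (λ S → a S * a S) ∎
    where
    sq-fibre : ∀ x y z → y * y ≡ y → z * ((x * y) * (x * y)) ≡ ((x * x) * z) * y
    sq-fibre x y z idem = trans (shuffle x y z) (cong (((x * x) * z) *_) idem)
      where
      shuffle : ∀ x y z → z * ((x * y) * (x * y)) ≡ ((x * x) * z) * (y * y)
      shuffle = solve-∀ ℚ-ring
    average-signs : ∀ φ → 𝔼 (bits n) (λ s → ∑ (bits L) (λ U → 𝟙 (weight U ℕ.<ᵇ κ) * (fold φ s U a * fold φ s U a)))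
      ≡ ∑ (bits n) (λ S → (a S * a S) * 𝟙 (weight (push φ S) ℕ.<ᵇ κ))
    average-signs φ = begin-equality
      𝔼 (bits n) (λ s → ∑ (bits L) (λ U → 𝟙 (weight U ℕ.<ᵇ κ) * (fold φ s U a * fold φ s U a)))
        ≡⟨ ∫-swap ½ 1ℚ (bits n) (bits L) (λ s U → 𝟙 (weight U ℕ.<ᵇ κ) * (fold φ s U a * fold φ s U a)) ⟩
      ∑ (bits L) (λ U → 𝔼 (bits n) (λ s → 𝟙 (weight U ℕ.<ᵇ κ) * (fold φ s U a * fold φ s U a)))
        ≡⟨ ∫-cong 1ℚ (bits L) (λ U → trans (∫-*ˡ ½ (bits n) (𝟙 (weight U ℕ.<ᵇ κ)) (λ s → fold φ s U a * fold φ s U a))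
             (trans (cong (𝟙 (weight U ℕ.<ᵇ κ) *_) (𝔼-synth-sq (fibre φ U a)))
             (trans (sym (∫-*ˡ 1ℚ (bits n) (𝟙 (weight U ℕ.<ᵇ κ)) (λ S → fibre φ U a S * fibre φ U a S)))
               (∫-cong 1ℚ (bits n) (λ S → sq-fibre (a S) (𝟙 (push φ S == U)) (𝟙 (weight U ℕ.<ᵇ κ)) (𝟙-sq (push φ S == U))))))) ⟩
      ∑ (bits L) (λ U → ∑ (bits n) (λ S → ((a S * a S) * 𝟙 (weight U ℕ.<ᵇ κ)) * 𝟙 (push φ S == U)))
        ≡⟨ ∫-swap 1ℚ 1ℚ (bits L) (bits n) (λ U S → ((a S * a S) * 𝟙 (weight U ℕ.<ᵇ κ)) * 𝟙 (push φ S == U)) ⟩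
      ∑ (bits n) (λ S → ∑ (bits L) (λ U → ((a S * a S) * 𝟙 (weight U ℕ.<ᵇ κ)) * 𝟙 (push φ S == U)))
        ≡⟨ ∫-cong 1ℚ (bits n) (λ S → ∑-point L (push φ S) (λ U → (a S * a S) * 𝟙 (weight U ℕ.<ᵇ κ))) ⟩
      ∑ (bits n) (λ S → (a S * a S) * 𝟙 (weight (push φ S) ℕ.<ᵇ κ)) ∎
    average-labels : ∀ S → a S ≡ 0ℚ ⊎ κ ≤ weight S →
      𝔼 (vec R n) (λ φ → (a S * a S) * 𝟙 (weight (push φ S) ℕ.<ᵇ κ)) ≤ℚ ((ℕ→ℚ κ * ℕ→ℚ κ) * p) * (a S * a S)
    average-labels S (inj₁ zero-coeff) = ℚₚ.≤-reflexive (trans (∫-*ˡ ½ (vec R n) (a S * a S) (λ φ → 𝟙 (weight (push φ S) ℕ.<ᵇ κ)))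
      (trans (cong (λ z → (z * z) * 𝔼 (vec R n) (λ φ → 𝟙 (weight (push φ S) ℕ.<ᵇ κ))) zero-coeff)
      (trans (ℚₚ.*-zeroˡ (𝔼 (vec R n) (λ φ → 𝟙 (weight (push φ S) ℕ.<ᵇ κ)))) (sym (trans (cong (λ z → ((ℕ→ℚ κ * ℕ→ℚ κ) * p) * (z * z)) zero-coeff)
        (ℚₚ.*-zeroʳ ((ℕ→ℚ κ * ℕ→ℚ κ) * p)))))))
    average-labels S (inj₂ κ≤) = begin
      𝔼 (vec R n) (λ φ → (a S * a S) * 𝟙 (weight (push φ S) ℕ.<ᵇ κ))
        ≡⟨ ∫-*ˡ ½ (vec R n) (a S * a S) (λ φ → 𝟙 (weight (push φ S) ℕ.<ᵇ κ)) ⟩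
      (a S * a S) * 𝔼 (vec R n) (λ φ → 𝟙 (weight (push φ S) ℕ.<ᵇ κ))
        ≤⟨ *-monoˡ (0≤-sq (a S)) (light-push κ S κ≤) ⟩
      (a S * a S) * ((ℕ→ℚ κ * ℕ→ℚ κ) * p)
        ≡⟨ ℚₚ.*-comm (a S * a S) ((ℕ→ℚ κ * ℕ→ℚ κ) * p) ⟩
      ((ℕ→ℚ κ * ℕ→ℚ κ) * p) * (a S * a S) ∎

  private
    same-or-collide : (S T : Vec Bool n) → 𝔼 (vec R n) (λ φ → 𝟙 (push φ T == push φ S)) ≤ℚ 𝟙 (S == T) + p
    same-or-collide {n} S T with ≡-dec Boolₚ._≟_ S T
    ... | yes refl = ℚₚ.≤-trans (𝔼-≤const (vec R n) (IsProb-vec R R-prob n) (λ φ → 𝟙≤1 (push φ T == push φ S)))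
                       (≤-via p refl 0≤p)
    ... | no S≢T = ℚₚ.≤-trans (push-collision T S (S≢T ∘ sym)) (ℚₚ.≤-reflexive (sym (ℚₚ.+-identityˡ p)))

  -- For fixed φ, hypercontractivity in s bounds the fourth moment at U by 9^k times the square of
  -- the fibre mass, the sum of a S² over the S folding to U. Averaging over φ, the squared masses
  -- add up to little: each single a S² is at most τ, and distinct sets collide with probability at
  -- most p.
  light-part : ∀ k τ (a : Vec Bool n → ℚ) → (∀ S → a S ≡ 0ℚ ⊎ weight S ≤ k) →
    (∀ S → a S * a S ≤ℚ τ) → 0ℚ ≤ℚ τ → ∑ (bits n) (λ S → a S * a S) ≤ℚ 1ℚ →
    𝔼 (vec R n) (λ φ → 𝔼 (bits n) (λ s → ∑ (bits L) (λ U → (fold φ s U a * fold φ s U a) * (fold φ s U a * fold φ s U a))))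
      ≤ℚ (ℕ→ℚ (3 ^ k) * ℕ→ℚ (3 ^ k)) * (τ + p)
  light-part {n} k τ a supp small 0≤τ total = begin
    𝔼 (vec R n) (λ φ → 𝔼 (bits n) (λ s → ∑ (bits L) (λ U → (fold φ s U a * fold φ s U a) * (fold φ s U a * fold φ s U a))))
      ≡⟨ ∫-cong ½ (vec R n) (λ φ → ∫-swap ½ 1ℚ (bits n) (bits L) (λ s U → (fold φ s U a * fold φ s U a) * (fold φ s U a * fold φ s U a))) ⟩
    𝔼 (vec R n) (λ φ → ∑ (bits L) (λ U → 𝔼 (bits n) (λ s → (fold φ s U a * fold φ s U a) * (fold φ s U a * fold φ s U a))))
      ≤⟨ 𝔼-mono (vec R n) (λ φ → ∑-mono (bits L) (λ U → fourth-moment φ U)) ⟩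
    𝔼 (vec R n) (λ φ → ∑ (bits L) (λ U → (c * c) * (Q φ U * Q φ U)))
      ≡⟨ trans (∫-cong ½ (vec R n) (λ φ → ∫-*ˡ 1ℚ (bits L) (c * c) (λ U → Q φ U * Q φ U))) (∫-*ˡ ½ (vec R n) (c * c) _) ⟩
    (c * c) * 𝔼 (vec R n) (λ φ → ∑ (bits L) (λ U → Q φ U * Q φ U))
      -- Summed over U, the squared fibre masses become a sum over pairs (S, T) with the same folded
      -- set.
      ≡⟨ cong ((c * c) *_) (∫-cong ½ (vec R n) pair-up) ⟩
    (c * c) * 𝔼 (vec R n) (λ φ → ∑ (bits n) (λ S → ∑ (bits n) (λ T → b S * (b T * 𝟙 (push φ T == push φ S)))))
      ≡⟨ cong ((c * c) *_) (trans (∫-swap ½ 1ℚ (vec R n) (bits n) (λ φ S → ∑ (bits n) (λ T → b S * (b T * 𝟙 (push φ T == push φ S)))))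
           (∫-cong 1ℚ (bits n) (λ S → ∫-swap ½ 1ℚ (vec R n) (bits n) (λ φ T → b S * (b T * 𝟙 (push φ T == push φ S)))))) ⟩
    (c * c) * ∑ (bits n) (λ S → ∑ (bits n) (λ T → 𝔼 (vec R n) (λ φ → b S * (b T * 𝟙 (push φ T == push φ S)))))
      ≤⟨ *-monoˡ (0≤-sq c) (∑-mono (bits n) (λ S → ∑-mono (bits n) (λ T → collide S T))) ⟩
    (c * c) * ∑ (bits n) (λ S → ∑ (bits n) (λ T → b S * (b T * 𝟙 (S == T) + b T * p)))
      -- For fixed S, the term T = S gives at most τ; the collision terms together give at most p
      -- because the total mass is at most 1.
      ≤⟨ *-monoˡ (0≤-sq c) (∑-mono (bits n) diagonal) ⟩
    (c * c) * ∑ (bits n) (λ S → b S * (τ + p))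
      ≤⟨ *-monoˡ (0≤-sq c) (ℚₚ.≤-trans (ℚₚ.≤-reflexive (∫-*ʳ 1ℚ (bits n) (τ + p) b))
           (ℚₚ.≤-trans (*-monoʳ (0≤-+ 0≤τ 0≤p) total) (ℚₚ.≤-reflexive (ℚₚ.*-identityˡ (τ + p))))) ⟩
    (c * c) * (τ + p) ∎
    where
    c : ℚ
    c = ℕ→ℚ (3 ^ k)
    b : Vec Bool n → ℚ
    b S = a S * a S
    Q : Vec (Fin L) n → Vec Bool L → ℚ
    Q φ U = ∑ (bits n) (λ S → b S * 𝟙 (push φ S == U))
    sq-fibre : ∀ w x y → y * y ≡ y → w * ((x * y) * (x * y)) ≡ w * ((x * x) * y)
    sq-fibre w x y idem = trans (shuffle w x y) (cong (λ z → w * ((x * x) * z)) idem)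
      where
      shuffle : ∀ w x y → w * ((x * y) * (x * y)) ≡ w * ((x * x) * (y * y))
      shuffle = solve-∀ ℚ-ring
    weighted : ∀ S y → 0ℚ ≤ℚ y → a S ≡ 0ℚ ⊎ weight S ≤ k → 3^∣ S ∣ * ((a S * a S) * y) ≤ℚ c * ((a S * a S) * y)
    weighted S y 0≤y (inj₁ zero-coeff) = ℚₚ.≤-reflexive (trans (cong (λ z → 3^∣ S ∣ * ((z * z) * y)) zero-coeff)
      (trans (vanish (3^∣ S ∣) y) (sym (trans (cong (λ z → c * ((z * z) * y)) zero-coeff) (vanish c y)))))
      where
      vanish : ∀ w y → w * ((0ℚ * 0ℚ) * y) ≡ 0ℚ
      vanish = solve-∀ ℚ-ring
    weighted S y 0≤y (inj₂ light) = *-monoʳ (0≤-* (0≤-sq (a S)) 0≤y)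
      (ℚₚ.≤-trans (ℚₚ.≤-reflexive (3^-weight S)) (ℕ→ℚ-mono (ℕₚ.^-monoʳ-≤ 3 light)))
    norm-bound : ∀ φ U → norm₃ (fibre φ U a) ≤ℚ c * Q φ U
    norm-bound φ U = ℚₚ.≤-trans (∑-mono (bits n) (λ S → ℚₚ.≤-trans
        (ℚₚ.≤-reflexive (sq-fibre (3^∣ S ∣) (a S) (𝟙 (push φ S == U)) (𝟙-sq (push φ S == U))))
        (weighted S (𝟙 (push φ S == U)) (0≤𝟙 (push φ S == U)) (supp S))))
      (ℚₚ.≤-reflexive (∫-*ˡ 1ℚ (bits n) c (λ S → b S * 𝟙 (push φ S == U))))
    interchange : ∀ x y → (x * y) * (x * y) ≡ (x * x) * (y * y)
    interchange = solve-∀ ℚ-ring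
    fourth-moment : ∀ φ U → 𝔼 (bits n) (λ s → (fold φ s U a * fold φ s U a) * (fold φ s U a * fold φ s U a)) ≤ℚ (c * c) * (Q φ U * Q φ U)
    fourth-moment φ U = ℚₚ.≤-trans (bonami (fibre φ U a) (fibre φ U a))
      (ℚₚ.≤-trans (sq-mono (0≤norm₃ (fibre φ U a)) (norm-bound φ U)) (ℚₚ.≤-reflexive (interchange c (Q φ U))))
    pair-up : ∀ φ → ∑ (bits L) (λ U → Q φ U * Q φ U) ≡ ∑ (bits n) (λ S → ∑ (bits n) (λ T → b S * (b T * 𝟙 (push φ T == push φ S))))
    pair-up φ = begin-equality
      ∑ (bits L) (λ U → Q φ U * Q φ U)
        ≡⟨ ∫-cong 1ℚ (bits L) (λ U → trans (sym (∫-*ˡ 1ℚ (bits n) (Q φ U) (λ S → b S * 𝟙 (push φ S == U))))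
             (∫-cong 1ℚ (bits n) (λ S → sym (ℚₚ.*-assoc (Q φ U) (b S) (𝟙 (push φ S == U)))))) ⟩
      ∑ (bits L) (λ U → ∑ (bits n) (λ S → (Q φ U * b S) * 𝟙 (push φ S == U)))
        ≡⟨ ∫-swap 1ℚ 1ℚ (bits L) (bits n) (λ U S → (Q φ U * b S) * 𝟙 (push φ S == U)) ⟩
      ∑ (bits n) (λ S → ∑ (bits L) (λ U → (Q φ U * b S) * 𝟙 (push φ S == U)))
        ≡⟨ ∫-cong 1ℚ (bits n) (λ S → trans (∑-point L (push φ S) (λ U → Q φ U * b S)) (trans (ℚₚ.*-comm (Q φ (push φ S)) (b S))
             (sym (∫-*ˡ 1ℚ (bits n) (b S) (λ T → b T * 𝟙 (push φ T == push φ S)))))) ⟩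
      ∑ (bits n) (λ S → ∑ (bits n) (λ T → b S * (b T * 𝟙 (push φ T == push φ S)))) ∎
    collide : ∀ S T → 𝔼 (vec R n) (λ φ → b S * (b T * 𝟙 (push φ T == push φ S))) ≤ℚ b S * (b T * 𝟙 (S == T) + b T * p)
    collide S T = begin
      𝔼 (vec R n) (λ φ → b S * (b T * 𝟙 (push φ T == push φ S)))
        ≡⟨ trans (∫-*ˡ ½ (vec R n) (b S) _) (cong (b S *_) (∫-*ˡ ½ (vec R n) (b T) _)) ⟩
      b S * (b T * 𝔼 (vec R n) (λ φ → 𝟙 (push φ T == push φ S)))
        ≤⟨ *-monoˡ (0≤-sq (a S)) (*-monoˡ (0≤-sq (a T)) (same-or-collide S T)) ⟩
      b S * (b T * (𝟙 (S == T) + p))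
        ≡⟨ cong (b S *_) (ℚₚ.*-distribˡ-+ (b T) (𝟙 (S == T)) p) ⟩
      b S * (b T * 𝟙 (S == T) + b T * p) ∎
    diagonal : ∀ S → ∑ (bits n) (λ T → b S * (b T * 𝟙 (S == T) + b T * p)) ≤ℚ b S * (τ + p)
    diagonal S = begin
      ∑ (bits n) (λ T → b S * (b T * 𝟙 (S == T) + b T * p))
        ≡⟨ trans (∫-*ˡ 1ℚ (bits n) (b S) _) (cong (b S *_) (trans (∫-+ 1ℚ (bits n) (λ T → b T * 𝟙 (S == T)) (λ T → b T * p))
             (cong₂ _+_ (∑-point n S b) (∫-*ʳ 1ℚ (bits n) p b)))) ⟩
      b S * (b S + ∑ (bits n) b * p)
        ≤⟨ *-monoˡ (0≤-sq (a S)) (ℚₚ.+-mono-≤ (small S)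
             (ℚₚ.≤-trans (*-monoʳ 0≤p total) (ℚₚ.≤-reflexive (ℚₚ.*-identityˡ p)))) ⟩
      b S * (τ + p) ∎

sq-sum : ∀ x y → (x + y) * (x + y) ≤ℚ (1ℚ + 1ℚ) * (x * x + y * y)
sq-sum x y = ≤-via ((x - y) * (x - y)) (identity x y) (0≤-sq (x - y))
  where
  identity : ∀ x y → (1ℚ + 1ℚ) * (x * x + y * y) ≡ (x + y) * (x + y) + (x - y) * (x - y)
  identity = solve-∀ ℚ-ring

-- Splitting a spectrum by degree and size

module Thresholds (k : ℕ) (T τ : ℚ) (0≤T : 0ℚ ≤ℚ T) (0≤τ : 0ℚ ≤ℚ τ) (τT≡1 : τ * T ≡ 1ℚ) where

  lightᵇ : Vec Bool n → Bool
  lightᵇ S = weight S ℕ.≤ᵇ k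

  -- The test x² ≥ τ, written with T = 1/τ so that no division occurs.
  largeᵇ : ℚ → Bool
  largeᵇ x = does (1ℚ ℚₚ.≤? T * (x * x))

  -- The three parts need different treatment: `top` is what the data reveal, `faint` (low degree,
  -- small) is negligible after folding by the fourth moment, and `deep` (more than k coordinates)
  -- by the loss of weight.
  top faint deep : (Vec Bool n → ℚ) → Vec Bool n → ℚ
  top a S = 𝟙 (lightᵇ S ∧ largeᵇ (a S)) * a S
  faint a S = 𝟙 (lightᵇ S ∧ not (largeᵇ (a S))) * a S
  deep a S = 𝟙 (not (lightᵇ S)) * a S

  decompose : ∀ (a : Vec Bool n → ℚ) S → a S ≡ top a S + (faint a S + deep a S)
  decompose a S with lightᵇ S | largeᵇ (a S)
  ... | true | true = on-top (a S)
    where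
    on-top : ∀ x → x ≡ 1ℚ * x + (0ℚ * x + 0ℚ * x)
    on-top = solve-∀ ℚ-ring
  ... | true | false = on-faint (a S)
    where
    on-faint : ∀ x → x ≡ 0ℚ * x + (1ℚ * x + 0ℚ * x)
    on-faint = solve-∀ ℚ-ring
  ... | false | _ = on-deep (a S)
    where
    on-deep : ∀ x → x ≡ 0ℚ * x + (0ℚ * x + 1ℚ * x)
    on-deep = solve-∀ ℚ-ring

  𝟙-sq≤ : ∀ b x → (𝟙 b * x) * (𝟙 b * x) ≤ℚ x * x
  𝟙-sq≤ true x = ℚₚ.≤-reflexive (cong₂ _*_ (ℚₚ.*-identityˡ x) (ℚₚ.*-identityˡ x))
  𝟙-sq≤ false x = ℚₚ.≤-trans (ℚₚ.≤-reflexive (vanish x)) (0≤-sq x)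
    where
    vanish : ∀ x → (0ℚ * x) * (0ℚ * x) ≡ 0ℚ
    vanish = solve-∀ ℚ-ring

  ¬large-small : ∀ x → largeᵇ x ≡ false → x * x ≤ℚ τ
  ¬large-small x eq = begin
    x * x             ≡⟨ trans (sym (ℚₚ.*-identityˡ (x * x))) (trans (cong (_* (x * x)) (sym τT≡1)) (ℚₚ.*-assoc τ T (x * x))) ⟩
    τ * (T * (x * x)) ≤⟨ *-monoˡ 0≤τ (below (1ℚ ℚₚ.≤? T * (x * x)) eq) ⟩
    τ * 1ℚ            ≡⟨ ℚₚ.*-identityʳ τ ⟩
    τ                 ∎
    where
    open ℚₚ.≤-Reasoning
    below : ∀ {y} (d : Dec (1ℚ ≤ℚ y)) → does d ≡ false → y ≤ℚ 1ℚ
    below (no 1≰y) _ = ℚₚ.<⇒≤ (ℚₚ.≰⇒> 1≰y)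

  faint-small : ∀ (a : Vec Bool n → ℚ) S → faint a S * faint a S ≤ℚ τ
  faint-small a S with lightᵇ S | largeᵇ (a S) in eq
  ... | true | false = subst (_≤ℚ τ) (sym (cong₂ _*_ (ℚₚ.*-identityˡ (a S)) (ℚₚ.*-identityˡ (a S)))) (¬large-small (a S) eq)
  ... | true | true = subst (_≤ℚ τ) (sym (cong₂ _*_ (ℚₚ.*-zeroˡ (a S)) (ℚₚ.*-zeroˡ (a S)))) 0≤τ
  ... | false | _ = subst (_≤ℚ τ) (sym (cong₂ _*_ (ℚₚ.*-zeroˡ (a S)) (ℚₚ.*-zeroˡ (a S)))) 0≤τ

  faint-support : ∀ (a : Vec Bool n → ℚ) S → faint a S ≡ 0ℚ ⊎ weight S ≤ k
  faint-support a S with lightᵇ S in eq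
  ... | true = inj₂ (ℕₚ.≤ᵇ⇒≤ (weight S) k (subst Data.Bool.T (sym eq) _))
  ... | false = inj₁ (ℚₚ.*-zeroˡ (a S))

  deep-support : ∀ (a : Vec Bool n → ℚ) S → deep a S ≡ 0ℚ ⊎ suc k ≤ weight S
  deep-support a S with lightᵇ S in eq
  ... | true = inj₁ (ℚₚ.*-zeroˡ (a S))
  ... | false = inj₂ (ℕₚ.≰⇒> (λ le → true≢false (trans (sym (Equivalence.to Boolₚ.T-≡ (ℕₚ.≤⇒≤ᵇ le))) eq)))

  module Deviation (B : ℚ) (0≤B : 0ℚ ≤ℚ B) where
    4B : ℚ
    4B = (+ 4 / 1) * B

    0≤4B : 0ℚ ≤ℚ 4B
    0≤4B = 0≤-* (ℚₚ.nonNegative⁻¹ (+ 4 / 1)) 0≤B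

    deepTerm faintTerm : Vec (Fin L) n → Vec Bool n → (Vec Bool n → ℚ) → Vec Bool L → ℚ
    deepTerm φ s a U = 𝟙 (weight U ℕ.<ᵇ suc k) * (fold φ s U (deep a) * fold φ s U (deep a))
    faintTerm φ s a U = (fold φ s U (faint a) * fold φ s U (faint a)) * (fold φ s U (faint a) * fold φ s U (faint a))

    -- Sums over U stand in for a maximum, since their expectations are computable. The factors make
    -- a value below 1 force 4B y² ≤ 1 for the deep part y and (4B x²)² < 1 for the faint part x at
    -- every U with at most k labels.
    deviation : Vec (Fin L) n → Vec Bool n → (Vec Bool n → ℚ) → ℚ
    deviation {L = L} φ s a = 4B * ∑ (bits L) (deepTerm φ s a) + (4B * 4B) * ∑ (bits L) (faintTerm φ s a)

    0≤deepTerm : ∀ (φ : Vec (Fin L) n) s a U → 0ℚ ≤ℚ deepTerm φ s a U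
    0≤deepTerm φ s a U = 0≤-* (0≤𝟙 (weight U ℕ.<ᵇ suc k)) (0≤-sq (fold φ s U (deep a)))

    0≤faintTerm : ∀ (φ : Vec (Fin L) n) s a U → 0ℚ ≤ℚ faintTerm φ s a U
    0≤faintTerm φ s a U = 0≤-sq (fold φ s U (faint a) * fold φ s U (faint a))

    0≤deviation : ∀ (φ : Vec (Fin L) n) s a → 0ℚ ≤ℚ deviation φ s a
    0≤deviation {L = L} φ s a = 0≤-+ (0≤-* 0≤4B (∑-nonneg (bits L) (0≤deepTerm φ s a)))
      (0≤-* (0≤-sq 4B) (∑-nonneg (bits L) (0≤faintTerm φ s a)))

    private
      root-small : ∀ x → 0ℚ ≤ℚ x → x * x < 1ℚ → x ≤ℚ 1ℚ
      root-small x 0≤x x²<1 with ℚₚ.≤-total x 1ℚ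
      ... | inj₁ x≤1 = x≤1
      ... | inj₂ 1≤x = ⊥-elim (ℚₚ.<-irrefl refl (ℚₚ.<-≤-trans x²<1 (ℚₚ.≤-trans 1≤x (subst (_≤ℚ x * x) (ℚₚ.*-identityˡ x) (*-monoʳ 0≤x 1≤x)))))

    -- The error at U is x + y, and (x + y)² ≤ 2(x² + y²); with 4B x² and 4B y² at most 1, this
    -- gives B (x + y)² ≤ 1.
    deviation<1 : ∀ (φ : Vec (Fin L) n) s a → deviation φ s a < 1ℚ → ∀ U → weight U ≤ k →
      B * ((fold φ s U a - fold φ s U (top a)) * (fold φ s U a - fold φ s U (top a))) ≤ℚ 1ℚ
    deviation<1 {L = L} φ s a dev<1 U light = begin
      B * ((fold φ s U a - fold φ s U (top a)) * (fold φ s U a - fold φ s U (top a)))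
        ≡⟨ cong (λ z → B * (z * z)) error ⟩
      B * ((x + y) * (x + y))
        ≤⟨ *-monoˡ 0≤B (sq-sum x y) ⟩
      B * ((1ℚ + 1ℚ) * (x * x + y * y))
        ≡⟨ regroup B x y ⟩
      ½ * (4B * (x * x) + 4B * (y * y))
        ≤⟨ *-monoˡ 0≤½ (ℚₚ.+-mono-≤ x-small y-small) ⟩
      ½ * (1ℚ + 1ℚ)
        ≡⟨⟩
      1ℚ ∎
      where
      open ℚₚ.≤-Reasoning
      x y : ℚ
      x = fold φ s U (faint a)
      y = fold φ s U (deep a)
      cancel : ∀ t x y → (t + (x + y)) - t ≡ x + y
      cancel = solve-∀ ℚ-ring
      regroup : ∀ B x y → B * ((1ℚ + 1ℚ) * (x * x + y * y)) ≡ ½ * (((+ 4 / 1) * B) * (x * x) + ((+ 4 / 1) * B) * (y * y))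
      regroup = solve-∀ ℚ-ring
      error : fold φ s U a - fold φ s U (top a) ≡ x + y
      error = trans (cong (_- fold φ s U (top a)) (trans (fold-cong φ s U (decompose a))
        (trans (fold-+ φ s U (top a) (λ S → faint a S + deep a S)) (cong (λ z → fold φ s U (top a) + z) (fold-+ φ s U (faint a) (deep a))))))
        (cancel (fold φ s U (top a)) x y)
      dTerm fTerm : ℚ
      dTerm = 4B * ∑ (bits L) (deepTerm φ s a)
      fTerm = (4B * 4B) * ∑ (bits L) (faintTerm φ s a)
      0≤dTerm : 0ℚ ≤ℚ dTerm
      0≤dTerm = 0≤-* 0≤4B (∑-nonneg (bits L) (0≤deepTerm φ s a))
      0≤fTerm : 0ℚ ≤ℚ fTerm
      0≤fTerm = 0≤-* (0≤-sq 4B) (∑-nonneg (bits L) (0≤faintTerm φ s a))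
      interchange : ∀ c x → (c * (x * x)) * (c * (x * x)) ≡ (c * c) * ((x * x) * (x * x))
      interchange = solve-∀ ℚ-ring
      x-small : 4B * (x * x) ≤ℚ 1ℚ
      x-small = root-small (4B * (x * x)) (0≤-* 0≤4B (0≤-sq x)) (ℚₚ.≤-<-trans
        (ℚₚ.≤-trans (ℚₚ.≤-reflexive (interchange 4B x))
          (ℚₚ.≤-trans (*-monoˡ (0≤-sq 4B) (∑-term L (0≤faintTerm φ s a) U))
            (≤-via dTerm (ℚₚ.+-comm dTerm fTerm) 0≤dTerm))) dev<1)
      y-small : 4B * (y * y) ≤ℚ 1ℚ
      y-small = ℚₚ.≤-trans
        (ℚₚ.≤-trans (*-monoˡ 0≤4B (subst (_≤ℚ ∑ (bits L) (deepTerm φ s a))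
            (trans (cong (λ b → 𝟙 b * (y * y)) (Equivalence.to Boolₚ.T-≡ (ℕₚ.<⇒<ᵇ (s≤s light)))) (ℚₚ.*-identityˡ (y * y)))
            (∑-term L (0≤deepTerm φ s a) U)))
          (≤-via fTerm refl 0≤fTerm)) (ℚₚ.<⇒≤ dev<1)

    𝔼-deviation : ∀ (R : Tree (Fin L)) (R-prob : IsProb R) p (0≤p : 0ℚ ≤ℚ p) →
      (∀ w → 𝔼 R (λ v → 𝟙 (v ≟ᵇ w)) ≤ℚ p) →
      ∀ (a : Vec Bool n → ℚ) → ∑ (bits n) (λ S → a S * a S) ≤ℚ 1ℚ →
      𝔼 (vec R n) (λ φ → 𝔼 (bits n) (λ s → deviation φ s a))
        ≤ℚ 4B * ((ℕ→ℚ (suc k) * ℕ→ℚ (suc k)) * p) + (4B * 4B) * ((ℕ→ℚ (3 ^ k) * ℕ→ℚ (3 ^ k)) * (τ + p))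
    𝔼-deviation {L = L} {n = n} R R-prob p 0≤p R-point a total = begin
      𝔼 (vec R n) (λ φ → 𝔼 (bits n) (λ s → deviation φ s a))
        ≡⟨ trans (∫-cong ½ (vec R n) (λ φ → trans (∫-+ ½ (bits n) (λ s → 4B * D φ s) (λ s → (4B * 4B) * F φ s))
             (cong₂ _+_ (∫-*ˡ ½ (bits n) 4B (D φ)) (∫-*ˡ ½ (bits n) (4B * 4B) (F φ)))))
           (trans (∫-+ ½ (vec R n) (λ φ → 4B * 𝔼 (bits n) (D φ)) (λ φ → (4B * 4B) * 𝔼 (bits n) (F φ)))
             (cong₂ _+_ (∫-*ˡ ½ (vec R n) 4B (λ φ → 𝔼 (bits n) (D φ))) (∫-*ˡ ½ (vec R n) (4B * 4B) (λ φ → 𝔼 (bits n) (F φ))))) ⟩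
      4B * 𝔼 (vec R n) (λ φ → 𝔼 (bits n) (D φ)) + (4B * 4B) * 𝔼 (vec R n) (λ φ → 𝔼 (bits n) (F φ))
        ≤⟨ ℚₚ.+-mono-≤
             (*-monoˡ 0≤4B (ℚₚ.≤-trans (heavy-part (suc k) (deep a) (deep-support a)) (ℚₚ.≤-trans
               (*-monoˡ (0≤-* (0≤-sq (ℕ→ℚ (suc k))) 0≤p) (part-total (λ S → not (lightᵇ S)))) (ℚₚ.≤-reflexive (ℚₚ.*-identityʳ _)))))
             (*-monoˡ (0≤-sq 4B) (light-part k τ (faint a) (faint-support a) (faint-small a) 0≤τ
               (part-total (λ S → lightᵇ S ∧ not (largeᵇ (a S)))))) ⟩
      4B * ((ℕ→ℚ (suc k) * ℕ→ℚ (suc k)) * p) + (4B * 4B) * ((ℕ→ℚ (3 ^ k) * ℕ→ℚ (3 ^ k)) * (τ + p)) ∎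
      where
      open HashedSpectrum R R-prob p 0≤p R-point
      open ℚₚ.≤-Reasoning
      D F : Vec (Fin L) n → Vec Bool n → ℚ
      D φ s = ∑ (bits L) (deepTerm φ s a)
      F φ s = ∑ (bits L) (faintTerm φ s a)
      part-total : ∀ (P : Vec Bool n → Bool) → ∑ (bits n) (λ S → (𝟙 (P S) * a S) * (𝟙 (P S) * a S)) ≤ℚ 1ℚ
      part-total P = ℚₚ.≤-trans (∑-mono (bits n) (λ S → 𝟙-sq≤ (P S) (a S))) total

-- Sampling

sumOver : ∀ {m} → (A → ℚ) → Vec A m → ℚ
sumOver Z [] = 0ℚ
sumOver Z (a ∷ v) = Z a + sumOver Z v

𝔼-sumOver : (t : Tree A) → IsProb t → (Y : A → ℚ) → 𝔼 t Y ≡ 0ℚ → ∀ m → 𝔼 (vec t m) (sumOver Y) ≡ 0ℚ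
𝔼-sumOver t t-prob Y centred zero = refl
𝔼-sumOver t t-prob Y centred (suc m) =
  trans (∫-vec ½ t m (sumOver Y))
  (trans (∫-cong ½ t (λ a → trans (∫-+ ½ (vec t m) (λ _ → Y a) (sumOver Y))
    (trans (cong₂ _+_ (𝔼-const (vec t m) (IsProb-vec t t-prob m) (Y a)) (𝔼-sumOver t t-prob Y centred m)) (ℚₚ.+-identityʳ (Y a)))))
  centred)

variance-sum : (t : Tree A) → IsProb t → (Y : A → ℚ) → 𝔼 t Y ≡ 0ℚ → 𝔼 t (λ a → Y a * Y a) ≤ℚ 1ℚ →
  ∀ m → 𝔼 (vec t m) (λ v → sumOver Y v * sumOver Y v) ≤ℚ ℕ→ℚ m
variance-sum t t-prob Y centred var≤1 zero = ℚₚ.≤-refl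
variance-sum t t-prob Y centred var≤1 (suc m) = begin
  𝔼 (vec t (suc m)) (λ v → sumOver Y v * sumOver Y v)
    ≡⟨ ∫-vec ½ t m (λ v → sumOver Y v * sumOver Y v) ⟩
  𝔼 t (λ a → 𝔼 (vec t m) (λ v → (Y a + sumOver Y v) * (Y a + sumOver Y v)))
    ≡⟨ ∫-cong ½ t inner ⟩
  𝔼 t (λ a → Y a * Y a + V)
    ≡⟨ trans (∫-+ ½ t (λ a → Y a * Y a) (λ _ → V)) (cong (λ z → 𝔼 t (λ a → Y a * Y a) + z) (𝔼-const t t-prob V)) ⟩
  𝔼 t (λ a → Y a * Y a) + V
    ≤⟨ ℚₚ.+-mono-≤ var≤1 (variance-sum t t-prob Y centred var≤1 m) ⟩
  1ℚ + ℕ→ℚ m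
    ≡⟨ sym (ℕ→ℚ-suc m) ⟩
  ℕ→ℚ (suc m) ∎
  where
  open ℚₚ.≤-Reasoning
  V : ℚ
  V = 𝔼 (vec t m) (λ v → sumOver Y v * sumOver Y v)
  expand : ∀ y z → (y + z) * (y + z) ≡ y * y + (((1ℚ + 1ℚ) * y) * z + z * z)
  expand = solve-∀ ℚ-ring
  drop : ∀ y V → y * y + (((1ℚ + 1ℚ) * y) * 0ℚ + V) ≡ y * y + V
  drop = solve-∀ ℚ-ring
  inner : ∀ a → 𝔼 (vec t m) (λ v → (Y a + sumOver Y v) * (Y a + sumOver Y v)) ≡ Y a * Y a + V
  inner a =
    trans (∫-cong ½ (vec t m) (λ v → expand (Y a) (sumOver Y v)))
    (trans (∫-+ ½ (vec t m) (λ _ → Y a * Y a) (λ v → ((1ℚ + 1ℚ) * Y a) * sumOver Y v + sumOver Y v * sumOver Y v))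
    (trans (cong₂ _+_ (𝔼-const (vec t m) (IsProb-vec t t-prob m) (Y a * Y a))
      (trans (∫-+ ½ (vec t m) (λ v → ((1ℚ + 1ℚ) * Y a) * sumOver Y v) (λ v → sumOver Y v * sumOver Y v))
        (cong (_+ V) (trans (∫-*ˡ ½ (vec t m) ((1ℚ + 1ℚ) * Y a) (sumOver Y))
          (cong (λ z → ((1ℚ + 1ℚ) * Y a) * z) (𝔼-sumOver t t-prob Y centred m))))))
    (drop (Y a) V)))

sumOver-centre : ∀ {m} (Z : A → ℚ) μ (v : Vec A m) → sumOver (λ a → Z a - μ) v ≡ sumOver Z v - ℕ→ℚ m * μ
sumOver-centre Z μ [] = sym (trans (ℚₚ.+-identityˡ (- (0ℚ * μ))) (cong -_ (ℚₚ.*-zeroˡ μ)))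
sumOver-centre {m = suc m} Z μ (a ∷ v) =
  trans (cong (λ z → (Z a - μ) + z) (sumOver-centre Z μ v))
  (trans (regroup (Z a) μ (sumOver Z v) (ℕ→ℚ m)) (cong (λ z → (Z a + sumOver Z v) - z * μ) (sym (ℕ→ℚ-suc m))))
  where
  regroup : ∀ a μ s m → (a - μ) + (s - m * μ) ≡ (a + s) - (1ℚ + m) * μ
  regroup = solve-∀ ℚ-ring

farᵇ : ℚ → ∀ {m} → (A → ℚ) → ℚ → Vec A m → Bool
farᵇ bound {m} Z μ v = not (does ((sumOver Z v - ℕ→ℚ m * μ) * (sumOver Z v - ℕ→ℚ m * μ) ℚₚ.≤? bound))

-- For values ±1 the variance of one sample is 1 - μ², so independent samples give the sum a
-- variance of at most m. The bound is multiplied out to avoid dividing by `bound`.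
chebyshev : (t : Tree A) → IsProb t → (Z : A → ℚ) → (∀ a → Z a * Z a ≡ 1ℚ) → ∀ m bound → 0ℚ ≤ℚ bound →
  𝔼 (vec t m) (λ v → 𝟙 (farᵇ bound Z (𝔼 t Z) v)) * bound ≤ℚ ℕ→ℚ m
chebyshev t t-prob Z unit m bound 0≤bound = begin
  𝔼 (vec t m) (λ v → 𝟙 (farᵇ bound Z μ v)) * bound
    ≡⟨ sym (∫-*ʳ ½ (vec t m) bound (λ v → 𝟙 (farᵇ bound Z μ v))) ⟩
  𝔼 (vec t m) (λ v → 𝟙 (farᵇ bound Z μ v) * bound)
    ≤⟨ 𝔼-mono (vec t m) pointwise ⟩
  𝔼 (vec t m) (λ v → sumOver Y v * sumOver Y v)
    ≤⟨ variance-sum t t-prob Y centred variance m ⟩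
  ℕ→ℚ m ∎
  where
  open ℚₚ.≤-Reasoning
  μ : ℚ
  μ = 𝔼 t Z
  Y : _ → ℚ
  Y a = Z a - μ
  centred : 𝔼 t Y ≡ 0ℚ
  centred = trans (∫-+ ½ t Z (λ _ → - μ)) (trans (cong (λ z → μ + z) (𝔼-const t t-prob (- μ))) (ℚₚ.+-inverseʳ μ))
  square : ∀ z μ → (z - μ) * (z - μ) ≡ z * z + ((- (1ℚ + 1ℚ) * μ) * z + μ * μ)
  square = solve-∀ ℚ-ring
  collect : ∀ μ → 1ℚ ≡ (1ℚ + ((- (1ℚ + 1ℚ) * μ) * μ + μ * μ)) + μ * μ
  collect = solve-∀ ℚ-ring
  variance : 𝔼 t (λ a → Y a * Y a) ≤ℚ 1ℚ
  variance = ℚₚ.≤-trans (ℚₚ.≤-reflexive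
    (trans (∫-cong ½ t (λ a → trans (square (Z a) μ) (cong (_+ ((- (1ℚ + 1ℚ) * μ) * Z a + μ * μ)) (unit a))))
    (trans (∫-+ ½ t (λ _ → 1ℚ) (λ a → (- (1ℚ + 1ℚ) * μ) * Z a + μ * μ)) (cong₂ _+_ t-prob
      (trans (∫-+ ½ t (λ a → (- (1ℚ + 1ℚ) * μ) * Z a) (λ _ → μ * μ))
        (cong₂ _+_ (∫-*ˡ ½ t (- (1ℚ + 1ℚ) * μ) Z) (𝔼-const t t-prob (μ * μ))))))))
    (≤-via (μ * μ) (collect μ) (0≤-sq μ))
  dichotomy : ∀ x → 0ℚ ≤ℚ x → (d : Dec (x ≤ℚ bound)) → 𝟙 (not (does d)) * bound ≤ℚ x
  dichotomy x 0≤x (yes _) = subst (_≤ℚ x) (sym (ℚₚ.*-zeroˡ bound)) 0≤x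
  dichotomy x 0≤x (no x≰) = subst (_≤ℚ x) (sym (ℚₚ.*-identityˡ bound)) (ℚₚ.<⇒≤ (ℚₚ.≰⇒> x≰))
  pointwise : ∀ (v : Vec _ m) → 𝟙 (farᵇ bound Z μ v) * bound ≤ℚ sumOver Y v * sumOver Y v
  pointwise v = subst (𝟙 (farᵇ bound Z μ v) * bound ≤ℚ_) (sym (cong₂ _*_ (sumOver-centre Z μ v) (sumOver-centre Z μ v)))
    (dichotomy ((sumOver Z v - ℕ→ℚ m * μ) * (sumOver Z v - ℕ→ℚ m * μ)) (0≤-sq (sumOver Z v - ℕ→ℚ m * μ))
      ((sumOver Z v - ℕ→ℚ m * μ) * (sumOver Z v - ℕ→ℚ m * μ) ℚₚ.≤? bound))

countᵇ : ∀ {m} → (A → Bool) → Vec A m → ℕ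
countᵇ P [] = 0
countᵇ P (a ∷ v) = if P a then suc (countᵇ P v) else countᵇ P v

countᵇ-mono : ∀ {m} {P Q : A → Bool} → (∀ a → P a ≡ true → Q a ≡ true) → (v : Vec A m) → countᵇ P v ≤ countᵇ Q v
countᵇ-mono imp [] = z≤n
countᵇ-mono {P = P} {Q} imp (a ∷ v) with P a in p | Q a in q
... | true | true = s≤s (countᵇ-mono imp v)
... | true | false = true≢false (trans (sym (imp a p)) q)
... | false | true = ℕₚ.m≤n⇒m≤1+n (countᵇ-mono imp v)
... | false | false = countᵇ-mono imp v

common-good : ∀ {m} (P Q : A → Bool) (v : Vec A m) → countᵇ P v ℕ.+ countᵇ Q v ℕ.< m → ∃ λ a → P a ≡ false × Q a ≡ false
common-good P Q [] ()
common-good {m = suc m} P Q (a ∷ v) lt with P a in p | Q a in q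
... | false | false = a , p , q
... | true | false = common-good P Q v (ℕ.s≤s⁻¹ lt)
... | false | true = common-good P Q v (ℕ.s≤s⁻¹ (subst (ℕ._< suc m) (ℕₚ.+-suc (countᵇ P v) (countᵇ Q v)) lt))
... | true | true = common-good P Q v (ℕₚ.≤-trans (ℕₚ.n≤1+n _)
    (ℕ.s≤s⁻¹ (subst (ℕ._< suc m) (cong suc (ℕₚ.+-suc (countᵇ P v) (countᵇ Q v))) lt)))

-- Exponential Markov inequality: 64 to the number of bad groups has mean at most (1 + 63/64)^(2H) ≤
-- 4^H, while H bad groups make it at least 64^H. The quotient is 16^H.
majority : (t : Tree A) → IsProb t → (P : A → Bool) → (+ 64 / 1) * 𝔼 t (λ a → 𝟙 (P a)) ≤ℚ 1ℚ → ∀ H →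
  𝔼 (vec t (2 ℕ.* H)) (λ v → 𝟙 (H ℕ.≤ᵇ countᵇ P v)) * ℕ→ℚ (16 ^ H) ≤ℚ 1ℚ
majority {A} t t-prob P rare H = ℚₚ.*-cancelʳ-≤-pos (ℕ→ℚ (2 ^ (2 ℕ.* H))) {{positive-2^}} (begin
  (q * ℕ→ℚ (16 ^ H)) * ℕ→ℚ (2 ^ (2 ℕ.* H))
    ≡⟨ trans (ℚₚ.*-assoc q (ℕ→ℚ (16 ^ H)) (ℕ→ℚ (2 ^ (2 ℕ.* H)))) (cong (q *_) (trans (sym (ℕ→ℚ-* (16 ^ H) (2 ^ (2 ℕ.* H)))) (cong ℕ→ℚ powers))) ⟩
  q * ℕ→ℚ (64 ^ H)
    ≡⟨ sym (∫-*ʳ ½ (vec t (2 ℕ.* H)) (ℕ→ℚ (64 ^ H)) (λ v → 𝟙 (H ℕ.≤ᵇ countᵇ P v))) ⟩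
  𝔼 (vec t (2 ℕ.* H)) (λ v → 𝟙 (H ℕ.≤ᵇ countᵇ P v) * ℕ→ℚ (64 ^ H))
    ≤⟨ 𝔼-mono (vec t (2 ℕ.* H)) (λ v → markov (countᵇ P v)) ⟩
  𝔼 (vec t (2 ℕ.* H)) (λ v → ℕ→ℚ (64 ^ countᵇ P v))
    ≤⟨ exponential (2 ℕ.* H) ⟩
  ℕ→ℚ (2 ^ (2 ℕ.* H))
    ≡⟨ sym (ℚₚ.*-identityˡ (ℕ→ℚ (2 ^ (2 ℕ.* H)))) ⟩
  1ℚ * ℕ→ℚ (2 ^ (2 ℕ.* H)) ∎)
  where
  open ℚₚ.≤-Reasoning
  q : ℚ
  q = 𝔼 (vec t (2 ℕ.* H)) (λ v → 𝟙 (H ℕ.≤ᵇ countᵇ P v))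
  positive-2^ : Data.Rational.Positive (ℕ→ℚ (2 ^ (2 ℕ.* H)))
  positive-2^ = Data.Rational.positive (ℚₚ.<-≤-trans (ℚₚ.positive⁻¹ 1ℚ) (ℕ→ℚ-mono (ℕₚ.m^n>0 2 (2 ℕ.* H))))
  powers : 16 ^ H ℕ.* 2 ^ (2 ℕ.* H) ≡ 64 ^ H
  powers = trans (cong (ℕ._* 2 ^ (2 ℕ.* H)) (ℕₚ.^-*-assoc 2 4 H))
    (trans (sym (ℕₚ.^-distribˡ-+-* 2 (4 ℕ.* H) (2 ℕ.* H)))
    (trans (cong (2 ^_) (sym (ℕₚ.*-distribʳ-+ H 4 2))) (sym (ℕₚ.^-*-assoc 2 6 H))))
  markov : ∀ c → 𝟙 (H ℕ.≤ᵇ c) * ℕ→ℚ (64 ^ H) ≤ℚ ℕ→ℚ (64 ^ c)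
  markov c with H ℕ.≤ᵇ c in eq
  ... | false = subst (_≤ℚ ℕ→ℚ (64 ^ c)) (sym (ℚₚ.*-zeroˡ (ℕ→ℚ (64 ^ H)))) (0≤ℕ→ℚ (64 ^ c))
  ... | true = subst (_≤ℚ ℕ→ℚ (64 ^ c)) (sym (ℚₚ.*-identityˡ (ℕ→ℚ (64 ^ H))))
                 (ℕ→ℚ-mono (ℕₚ.^-monoʳ-≤ 64 (ℕₚ.≤ᵇ⇒≤ H c (subst Data.Bool.T (sym eq) _))))
  split : ∀ a c → ℕ→ℚ (64 ^ (if P a then suc c else c)) ≡ (1ℚ + (+ 63 / 1) * 𝟙 (P a)) * ℕ→ℚ (64 ^ c)
  split a c with P a
  ... | true = ℕ→ℚ-* 64 (64 ^ c)
  ... | false = sym (ℚₚ.*-identityˡ (ℕ→ℚ (64 ^ c)))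
  one-step : 𝔼 t (λ a → 1ℚ + (+ 63 / 1) * 𝟙 (P a)) ≤ℚ ℕ→ℚ 2
  one-step = ℚₚ.≤-trans (ℚₚ.≤-reflexive (trans (∫-+ ½ t (λ _ → 1ℚ) (λ a → (+ 63 / 1) * 𝟙 (P a)))
      (cong₂ _+_ t-prob (∫-*ˡ ½ t (+ 63 / 1) (λ a → 𝟙 (P a))))))
    (ℚₚ.+-monoʳ-≤ 1ℚ (ℚₚ.≤-trans (*-monoʳ (∫-nonneg 0≤½ t (λ a → 0≤𝟙 (P a))) 63≤64) rare))
    where
    63≤64 : (+ 63 / 1) ≤ℚ (+ 64 / 1)
    63≤64 = ≤-via 1ℚ refl 0≤1
  exponential : ∀ m → 𝔼 (vec t m) (λ v → ℕ→ℚ (64 ^ countᵇ P v)) ≤ℚ ℕ→ℚ (2 ^ m)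
  exponential zero = ℚₚ.≤-refl
  exponential (suc m) = begin
    𝔼 (vec t (suc m)) (λ v → ℕ→ℚ (64 ^ countᵇ P v))
      ≡⟨ trans (∫-vec ½ t m (λ v → ℕ→ℚ (64 ^ countᵇ P v))) (∫-cong ½ t (λ a → trans (∫-cong ½ (vec t m) (λ v → split a (countᵇ P v)))
           (∫-*ˡ ½ (vec t m) (1ℚ + (+ 63 / 1) * 𝟙 (P a)) (λ v → ℕ→ℚ (64 ^ countᵇ P v))))) ⟩
    𝔼 t (λ a → (1ℚ + (+ 63 / 1) * 𝟙 (P a)) * W)
      ≡⟨ ∫-*ʳ ½ t W (λ a → 1ℚ + (+ 63 / 1) * 𝟙 (P a)) ⟩
    𝔼 t (λ a → 1ℚ + (+ 63 / 1) * 𝟙 (P a)) * W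
      ≤⟨ *-monoʳ (∫-nonneg 0≤½ (vec t m) (λ v → 0≤ℕ→ℚ (64 ^ countᵇ P v))) one-step ⟩
    ℕ→ℚ 2 * W
      ≤⟨ *-monoˡ (0≤ℕ→ℚ 2) (exponential m) ⟩
    ℕ→ℚ 2 * ℕ→ℚ (2 ^ m)
      ≡⟨ sym (ℕ→ℚ-* 2 (2 ^ m)) ⟩
    ℕ→ℚ (2 ^ suc m) ∎
    where
    W : ℚ
    W = 𝔼 (vec t m) (λ v → ℕ→ℚ (64 ^ countᵇ P v))

ball-size : ∀ L k → ∑ (bits L) (λ U → 𝟙 (weight U ℕ.<ᵇ suc k)) ≤ℚ ℕ→ℚ (suc L ^ k)
ball-size zero k = ℕ→ℚ-mono (ℕₚ.m^n>0 1 k)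
ball-size (suc L) zero = ℚₚ.≤-trans (ℚₚ.≤-reflexive (trans (∑-bits L (λ U → 𝟙 (weight U ℕ.<ᵇ 1)))
  (trans (cong (_+ ∑ (bits L) (λ U → 𝟙 (weight U ℕ.<ᵇ 1))) (∫-zero 1ℚ (bits L))) (ℚₚ.+-identityˡ _)))) (ball-size L zero)
ball-size (suc L) (suc k) = begin
  ∑ (bits (suc L)) (λ U → 𝟙 (weight U ℕ.<ᵇ suc (suc k)))
    ≡⟨ ∑-bits L (λ U → 𝟙 (weight U ℕ.<ᵇ suc (suc k))) ⟩
  ∑ (bits L) (λ U → 𝟙 (weight U ℕ.<ᵇ suc k)) + ∑ (bits L) (λ U → 𝟙 (weight U ℕ.<ᵇ suc (suc k)))
    ≤⟨ ℚₚ.+-mono-≤ (ball-size L k) (ball-size L (suc k)) ⟩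
  ℕ→ℚ (suc L ^ k) + ℕ→ℚ (suc L ^ suc k)
    ≡⟨ sym (ℕ→ℚ-+ (suc L ^ k) (suc L ^ suc k)) ⟩
  -- Pascal's recursion: the two counts add up to (L + 2)(L + 1)^k.
  ℕ→ℚ (suc (suc L) ℕ.* suc L ^ k)
    ≤⟨ ℕ→ℚ-mono (ℕₚ.*-monoʳ-≤ (suc (suc L)) (ℕₚ.^-monoˡ-≤ k (ℕₚ.n≤1+n (suc L)))) ⟩
  ℕ→ℚ (suc (suc L) ^ suc k) ∎
  where open ℚₚ.≤-Reasoning

-- Matching the relevant coordinates of two functions

module Matching (k : ℕ) (T τ : ℚ) (0≤T : 0ℚ ≤ℚ T) (0≤τ : 0ℚ ≤ℚ τ) (τT≡1 : τ * T ≡ 1ℚ) where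
  open Thresholds k T τ 0≤T 0≤τ τT≡1

  significantᵇ : (Vec Bool n → ℚ) → Vec Bool n → Bool
  significantᵇ a S = lightᵇ S ∧ largeᵇ (a S)

  Covers : (Vec Bool n → ℚ) → (Fin n → Bool) → Set
  Covers a A = ∀ S → significantᵇ a S ≡ true → S ⊆ A

  top-insignificant : ∀ (a : Vec Bool n → ℚ) S → significantᵇ a S ≡ false → top a S ≡ 0ℚ
  top-insignificant a S eq = trans (cong (λ b → 𝟙 b * a S) eq) (ℚₚ.*-zeroˡ (a S))

  residue : ∀ (a : Vec Bool n → ℚ) S → weight S ≤ k → (a S - top a S) * (a S - top a S) ≤ℚ τ
  residue a S light = subst (λ z → z * z ≤ℚ τ) (sym difference) (faint-small a S)
    where
    not-deep : deep a S ≡ 0ℚ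
    not-deep with deep-support a S
    ... | inj₁ eq = eq
    ... | inj₂ heavy = ⊥-elim (ℕₚ.<⇒≱ heavy light)
    cancel : ∀ t f → (t + (f + 0ℚ)) - t ≡ f
    cancel = solve-∀ ℚ-ring
    difference : a S - top a S ≡ faint a S
    difference = trans (cong (_- top a S) (trans (decompose a S) (cong (λ z → top a S + (faint a S + z)) not-deep)))
      (cancel (top a S) (faint a S))

  -- Labels that separate A separate its subsets, so no significant set other than S can fold to
  -- `push φ S`. S itself need only lie in A: if it is insignificant both sides vanish.
  fold-top : ∀ (a : Vec Bool n → ℚ) {A} → Covers a A → (φ : Vec (Fin L) n) → InjectiveOn A φ → ∀ s S → S ⊆ A →
    fold φ s (push φ S) (top a) ≡ top a S * χ S s
  fold-top {n} a {A} covers φ inj s S S⊆A = trans (∫-cong 1ℚ (bits n) term) (∑-point n S (λ W → top a W * χ W s))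
    where
    open ℚₚ.≤-Reasoning
    swap-last : ∀ x y z → (x * y) * z ≡ (x * z) * y
    swap-last = solve-∀ ℚ-ring
    vanish : ∀ x y → (0ℚ * x) * y ≡ 0ℚ
    vanish = solve-∀ ℚ-ring
    off : ∀ W → S ≢ W → top a W * 𝟙 (push φ W == push φ S) ≡ 0ℚ
    off W S≢W with significantᵇ a W in sig
    ... | false = vanish (a W) (𝟙 (push φ W == push φ S))
    ... | true = trans (cong (λ b → (1ℚ * a W) * 𝟙 b) (==-false (push φ W) (push φ S)
                   (λ eq → S≢W (sym (push-injective φ inj W S (covers W sig) S⊆A eq))))) (ℚₚ.*-zeroʳ (1ℚ * a W))
    term : ∀ W → (top a W * 𝟙 (push φ W == push φ S)) * χ W s ≡ (top a W * χ W s) * 𝟙 (S == W)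
    term W with ≡-dec Boolₚ._≟_ S W
    ... | yes refl = trans (cong (λ b → (top a S * 𝟙 b) * χ S s) (==-refl (push φ S))) (swap-last (top a S) 1ℚ (χ S s))
    ... | no S≢W = trans (cong (_* χ W s) (off W S≢W)) (trans (ℚₚ.*-zeroˡ (χ W s)) (sym (ℚₚ.*-zeroʳ (top a W * χ W s))))

  fold-missing : ∀ (a : Vec Bool n → ℚ) (φ : Vec (Fin L) n) s U → (∀ W → significantᵇ a W ≡ true → push φ W ≢ U) →
    fold φ s U (top a) ≡ 0ℚ
  fold-missing {n} a φ s U missing = trans (∫-cong 1ℚ (bits n) term) (∫-zero 1ℚ (bits n))
    where
    vanish : ∀ x y z → ((0ℚ * x) * y) * z ≡ 0ℚ
    vanish = solve-∀ ℚ-ring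
    vanish′ : ∀ x z → (x * 0ℚ) * z ≡ 0ℚ
    vanish′ = solve-∀ ℚ-ring
    term : ∀ W → (top a W * 𝟙 (push φ W == U)) * χ W s ≡ 0ℚ
    term W with significantᵇ a W in sig
    ... | false = vanish (a W) (𝟙 (push φ W == U)) (χ W s)
    ... | true = trans (cong (λ b → ((1ℚ * a W) * 𝟙 b) * χ W s) (==-false (push φ W) U (missing W sig))) (vanish′ (1ℚ * a W) (χ W s))

  -- An index with no partner of the same label gets a coordinate outside A′, so that sets of
  -- A′-side coordinates using it are insignificant. The implication in `Unmatched` also covers
  -- coordinates outside A.
  Matched Unmatched : (A A′ : Fin n → Bool) (ψ : Vec (Fin L) n) (i i′ : Fin n) → Set
  Matched A A′ ψ i i′ = A i ≡ true × A′ i′ ≡ true × lookup ψ i ≡ lookup ψ i′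
  Unmatched A A′ ψ i i′ = A′ i′ ≡ false × (A i ≡ true → ∀ j → A′ j ≡ true → lookup ψ j ≢ lookup ψ i)

  all-or-some : ∀ {m} {P Q : Fin m → Set} → (∀ r → P r ⊎ Q r) → (∀ r → P r) ⊎ ∃ Q
  all-or-some {zero} f = inj₁ (λ ())
  all-or-some {suc m} f with f zero | all-or-some (λ r → f (suc r))
  ... | inj₂ q | _ = inj₂ (zero , q)
  ... | inj₁ p | inj₂ (r , q) = inj₂ (suc r , q)
  ... | inj₁ p | inj₁ ps = inj₁ λ { zero → p ; (suc r) → ps r }

  InjectiveVec : ∀ {m} → Vec (Fin n) m → Set
  InjectiveVec ι = ∀ r r′ → lookup ι r ≡ lookup ι r′ → r ≡ r′

  -- Each data set serves one case. Partners are defined by equal ψ-labels, which fixes both the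
  -- φ-label and the sign s, so the first data set compares matched sets with equal signs; their
  -- signs s₂ may differ. A missing partner means that no coordinate of A′ has the ψ-label, which
  -- only the data set labelled by ψ can detect.
  module Transfer
    (B : ℚ) (0≤B : 0ℚ ≤ℚ B) (Bτ≤1 : B * τ ≤ℚ 1ℚ) {n L L₂ : ℕ}
    (φ : Vec (Fin L) n) (s : Vec Bool n) (ψ : Vec (Fin L₂) n) (s₂ : Vec Bool n)
    (ψ-determines : ∀ i j → lookup ψ i ≡ lookup ψ j → lookup φ i ≡ lookup φ j × lookup s i ≡ lookup s j)
    (a a′ : Vec Bool n → ℚ) (A A′ : Fin n → Bool) (covers : Covers a A) (covers′ : Covers a′ A′)
    (inj : InjectiveOn A φ) (inj′ : InjectiveOn A′ φ)
    (close : ∀ U → weight U ≤ k → B * ((fold φ s U (top a) - fold φ s U (top a′)) * (fold φ s U (top a) - fold φ s U (top a′))) ≤ℚ (+ 16 / 1))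
    (close₂ : ∀ U → weight U ≤ k → B * ((fold ψ s₂ U (top a) - fold ψ s₂ U (top a′)) * (fold ψ s₂ U (top a) - fold ψ s₂ U (top a′))) ≤ℚ (+ 16 / 1))
    where

    ψ-inj : ∀ {A} → InjectiveOn A φ → InjectiveOn A ψ
    ψ-inj φ-inj i j Ai Aj eq = φ-inj i j Ai Aj (proj₁ (ψ-determines i j eq))

    χ-sq-cancel : ∀ x y (S x₀ : Vec Bool n) → B * ((x * χ S x₀ - y * χ S x₀) * (x * χ S x₀ - y * χ S x₀)) ≡ B * ((x - y) * (x - y))
    χ-sq-cancel x y S x₀ = trans (factor B x y (χ S x₀)) (trans (cong (λ z → (B * ((x - y) * (x - y))) * z) (χ-sq S x₀)) (ℚₚ.*-identityʳ _))
      where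
      factor : ∀ B x y c → B * ((x * c - y * c) * (x * c - y * c)) ≡ (B * ((x - y) * (x - y))) * (c * c)
      factor = solve-∀ ℚ-ring

    module _ (ι ι′ : Vec (Fin n) k) (ι-inj : InjectiveVec ι) (ι′-inj : InjectiveVec ι′)
             (paired : ∀ r → Matched A A′ ψ (lookup ι r) (lookup ι′ r) ⊎ Unmatched A A′ ψ (lookup ι r) (lookup ι′ r)) where

      private
        light : ∀ (j : Vec (Fin n) k) V → weight (push j V) ≤ k
        light j V = ℕₚ.≤-trans (weight-push j V) (weight≤ V)

        member : ∀ (j : Vec (Fin n) k) → InjectiveVec j → ∀ V r → lookup V r ≡ true → lookup (push j V) (lookup j r) ≡ true
        member j j-inj V r r∈V = push-hit j V r r∈V (λ r′ _ eq → j-inj r′ r eq)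

        inside : ∀ (j : Vec (Fin n) k) V {C : Fin n → Bool} → (∀ r → lookup V r ≡ true → C (lookup j r) ≡ true) → push j V ⊆ C
        inside j V {C} f i i∈ with push-witness j V i i∈
        ... | r , r∈V , refl = f r r∈V

        top-close : ∀ V → B * ((top a (push ι V) - top a′ (push ι′ V)) * (top a (push ι V) - top a′ (push ι′ V))) ≤ℚ (+ 16 / 1)
        top-close V with all-or-some {P = λ r → lookup V r ≡ true → Matched A A′ ψ (lookup ι r) (lookup ι′ r)}
                                     {Q = λ r → lookup V r ≡ true × Unmatched A A′ ψ (lookup ι r) (lookup ι′ r)} (λ r → sort r (paired r))
          where
          sort : ∀ r → Matched A A′ ψ (lookup ι r) (lookup ι′ r) ⊎ Unmatched A A′ ψ (lookup ι r) (lookup ι′ r) →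
            (lookup V r ≡ true → Matched A A′ ψ (lookup ι r) (lookup ι′ r)) ⊎ (lookup V r ≡ true × Unmatched A A′ ψ (lookup ι r) (lookup ι′ r))
          sort r (inj₁ m) = inj₁ (λ _ → m)
          sort r (inj₂ u) with lookup V r
          ... | true = inj₂ (refl , u)
          ... | false = inj₁ true≢false′
            where
            true≢false′ : false ≡ true → Matched A A′ ψ (lookup ι r) (lookup ι′ r)
            true≢false′ ()
        -- All of V is matched: both sets fold to the same labels and have the same sign, which
        -- cancels after squaring.
        ... | inj₁ matched = subst (_≤ℚ (+ 16 / 1))
              (trans (cong (λ z → B * (z * z)) (cong₂ _-_ (fold-top a covers φ inj s S S⊆A)
                (trans (cong (λ U → fold φ s U (top a′)) same-push) (trans (fold-top a′ covers′ φ inj′ s S′ S′⊆A′) (cong (top a′ S′ *_) (sym same-sign))))))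
                (χ-sq-cancel (top a S) (top a′ S′) S s))
              (close (push φ S) (ℕₚ.≤-trans (weight-push φ S) (light ι V)))
          where
          S S′ : Vec Bool n
          S = push ι V
          S′ = push ι′ V
          S⊆A : S ⊆ A
          S⊆A = inside ι V (λ r r∈V → proj₁ (matched r r∈V))
          S′⊆A′ : S′ ⊆ A′
          S′⊆A′ = inside ι′ V (λ r r∈V → proj₁ (proj₂ (matched r r∈V)))
          labels : ∀ r → lookup V r ≡ true → lookup φ (lookup ι r) ≡ lookup φ (lookup ι′ r) × lookup s (lookup ι r) ≡ lookup s (lookup ι′ r)
          labels r r∈V = ψ-determines (lookup ι r) (lookup ι′ r) (proj₂ (proj₂ (matched r r∈V)))
          via : ∀ {C : Set} (xs : Vec C n) r → lookup xs (lookup ι r) ≡ lookup xs (lookup ι′ r) → lookup (map (lookup xs) ι) r ≡ lookup (map (lookup xs) ι′) r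
          via xs r eq = trans (lookup-map r (lookup xs) ι) (trans eq (sym (lookup-map r (lookup xs) ι′)))
          same-push : push φ S ≡ push φ S′
          same-push = trans (push-push φ ι V) (trans (push-agree (map (lookup φ) ι) (map (lookup φ) ι′) V
            (λ r r∈V → via φ r (proj₁ (labels r r∈V)))) (sym (push-push φ ι′ V)))
          same-sign : χ S s ≡ χ S′ s
          same-sign = trans (χ-push ι V s) (trans (χ-agree V (gather ι s) (gather ι′ s)
            (λ r r∈V → via s r (proj₂ (labels r r∈V)))) (sym (χ-push ι′ V s)))
        -- The set on the primed side contains a coordinate outside A′ and so has no top
        -- coefficient; it remains to bound the top coefficient on the other side.
        ... | inj₂ (r , r∈V , outside , no-partner) with significantᵇ a (push ι V) in sig
        ...   | false = ℚₚ.≤-trans (ℚₚ.≤-reflexive (trans (cong₂ (λ x y → B * ((x - y) * (x - y)))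
                  (ℚₚ.*-zeroˡ (a (push ι V))) (top-insignificant a′ (push ι′ V) insig′)) (ℚₚ.*-zeroʳ B))) (ℚₚ.nonNegative⁻¹ (+ 16 / 1))
          where
          insig′ : significantᵇ a′ (push ι′ V) ≡ false
          insig′ with significantᵇ a′ (push ι′ V) in sig′
          ... | false = refl
          ... | true = trans (sym (covers′ (push ι′ V) sig′ (lookup ι′ r) (member ι′ ι′-inj V r r∈V))) outside
        -- The ψ-label of the unmatched coordinate survives in `push ψ S`, but no significant set of
        -- a′ can produce it. The folded top part of a′ is zero there, while that of a is the
        -- coefficient itself up to sign.
        ...   | true = subst (_≤ℚ (+ 16 / 1))
                (trans (cong (λ z → B * (z * z)) (cong₂ _-_ (fold-top a covers ψ (ψ-inj inj) s₂ S S⊆A)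
                  (trans (fold-missing a′ ψ s₂ (push ψ S) missing) (sym (ℚₚ.*-zeroˡ (χ S s₂))))))
                  (trans (χ-sq-cancel (top a S) 0ℚ S s₂) (cong₂ (λ x y → B * ((x - y) * (x - y))) (cong (λ b → 𝟙 b * a S) sig) (sym (top-insignificant a′ (push ι′ V) insig′)))))
                (close₂ (push ψ S) (ℕₚ.≤-trans (weight-push ψ S) (light ι V)))
          where
          insig′ : significantᵇ a′ (push ι′ V) ≡ false
          insig′ with significantᵇ a′ (push ι′ V) in sig′
          ... | false = refl
          ... | true = trans (sym (covers′ (push ι′ V) sig′ (lookup ι′ r) (member ι′ ι′-inj V r r∈V))) outside
          S : Vec Bool n
          S = push ι V
          S⊆A : S ⊆ A
          S⊆A = covers S sig
          r∈S : lookup S (lookup ι r) ≡ true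
          r∈S = member ι ι-inj V r r∈V
          hit : lookup (push ψ S) (lookup ψ (lookup ι r)) ≡ true
          hit = push-hit ψ S (lookup ι r) r∈S (λ j j∈S → ψ-inj inj j (lookup ι r) (S⊆A j j∈S) (S⊆A (lookup ι r) r∈S))
          missing : ∀ W → significantᵇ a′ W ≡ true → push ψ W ≢ push ψ S
          missing W sigW eq with push-witness ψ W (lookup ψ (lookup ι r)) (subst (λ U → lookup U (lookup ψ (lookup ι r)) ≡ true) (sym eq) hit)
          ... | j , j∈W , same = no-partner (S⊆A (lookup ι r) r∈S) j (covers′ W sigW j j∈W) same

      -- Pass from a to its top part, across to the top part of a′, and back to a′. The two residues
      -- cost 1 each by Bτ ≤ 1 and the crossing costs 16; three squares give 54 = 3(1 + 16 + 1).
      coefficients-close : ∀ V → B * ((a (push ι V) - a′ (push ι′ V)) * (a (push ι V) - a′ (push ι′ V))) ≤ℚ (+ 54 / 1)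
      coefficients-close V = begin
        B * ((a S - a′ S′) * (a S - a′ S′))
          ≤⟨ *-monoˡ 0≤B (≤-via e (three (a S) (top a S) (a′ S′) (top a′ S′))
               (0≤-+ (0≤-+ (0≤-sq (x - y)) (0≤-sq (y - z))) (0≤-sq (x - z)))) ⟩
        B * (3ℚ * ((x * x + y * y) + z * z))
          ≡⟨ spread B x y z ⟩
        3ℚ * ((B * (x * x) + B * (y * y)) + B * (z * z))
          ≤⟨ *-monoˡ 0≤3ℚ (ℚₚ.+-mono-≤ (ℚₚ.+-mono-≤
               (ℚₚ.≤-trans (*-monoˡ 0≤B (residue a S (light ι V))) Bτ≤1) (top-close V))
               (ℚₚ.≤-trans (*-monoˡ 0≤B (subst (_≤ℚ τ) (sq-neg (a′ S′) (top a′ S′)) (residue a′ S′ (light ι′ V)))) Bτ≤1)) ⟩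
        3ℚ * ((1ℚ + (+ 16 / 1)) + 1ℚ)
          ≡⟨⟩
        + 54 / 1 ∎
        where
        open ℚₚ.≤-Reasoning
        S S′ : Vec Bool n
        S = push ι V
        S′ = push ι′ V
        x y z e : ℚ
        x = a S - top a S
        y = top a S - top a′ S′
        z = top a′ S′ - a′ S′
        e = ((x - y) * (x - y) + (y - z) * (y - z)) + (x - z) * (x - z)
        three : ∀ p v p′ v′ → let x = p - v; y = v - v′; z = v′ - p′ in
          3ℚ * ((x * x + y * y) + z * z) ≡ (p - p′) * (p - p′) + (((x - y) * (x - y) + (y - z) * (y - z)) + (x - z) * (x - z))
        three = solve-∀ ℚ-ring
        spread : ∀ B x y z → B * (3ℚ * ((x * x + y * y) + z * z)) ≡ 3ℚ * ((B * (x * x) + B * (y * y)) + B * (z * z))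
        spread = solve-∀ ℚ-ring
        sq-neg : ∀ p v → (p - v) * (p - v) ≡ (v - p) * (v - p)
        sq-neg = solve-∀ ℚ-ring

  avoid : ∀ m (v : Vec Bool n) → m ℕ.+ weight v ≤ n → Σ (Fin m → Fin n) λ e → (∀ r → lookup v (e r) ≡ false) × (∀ r r′ → e r ≡ e r′ → r ≡ r′)
  avoid zero v _ = (λ ()) , (λ ()) , (λ ())
  avoid {suc n} (suc m) (true ∷ v) le with avoid (suc m) v (ℕ.s≤s⁻¹ (subst (ℕ._≤ suc n) (ℕₚ.+-suc (suc m) (weight v)) le))
  ... | e , out , e-inj = (λ r → suc (e r)) , out , (λ r r′ eq → e-inj r r′ (Finₚ.suc-injective eq))
  avoid (suc m) (false ∷ v) (s≤s le) with avoid m v le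
  ... | e , out , e-inj = e⁺ , out⁺ , inj⁺
    where
    e⁺ : Fin (suc m) → Fin _
    e⁺ zero = zero
    e⁺ (suc r) = suc (e r)
    out⁺ : ∀ r → lookup (false ∷ v) (e⁺ r) ≡ false
    out⁺ zero = refl
    out⁺ (suc r) = out r
    inj⁺ : ∀ r r′ → e⁺ r ≡ e⁺ r′ → r ≡ r′
    inj⁺ zero zero _ = refl
    inj⁺ (suc r) (suc r′) eq = cong suc (e-inj r r′ (Finₚ.suc-injective eq))

  -- With every coordinate active on both sides, the identity is a matching. Otherwise there are k
  -- distinct coordinates outside A′ to serve as replacements for missing partners.
  pair-up : ∀ (A A′ : Fin n → Bool) (ψ : Vec (Fin L) n) → InjectiveOn A ψ →
    (∀ i → A i ≡ true × A′ i ≡ true) ⊎ k ℕ.+ weight (tabulate A′) ≤ n →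
    (ι : Vec (Fin n) k) → InjectiveVec ι →
    Σ (Vec (Fin n) k) λ ι′ → InjectiveVec ι′ × (∀ r → Matched A A′ ψ (lookup ι r) (lookup ι′ r) ⊎ Unmatched A A′ ψ (lookup ι r) (lookup ι′ r))
  pair-up A A′ ψ inj (inj₁ full) ι ι-inj = ι , ι-inj , λ r → inj₁ (proj₁ (full _) , proj₂ (full _) , refl)
  pair-up {n} A A′ ψ inj (inj₂ room) ι ι-inj with avoid k (tabulate A′) room
  ... | e , out , e-inj = tabulate ι′ , tab-inj , tab-paired
    where
    partner? : ∀ r → Dec (A (lookup ι r) ≡ true × ∃ λ j → A′ j ≡ true × lookup ψ (lookup ι r) ≡ lookup ψ j)
    partner? r = (A (lookup ι r) Boolₚ.≟ true) ×-dec Finₚ.any? (λ j → (A′ j Boolₚ.≟ true) ×-dec (lookup ψ (lookup ι r) Fin.≟ lookup ψ j))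
    choose : ∀ r → Dec (A (lookup ι r) ≡ true × ∃ λ j → A′ j ≡ true × lookup ψ (lookup ι r) ≡ lookup ψ j) → Fin n
    choose r (yes (_ , j , _)) = j
    choose r (no _) = e r
    ι′ : Fin k → Fin n
    ι′ r = choose r (partner? r)
    out′ : ∀ r → A′ (e r) ≡ false
    out′ r = trans (sym (lookup∘tabulate A′ (e r))) (out r)
    choose-paired : ∀ r d → Matched A A′ ψ (lookup ι r) (choose r d) ⊎ Unmatched A A′ ψ (lookup ι r) (choose r d)
    choose-paired r (yes (Ai , j , A′j , eq)) = inj₁ (Ai , A′j , eq)
    choose-paired r (no none) = inj₂ (out′ r , λ Ai j A′j eq → none (Ai , j , A′j , sym eq))
    choose-inj : ∀ r r′ d d′ → choose r d ≡ choose r′ d′ → r ≡ r′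
    -- Indices sharing a partner have coordinates with equal ψ-labels, and ψ separates A.
    choose-inj r r′ (yes (Ai , j , A′j , eq)) (yes (Ai′ , .j , _ , eq′)) refl = ι-inj r r′ (inj _ _ Ai Ai′ (trans eq (sym eq′)))
    choose-inj r r′ (yes (_ , j , A′j , _)) (no _) refl = true≢false (trans (sym A′j) (out′ r′))
    choose-inj r r′ (no _) (yes (_ , j , A′j , _)) refl = true≢false (trans (sym A′j) (out′ r))
    choose-inj r r′ (no _) (no _) eq = e-inj r r′ eq
    tab-inj : InjectiveVec (tabulate ι′)
    tab-inj r r′ eq = choose-inj r r′ (partner? r) (partner? r′) (trans (sym (lookup∘tabulate ι′ r)) (trans eq (lookup∘tabulate ι′ r′)))
    tab-paired : ∀ r → Matched A A′ ψ (lookup ι r) (lookup (tabulate ι′) r) ⊎ Unmatched A A′ ψ (lookup ι r) (lookup (tabulate ι′) r)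
    tab-paired r = subst (λ i → Matched A A′ ψ (lookup ι r) i ⊎ Unmatched A A′ ψ (lookup ι r) i) (sym (lookup∘tabulate ι′ r)) (choose-paired r (partner? r))

-- Optimal juntas

find-best : (P : A → Set) (P? : ∀ a → Dec (P a)) (score : A → ℚ) (xs : List.List A) →
  (∀ a → a ∈ xs → ¬ P a) ⊎ Σ A λ a → P a × (∀ b → b ∈ xs → P b → score b ≤ℚ score a)
find-best P P? score List.[] = inj₁ (λ a ())
find-best P P? score (x List.∷ xs) with P? x | find-best P P? score xs
... | no ¬Px | inj₁ none = inj₁ λ { _ (here refl) → ¬Px ; a (there a∈) → none a a∈ }
... | no ¬Px | inj₂ (b , Pb , max) = inj₂ (b , Pb , λ { _ (here refl) Px → ⊥-elim (¬Px Px) ; a (there a∈) → max a a∈ })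
... | yes Px | inj₁ none = inj₂ (x , Px , λ { _ (here refl) _ → ℚₚ.≤-refl ; a (there a∈) Pa → ⊥-elim (none a a∈ Pa) })
... | yes Px | inj₂ (b , Pb , max) with ℚₚ.≤-total (score x) (score b)
...   | inj₁ x≤b = inj₂ (b , Pb , λ { _ (here refl) _ → x≤b ; a (there a∈) → max a a∈ })
...   | inj₂ b≤x = inj₂ (x , Px , λ { _ (here refl) _ → ℚₚ.≤-refl ; a (there a∈) Pa → ℚₚ.≤-trans (max a a∈ Pa) b≤x })

branch : BoolFun n → BoolFun n → BoolFun (suc n)
branch g h (b ∷ x) = if b then g x else h x

-- One representative of every Boolean function up to pointwise equality.
allFuns : ∀ n → List.List (BoolFun n)
allFuns zero = (λ _ → true) List.∷ (λ _ → false) List.∷ List.[]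
allFuns (suc n) = List.cartesianProductWith branch (allFuns n) (allFuns n)

allFuns-complete : ∀ n (f : BoolFun n) → Σ (BoolFun n) λ g → g ∈ allFuns n × (∀ x → f x ≡ g x)
allFuns-complete zero f with f [] in eq
... | true = _ , here refl , λ { [] → eq }
... | false = _ , there (here refl) , λ { [] → eq }
allFuns-complete (suc n) f with allFuns-complete n (λ x → f (true ∷ x)) | allFuns-complete n (λ x → f (false ∷ x))
... | g , g∈ , f≗g | h , h∈ , f≗h = branch g h , ∈-cartesianProductWith⁺ branch g∈ h∈ , λ { (true ∷ x) → f≗g x ; (false ∷ x) → f≗h x }

allVecs : ∀ n k → List.List (Vec (Fin n) k)
allVecs n zero = [] List.∷ List.[]
allVecs n (suc k) = List.cartesianProductWith _∷_ (List.allFin n) (allVecs n k)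

allVecs-complete : ∀ {k} (ι : Vec (Fin n) k) → ι ∈ allVecs n k
allVecs-complete [] = here refl
allVecs-complete (i ∷ ι) = ∈-cartesianProductWith⁺ _∷_ (∈-allFin i) (allVecs-complete ι)

allBits? : ∀ {P : Vec Bool n → Set} → (∀ U → Dec (P U)) → Dec (∀ U → P U)
allBits? {zero} P? with P? []
... | yes p = yes (λ { [] → p })
... | no ¬p = no (λ all → ¬p (all []))
allBits? {suc n} P? with allBits? (λ U → P? (true ∷ U)) | allBits? (λ U → P? (false ∷ U))
... | yes p | yes q = yes (λ { (true ∷ U) → p U ; (false ∷ U) → q U })
... | no ¬p | _ = no (λ all → ¬p (λ U → all (true ∷ U)))
... | yes _ | no ¬q = no (λ all → ¬q (λ U → all (false ∷ U)))

injectiveVec? : ∀ {k} (ι : Vec (Fin n) k) → Dec (∀ r r′ → lookup ι r ≡ lookup ι r′ → r ≡ r′)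
injectiveVec? ι = Finₚ.all? λ r → Finₚ.all? λ r′ → (lookup ι r Fin.≟ lookup ι r′) →-dec (r Fin.≟ r′)

-- Junta correlations in Fourier terms

private
  1/2m : ∀ m .{{_ : ℕ.NonZero m}} .{{_ : ℕ.NonZero (2 ℕ.* m)}} → + 1 / (2 ℕ.* m) ≡ ½ * (+ 1 / m)
  1/2m (suc d) = ℚₚ.toℚᵘ-injective (ℚᵘₚ.≃-trans (ℚₚ.toℚᵘ-fromℚᵘ (ℚᵘ.mkℚᵘ (+ 1) (d ℕ.+ suc (d ℕ.+ 0))))
    (ℚᵘₚ.≃-sym (ℚᵘₚ.≃-trans (ℚₚ.toℚᵘ-homo-* ½ (+ 1 / suc d))
      (ℚᵘₚ.≃-trans (ℚᵘₚ.*-congˡ {ℚᵘ.½} (ℚₚ.toℚᵘ-fromℚᵘ (ℚᵘ.mkℚᵘ (+ 1) d))) (ℚᵘ.*≡* refl)))))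

  sumℚ-++ : ∀ xs ys → sumℚ (xs List.++ ys) ≡ sumℚ xs + sumℚ ys
  sumℚ-++ List.[] ys = sym (ℚₚ.+-identityˡ (sumℚ ys))
  sumℚ-++ (x List.∷ xs) ys = trans (cong (λ z → x + z) (sumℚ-++ xs ys)) (sym (ℚₚ.+-assoc x (sumℚ xs) (sumℚ ys)))

  sum-allPoints : ∀ n (F : Point n → ℚ) .{{_ : ℕ.NonZero (2 ^ n)}} → sumℚ (List.map F (allPoints n)) * (+ 1 / (2 ^ n)) ≡ 𝔼 (bits n) F
  sum-allPoints zero F = trans (cong (_* 1ℚ) (ℚₚ.+-identityʳ (F []))) (ℚₚ.*-identityʳ (F []))
  sum-allPoints (suc n) F = trans (cong₂ _*_ splitSum (1/2m (2 ^ n) {{nz}}))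
    (trans (shuffle (part true) (part false) (+ 1 / (2 ^ n)) ½)
    (trans (cong (½ *_) (cong₂ _+_ (sum-allPoints n (λ x → F (true ∷ x))) (sum-allPoints n (λ x → F (false ∷ x))))) (sym (∫-bits ½ n F))))
    where
    instance
      nz : ℕ.NonZero (2 ^ n)
      nz = ℕ.>-nonZero (ℕₚ.m^n>0 2 n)
    part : Bool → ℚ
    part b = sumℚ (List.map (λ x → F (b ∷ x)) (allPoints n))
    shuffle : ∀ u v r h → (u + v) * (h * r) ≡ h * (u * r + v * r)
    shuffle = solve-∀ ℚ-ring
    halves : ∀ b → sumℚ (List.map F (List.map (b ∷_) (allPoints n))) ≡ part b
    halves b = cong sumℚ (sym (Listₚ.map-∘ (allPoints n)))
    splitSum : sumℚ (List.map F (allPoints (suc n))) ≡ part true + part false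
    splitSum = trans (cong sumℚ (Listₚ.map-++ F (List.map (true ∷_) (allPoints n)) (List.map (false ∷_) (allPoints n))))
      (trans (sumℚ-++ (List.map F (List.map (true ∷_) (allPoints n))) (List.map F (List.map (false ∷_) (allPoints n))))
        (cong₂ _+_ (halves true) (halves false)))

  mul±-sg : ∀ a b → mul± a b ≡ sg a * sg b
  mul±-sg true true = refl
  mul±-sg true false = refl
  mul±-sg false true = refl
  mul±-sg false false = refl

corr-𝔼 : (g f : BoolFun n) → corr g f ≡ 𝔼 (bits n) (λ x → sg (g x) * sg (f x))
corr-𝔼 {n} g f = trans (sum-allPoints n (λ x → mul± (g x) (f x)) {{ℕ.>-nonZero (ℕₚ.m^n>0 2 n)}})
  (∫-cong ½ (bits n) (λ x → mul±-sg (g x) (f x)))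

corr-cong : {g g′ f f′ : BoolFun n} → (∀ x → g x ≡ g′ x) → (∀ x → f x ≡ f′ x) → corr g f ≡ corr g′ f′
corr-cong {n} {g} {g′} {f} {f′} g≗ f≗ = trans (corr-𝔼 g f)
  (trans (∫-cong ½ (bits n) (λ x → cong₂ (λ b c → sg b * sg c) (g≗ x) (f≗ x))) (sym (corr-𝔼 g′ f′)))

spectrum : BoolFun n → Vec Bool n → ℚ
spectrum f = hat (λ x → sg (f x))

spectrum-total : (f : BoolFun n) → ∑ (bits n) (λ S → spectrum f S * spectrum f S) ≡ 1ℚ
spectrum-total {n} f = trans (parseval (λ x → sg (f x))) (trans (∫-cong ½ (bits n) (λ x → sg-sq (f x))) (IsProb-bits n))

restrict-gather : ∀ {k} (ι : Vec (Fin n) k) x → restrict (lookup ι) x ≡ gather ι x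
restrict-gather ι x = trans (tabulate-∘ (lookup x) (lookup ι)) (cong (map (lookup x)) (tabulate∘lookup ι))

juntaCorr : ∀ {k} → BoolFun n → Vec (Fin n) k → BoolFun k → ℚ
juntaCorr f ι h = corr (λ x → h (restrict (lookup ι) x)) f

-- Expand the table in characters on k bits: χ V of the restricted point is χ (push ι V) of the
-- whole point, and averaging against f produces its coefficient there.
juntaCorr-spectrum : ∀ {k} (f : BoolFun n) (ι : Vec (Fin n) k) h →
  juntaCorr f ι h ≡ ∑ (bits k) (λ V → spectrum h V * spectrum f (push ι V))
juntaCorr-spectrum {n} {k} f ι h =
  trans (corr-𝔼 (λ x → h (restrict (lookup ι) x)) f)
  (trans (∫-cong ½ (bits n) (λ x → trans
    (cong (_* sg (f x)) (trans (cong (λ z → sg (h z)) (restrict-gather ι x)) (sym (inversion (λ z → sg (h z)) (gather ι x)))))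
    (sym (∫-*ʳ 1ℚ (bits k) (sg (f x)) (λ V → spectrum h V * χ V (gather ι x))))))
  (trans (∫-swap ½ 1ℚ (bits n) (bits k) (λ x V → (spectrum h V * χ V (gather ι x)) * sg (f x)))
  (∫-cong 1ℚ (bits k) (λ V → trans
    (∫-cong ½ (bits n) (λ x → trans (cong (λ z → (spectrum h V * z) * sg (f x)) (sym (χ-push ι V x))) (reorder (spectrum h V) (χ (push ι V) x) (sg (f x)))))
    (∫-*ˡ ½ (bits n) (spectrum h V) (λ x → sg (f x) * χ (push ι V) x))))))
  where
  reorder : ∀ a c g → (a * c) * g ≡ a * (g * c)
  reorder = solve-∀ ℚ-ring

∑-one : ∀ k → ∑ (bits k) (λ _ → 1ℚ) ≡ ℕ→ℚ (2 ^ k)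
∑-one zero = refl
∑-one (suc k) = trans (∑-bits k (λ _ → 1ℚ)) (trans (cong₂ _+_ (∑-one k) (∑-one k))
  (trans (sym (ℕ→ℚ-+ (2 ^ k) (2 ^ k))) (cong (λ z → ℕ→ℚ (2 ^ k ℕ.+ z)) (sym (ℕₚ.+-identityʳ (2 ^ k))))))

-- 4E·ab ≤ a² + 4E²b² replaces Cauchy–Schwarz.
juntaCorr-close : ∀ {k} (f f′ : BoolFun n) (ι ι′ : Vec (Fin n) k) (h : BoolFun k) (E ε : ℚ) → 0ℚ < E → 1ℚ ≤ℚ E * ε →
  (∀ V → ((+ 256 / 1) * (ℕ→ℚ (2 ^ k) * (E * E))) * ((spectrum f (push ι V) - spectrum f′ (push ι′ V)) * (spectrum f (push ι V) - spectrum f′ (push ι′ V))) ≤ℚ (+ 54 / 1)) →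
  (juntaCorr f ι h - juntaCorr f′ ι′ h) + (juntaCorr f ι h - juntaCorr f′ ι′ h) ≤ℚ ε
juntaCorr-close {k = k} f f′ ι ι′ h E ε 0<E 1≤Eε close =
  ℚₚ.*-cancelˡ-≤-pos E {{Data.Rational.positive 0<E}} (ℚₚ.≤-trans 2EΔ≤1 1≤Eε)
  where
  open ℚₚ.≤-Reasoning
  Δ K : ℚ
  Δ = juntaCorr f ι h - juntaCorr f′ ι′ h
  K = ℕ→ℚ (2 ^ k)
  a d : Vec Bool k → ℚ
  a = spectrum h
  d V = spectrum f (push ι V) - spectrum f′ (push ι′ V)
  Δ-sum : Δ ≡ ∑ (bits k) (λ V → a V * d V)
  Δ-sum = trans (cong₂ _-_ (juntaCorr-spectrum f ι h) (juntaCorr-spectrum f′ ι′ h))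
    (trans (cong (λ z → ∑ (bits k) (λ V → a V * spectrum f (push ι V)) + z) (trans (neg-one (∑ (bits k) (λ V → a V * spectrum f′ (push ι′ V))))
        (sym (∫-*ˡ 1ℚ (bits k) (- 1ℚ) (λ V → a V * spectrum f′ (push ι′ V))))))
    (trans (sym (∫-+ 1ℚ (bits k) (λ V → a V * spectrum f (push ι V)) (λ V → (- 1ℚ) * (a V * spectrum f′ (push ι′ V)))))
      (∫-cong 1ℚ (bits k) (λ V → distribute (a V) (spectrum f (push ι V)) (spectrum f′ (push ι′ V))))))
    where
    neg-one : ∀ x → - x ≡ (- 1ℚ) * x
    neg-one = solve-∀ ℚ-ring
    distribute : ∀ a x y → a * x + (- 1ℚ) * (a * y) ≡ a * (x - y)
    distribute = solve-∀ ℚ-ring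
  D : ℚ
  D = ∑ (bits k) (λ V → d V * d V)
  0<K : 0ℚ < K
  0<K = ℚₚ.<-≤-trans (ℚₚ.positive⁻¹ 1ℚ) (ℕ→ℚ-mono (ℕₚ.m^n>0 2 k))
  D-bound : (+ 256 / 1) * ((E * E) * D) ≤ℚ (+ 54 / 1)
  D-bound = ℚₚ.*-cancelˡ-≤-pos K {{Data.Rational.positive 0<K}} (begin
    K * ((+ 256 / 1) * ((E * E) * D))
      ≡⟨ regroup K E D ⟩
    ((+ 256 / 1) * (K * (E * E))) * D
      ≡⟨ sym (∫-*ˡ 1ℚ (bits k) ((+ 256 / 1) * (K * (E * E))) (λ V → d V * d V)) ⟩
    ∑ (bits k) (λ V → ((+ 256 / 1) * (K * (E * E))) * (d V * d V))
      ≤⟨ ∑-mono (bits k) close ⟩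
    ∑ (bits k) (λ _ → (+ 54 / 1))
      ≡⟨ trans (∫-*ʳ 1ℚ (bits k) (+ 54 / 1) (λ _ → 1ℚ)) (cong (_* (+ 54 / 1)) (∑-one k)) ⟩
    K * (+ 54 / 1) ∎)
    where
    regroup : ∀ K E D → K * ((+ 256 / 1) * ((E * E) * D)) ≡ ((+ 256 / 1) * (K * (E * E))) * D
    regroup = solve-∀ ℚ-ring
  amgm : ∀ a d E → (a * a + (+ 4 / 1) * ((E * E) * (d * d))) ≡ (+ 4 / 1) * (E * (a * d)) + (a - (+ 2 / 1) * (E * d)) * (a - (+ 2 / 1) * (E * d))
  amgm = solve-∀ ℚ-ring
  Σ-bound : (+ 4 / 1) * (E * Δ) ≤ℚ 1ℚ + (+ 4 / 1) * ((E * E) * D)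
  Σ-bound = begin
    (+ 4 / 1) * (E * Δ)
      ≡⟨ cong (λ z → (+ 4 / 1) * (E * z)) Δ-sum ⟩
    (+ 4 / 1) * (E * ∑ (bits k) (λ V → a V * d V))
      ≡⟨ trans (cong ((+ 4 / 1) *_) (sym (∫-*ˡ 1ℚ (bits k) E (λ V → a V * d V)))) (sym (∫-*ˡ 1ℚ (bits k) (+ 4 / 1) (λ V → E * (a V * d V)))) ⟩
    ∑ (bits k) (λ V → (+ 4 / 1) * (E * (a V * d V)))
      ≤⟨ ∑-mono (bits k) (λ V → ≤-via ((a V - (+ 2 / 1) * (E * d V)) * (a V - (+ 2 / 1) * (E * d V))) (amgm (a V) (d V) E) (0≤-sq (a V - (+ 2 / 1) * (E * d V)))) ⟩
    ∑ (bits k) (λ V → a V * a V + (+ 4 / 1) * ((E * E) * (d V * d V)))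
      ≡⟨ trans (∫-+ 1ℚ (bits k) (λ V → a V * a V) (λ V → (+ 4 / 1) * ((E * E) * (d V * d V)))) (cong₂ _+_ (spectrum-total h)
           (trans (∫-*ˡ 1ℚ (bits k) (+ 4 / 1) (λ V → (E * E) * (d V * d V))) (cong ((+ 4 / 1) *_) (∫-*ˡ 1ℚ (bits k) (E * E) (λ V → d V * d V))))) ⟩
    1ℚ + (+ 4 / 1) * ((E * E) * D) ∎
  2EΔ≤1 : E * (Δ + Δ) ≤ℚ 1ℚ
  2EΔ≤1 = begin
    E * (Δ + Δ)                                            ≡⟨ halve E Δ ⟩
    ½ * ((+ 4 / 1) * (E * Δ))                              ≤⟨ *-monoˡ 0≤½ Σ-bound ⟩
    ½ * (1ℚ + (+ 4 / 1) * ((E * E) * D))                   ≡⟨ rescale ((E * E) * D) ⟩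
    ½ * (1ℚ + (+ 1 / 64) * ((+ 256 / 1) * ((E * E) * D)))  ≤⟨ *-monoˡ 0≤½ (ℚₚ.+-monoʳ-≤ 1ℚ (*-monoˡ (ℚₚ.nonNegative⁻¹ (+ 1 / 64)) D-bound)) ⟩
    -- The factor 256 is chosen against 54: the value is 59/64, below 1.
    ½ * (1ℚ + (+ 1 / 64) * (+ 54 / 1))                     ≤⟨ ≤-via (+ 5 / 64) refl (ℚₚ.nonNegative⁻¹ (+ 5 / 64)) ⟩
    1ℚ                                                     ∎
    where
    halve : ∀ E Δ → E * (Δ + Δ) ≡ ½ * ((+ 4 / 1) * (E * Δ))
    halve = solve-∀ ℚ-ring
    rescale : ∀ X → ½ * (1ℚ + (+ 4 / 1) * X) ≡ ½ * (1ℚ + (+ 1 / 64) * ((+ 256 / 1) * X))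
    rescale = solve-∀ ℚ-ring

-- An optimal junta stored as coordinates and a table, because only the table is output and it is
-- later placed on other coordinates.
record Optimum {n : ℕ} (k : ℕ) (f : BoolFun n) : Set where
  field
    coords : Vec (Fin n) k
    coords-inj : ∀ r r′ → lookup coords r ≡ lookup coords r′ → r ≡ r′
    table : BoolFun k
    maximal : ∀ (ι : Vec (Fin n) k) → (∀ r r′ → lookup ι r ≡ lookup ι r′ → r ≡ r′) → ∀ h → juntaCorr f ι h ≤ℚ juntaCorr f coords table
  value : ℚ
  value = juntaCorr f coords table

abstract
  optimum : ∀ {n k} → k ≤ n → (f : BoolFun n) → Optimum k f
  optimum {n} {k} k≤n f
    with find-best (λ (ι , h) → ∀ r r′ → lookup ι r ≡ lookup ι r′ → r ≡ r′) (λ (ι , h) → injectiveVec? ι) (λ (ι , h) → juntaCorr f ι h)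
           (List.cartesianProduct (allVecs n k) (allFuns k))
  ... | inj₁ none = ⊥-elim (none (tabulate (λ r → inject≤ r k≤n) , proj₁ some)
          (∈-cartesianProduct⁺ (allVecs-complete _) (proj₁ (proj₂ some)))
          (λ r r′ eq → Finₚ.inject≤-injective k≤n k≤n r r′ (trans (sym (lookup∘tabulate (λ r → inject≤ r k≤n) r)) (trans eq (lookup∘tabulate (λ r → inject≤ r k≤n) r′)))))
    where
    some : Σ (BoolFun k) λ g → g ∈ allFuns k × (∀ x → true ≡ g x)
    some = allFuns-complete k (λ _ → true)
  ... | inj₂ ((ι , h) , ι-inj , max) = record { coords = ι ; coords-inj = ι-inj ; table = h ; maximal = maximal }
    where
    maximal : ∀ (ι′ : Vec (Fin n) k) → (∀ r r′ → lookup ι′ r ≡ lookup ι′ r′ → r ≡ r′) → ∀ h′ → juntaCorr f ι′ h′ ≤ℚ juntaCorr f ι h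
    maximal ι′ inj′ h′ with allFuns-complete k h′
    ... | g , g∈ , h′≗g = subst (_≤ℚ juntaCorr f ι h) (corr-cong (λ x → sym (h′≗g (restrict (lookup ι′) x))) (λ _ → refl))
                            (max (ι′ , g) (∈-cartesianProduct⁺ (allVecs-complete ι′) g∈) inj′)

optimum-isMax : ∀ {n k} (f : BoolFun n) (o : Optimum k f) → IsMaxJuntaCorr n k f (Optimum.value o)
optimum-isMax {n} {k} f o =
  ((λ x → table (restrict (lookup coords) x)) ,
   (lookup coords , (λ {r} {r′} → coords-inj r r′) , λ x y agree → cong table (Vecₚ.tabulate-cong agree)) , refl) ,
  upper
  where
  open Optimum o
  upper : ∀ ℓ → IsJunta n k ℓ → corr ℓ f ≤ℚ value
  upper ℓ (ι , ι-inj , depends) = subst (_≤ℚ value) (corr-cong same (λ _ → refl))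
    (maximal (tabulate ι) (λ r r′ eq → ι-inj (trans (sym (lookup∘tabulate ι r)) (trans eq (lookup∘tabulate ι r′)))) (λ z → ℓ (scatter z)))
    where
    pick : Point k → (i : Fin n) → Dec (∃ λ j → ι j ≡ i) → Bool
    pick z i (yes (j , _)) = lookup z j
    -- The filler is arbitrary, since ℓ depends only on the coordinates in the image of ι.
    pick z i (no _) = false
    scatter : Point k → Point n
    scatter z = tabulate (λ i → pick z i (Finₚ.any? (λ j → ι j Fin.≟ i)))
    same : ∀ x → ℓ (scatter (restrict (lookup (tabulate ι)) x)) ≡ ℓ x
    same x = depends (scatter z) x agree
      where
      z : Point k
      z = restrict (lookup (tabulate ι)) x
      z-lookup : ∀ j → lookup z j ≡ lookup x (ι j)
      z-lookup j = trans (lookup∘tabulate (λ j → lookup x (lookup (tabulate ι) j)) j) (cong (lookup x) (lookup∘tabulate ι j))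
      picked : ∀ j d → pick z (ι j) d ≡ lookup x (ι j)
      picked j (yes (j′ , eq)) = trans (z-lookup j′) (cong (lookup x) eq)
      picked j (no none) = ⊥-elim (none (j , refl))
      agree : ∀ j → lookup (scatter z) (ι j) ≡ lookup x (ι j)
      agree j = trans (lookup∘tabulate (λ i → pick z i (Finₚ.any? (λ j → ι j Fin.≟ i))) (ι j)) (picked j (Finₚ.any? (λ j′ → ι j′ Fin.≟ ι j)))

-- Query algorithms

-- At `nil` the default d is returned. This can only add to the success probability, hence an
-- inequality in `prob-flipCoins`.
flipCoins : Tree A′ → A → (A′ → QAlg n A) → QAlg n A
flipCoins nil d k = ret d
flipCoins (leaf a) d k = k a
flipCoins (node l r) d k = coin (λ b → if b then flipCoins l d k else flipCoins r d k)

ask : ∀ {m} → (A′ → Point n) → Vec A′ m → (Vec (A′ × Bool) m → QAlg n A) → QAlg n A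
ask at [] c = c []
ask at (y ∷ ys) c = query (at y) (λ b → ask at ys (λ bs → c ((y , b) ∷ bs)))

askAll : ∀ {m G} → (A′ → Point n) → Vec (Vec A′ m) G → (Vec (Vec (A′ × Bool) m) G → QAlg n A) → QAlg n A
askAll at [] c = c []
askAll at (v ∷ vs) c = ask at v (λ r → askAll at vs (λ rs → c (r ∷ rs)))

answer : (A′ → Bool) → A′ → A′ × Bool
answer g y = y , g y

prob-flipCoins : ∀ (f : BoolFun n) (S : A → Bool) (t : Tree A′) d k →
  𝔼 t (λ ω → prob f S (k ω)) ≤ℚ prob f S (flipCoins t d k)
prob-flipCoins f S nil d k with S d
... | true = 0≤1
... | false = ℚₚ.≤-refl
prob-flipCoins f S (leaf a) d k = ℚₚ.≤-refl
prob-flipCoins f S (node l r) d k = *-monoˡ 0≤½ (ℚₚ.+-mono-≤ (prob-flipCoins f S l d k) (prob-flipCoins f S r d k))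

prob-ask : ∀ {m} (f : BoolFun n) (S : A → Bool) (at : A′ → Point n) (v : Vec A′ m) c →
  prob f S (ask at v c) ≡ prob f S (c (map (answer (λ y → f (at y))) v))
prob-ask f S at [] c = refl
prob-ask f S at (y ∷ v) c = prob-ask f S at v (λ bs → c ((y , f (at y)) ∷ bs))

prob-askAll : ∀ {m G} (f : BoolFun n) (S : A → Bool) (at : A′ → Point n) (vs : Vec (Vec A′ m) G) c →
  prob f S (askAll at vs c) ≡ prob f S (c (map (map (answer (λ y → f (at y)))) vs))
prob-askAll f S at [] c = refl
prob-askAll f S at (v ∷ vs) c = trans (prob-ask f S at v _) (prob-askAll f S at vs _)

queries-flipCoins : ∀ {N} (t : Tree A′) (d : A) (k : A′ → QAlg n A) → (∀ ω → numQueries (k ω) ≤ N) → numQueries (flipCoins t d k) ≤ N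
queries-flipCoins nil d k le = z≤n
queries-flipCoins (leaf a) d k le = le a
queries-flipCoins (node l r) d k le = ℕₚ.⊔-lub (queries-flipCoins l d k le) (queries-flipCoins r d k le)

queries-ask : ∀ {m N} (at : A′ → Point n) (v : Vec A′ m) (c : _ → QAlg n A) → (∀ r → numQueries (c r) ≤ N) → numQueries (ask at v c) ≤ m ℕ.+ N
queries-ask at [] c le = le []
queries-ask at (y ∷ v) c le = s≤s (ℕₚ.⊔-lub (queries-ask at v _ (λ r → le _)) (queries-ask at v _ (λ r → le _)))

queries-askAll : ∀ {m G N} (at : A′ → Point n) (vs : Vec (Vec A′ m) G) (c : _ → QAlg n A) → (∀ r → numQueries (c r) ≤ N) →
  numQueries (askAll at vs c) ≤ G ℕ.* m ℕ.+ N
queries-askAll at [] c le = le []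
queries-askAll {m = m} {suc G} {N} at (v ∷ vs) c le = ℕₚ.≤-trans
  (queries-ask at v _ (λ r → queries-askAll at vs _ (λ rs → le _))) (ℕₚ.≤-reflexive (sym (ℕₚ.+-assoc m (G ℕ.* m) N)))

prob-cong : ∀ (f g : BoolFun n) → (∀ x → f x ≡ g x) → (S : A → Bool) → ∀ t → prob f S t ≡ prob g S t
prob-cong f g f≗g S (ret a) = refl
prob-cong f g f≗g S (query x c) = trans (prob-cong f g f≗g S (c (f x))) (cong (λ b → prob g S (c b)) (f≗g x))
prob-cong f g f≗g S (coin c) = cong (½ *_) (cong₂ _+_ (prob-cong f g f≗g S (c true)) (prob-cong f g f≗g S (c false)))

-- Exhaustive search sees one representative of each function up to pointwise equality; this brings
-- a guarantee for the representative back to f.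
Good-cong : ∀ {n k ε} (f g : BoolFun n) → (∀ x → f x ≡ g x) → ∀ o → Good n k ε g o → Good n k ε f o
Good-cong {ε = ε} f g f≗g (c , h) (m , ((ℓ , ℓ-junta , ℓ-corr) , upper) , near , ι , ι-inj , close) =
  m , ((ℓ , ℓ-junta , trans (sym (same ℓ)) ℓ-corr) , λ ℓ′ j → subst (_≤ℚ m) (same ℓ′) (upper ℓ′ j)) ,
  near , ι , ι-inj , subst (λ z → Data.Rational.∣ m - z ∣ ≤ℚ ε) (same (λ x → h (restrict ι x))) close
  where
  same : ∀ ℓ′ → corr ℓ′ g ≡ corr ℓ′ f
  same ℓ′ = corr-cong {g = ℓ′} {g′ = ℓ′} {f = g} {f′ = f} (λ _ → refl) (λ x → sym (f≗g x))

-- Uniformly random labels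

𝟙-≟ᵇ-mono : ∀ {L L′} (i j : Fin L) (i′ j′ : Fin L′) → (i ≡ j → i′ ≡ j′) → 𝟙 (i ≟ᵇ j) ≤ℚ 𝟙 (i′ ≟ᵇ j′)
𝟙-≟ᵇ-mono i j i′ j′ imp with i Fin.≟ j
... | yes eq = ℚₚ.≤-reflexive (cong 𝟙 (sym (dec-true (i′ Fin.≟ j′) (imp eq))))
... | no _ = 0≤𝟙 (i′ ≟ᵇ j′)

𝟙-≟ᵇ-≢ : (i j : Fin L) → i ≢ j → 𝟙 (i ≟ᵇ j) ≡ 0ℚ
𝟙-≟ᵇ-≢ i j i≢j = cong 𝟙 (dec-false (i Fin.≟ j) i≢j)

-- The power 2^q in doubling form, so that a bit and a label combine into a label of the next size
-- without a cast.
width : ℕ → ℕ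
width zero = 1
width (suc q) = width q ℕ.+ width q

width-2^ : ∀ q → width q ≡ 2 ^ q
width-2^ zero = refl
width-2^ (suc q) = cong₂ ℕ._+_ (width-2^ q) (trans (width-2^ q) (sym (ℕₚ.+-identityʳ (2 ^ q))))

-- Serves twice: it builds a uniform label bit by bit, and it merges the sign of a coordinate into
-- its label.
joinLabel : ∀ q → Bool → Fin (width q) → Fin (width (suc q))
joinLabel q true i = i ↑ˡ width q
joinLabel q false i = width q ↑ʳ i

joinLabel-injective : ∀ q b c i j → joinLabel q b i ≡ joinLabel q c j → b ≡ c × i ≡ j
joinLabel-injective q true true i j eq = refl , Finₚ.↑ˡ-injective (width q) i j eq
joinLabel-injective q false false i j eq = refl , Finₚ.↑ʳ-injective (width q) i j eq
joinLabel-injective q true false i j eq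
  with trans (sym (Finₚ.splitAt-↑ˡ (width q) i (width q))) (trans (cong (Fin.splitAt (width q)) eq) (Finₚ.splitAt-↑ʳ (width q) (width q) j))
... | ()
joinLabel-injective q false true i j eq
  with trans (sym (Finₚ.splitAt-↑ʳ (width q) (width q) i)) (trans (cong (Fin.splitAt (width q)) eq) (Finₚ.splitAt-↑ˡ (width q) j (width q)))
... | ()

label : ∀ q → Tree (Fin (width q))
label zero = leaf zero
label (suc q) = pairWith (joinLabel q) flips (label q)

label-prob : ∀ q → IsProb (label q)
label-prob zero = refl
label-prob (suc q) = IsProb-bind flips (λ b → mapᵗ (joinLabel q b) (label q)) refl
  (λ b → IsProb-bind (label q) (λ i → leaf (joinLabel q b i)) (label-prob q) (λ _ → refl))

0≤½^ : ∀ q → 0ℚ ≤ℚ (½ ^ℚ q)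
0≤½^ zero = 0≤1
0≤½^ (suc q) = 0≤-* 0≤½ (0≤½^ q)

label-point : ∀ q w → 𝔼 (label q) (λ v → 𝟙 (v ≟ᵇ w)) ≤ℚ (½ ^ℚ q)
label-point zero w = 𝟙≤1 (zero ≟ᵇ w)
label-point (suc q) w = ℚₚ.≤-trans (ℚₚ.≤-reflexive (∫-pairWith ½ (joinLabel q) flips (label q) (λ v → 𝟙 (v ≟ᵇ w))))
  (*-monoˡ 0≤½ (halves (Fin.splitAt (width q) w) refl))
  where
  same : ∀ b w′ → joinLabel q b w′ ≡ w → 𝔼 (label q) (λ i → 𝟙 (joinLabel q b i ≟ᵇ w)) ≤ℚ (½ ^ℚ q)
  same b w′ refl = ℚₚ.≤-trans (𝔼-mono (label q) (λ i → 𝟙-≟ᵇ-mono (joinLabel q b i) w i w′ (λ eq → proj₂ (joinLabel-injective q b b i w′ eq))))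
    (label-point q w′)
  other : ∀ b c w′ → b ≢ c → joinLabel q c w′ ≡ w → 𝔼 (label q) (λ i → 𝟙 (joinLabel q b i ≟ᵇ w)) ≡ 0ℚ
  other b c w′ b≢c refl = trans (∫-cong ½ (label q) (λ i → 𝟙-≟ᵇ-≢ (joinLabel q b i) w (λ eq → b≢c (proj₁ (joinLabel-injective q b c i w′ eq)))))
    (∫-zero ½ (label q))
  halves : ∀ x → Fin.splitAt (width q) w ≡ x →
    𝔼 (label q) (λ i → 𝟙 (joinLabel q true i ≟ᵇ w)) + 𝔼 (label q) (λ i → 𝟙 (joinLabel q false i ≟ᵇ w)) ≤ℚ (½ ^ℚ q)
  halves (inj₁ w′) eq = subst (_≤ℚ (½ ^ℚ q)) (sym (trans (cong (λ z → 𝔼 (label q) (λ i → 𝟙 (joinLabel q true i ≟ᵇ w)) + z)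
      (other false true w′ (λ ()) (Finₚ.splitAt⁻¹-↑ˡ eq))) (ℚₚ.+-identityʳ _)))
    (same true w′ (Finₚ.splitAt⁻¹-↑ˡ eq))
  halves (inj₂ w′) eq = subst (_≤ℚ (½ ^ℚ q)) (sym (trans (cong (_+ 𝔼 (label q) (λ i → 𝟙 (joinLabel q false i ≟ᵇ w)))
      (other true false w′ (λ ()) (Finₚ.splitAt⁻¹-↑ʳ {width q} eq))) (ℚₚ.+-identityˡ _)))
    (same false w′ (Finₚ.splitAt⁻¹-↑ʳ {width q} eq))

ℕ→ℚ-cancel : ∀ {x y} → ℕ→ℚ x ≤ℚ ℕ→ℚ y → x ≤ y
ℕ→ℚ-cancel {x} {y} le with x ℕ.≤? y
... | yes x≤y = x≤y
... | no x≰y = ⊥-elim (ℚₚ.<-irrefl refl (ℚₚ.<-≤-trans y<1+y (ℚₚ.≤-trans (ℚₚ.≤-reflexive (sym (ℕ→ℚ-suc y))) (ℚₚ.≤-trans (ℕ→ℚ-mono (ℕₚ.≰⇒> x≰y)) le))))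
  where
  y<1+y : ℕ→ℚ y < 1ℚ + ℕ→ℚ y
  y<1+y = subst (_< 1ℚ + ℕ→ℚ y) (ℚₚ.+-identityˡ (ℕ→ℚ y)) (ℚₚ.+-monoˡ-< (ℕ→ℚ y) (ℚₚ.positive⁻¹ 1ℚ))

abs-≤ : ∀ {x e} → x ≤ℚ e → - x ≤ℚ e → Data.Rational.∣ x ∣ ≤ℚ e
abs-≤ {x} {e} x≤e -x≤e with ℚₚ.∣p∣≡p∨∣p∣≡-p x
... | inj₁ eq = subst (_≤ℚ e) (sym eq) x≤e
... | inj₂ eq = subst (_≤ℚ e) (sym eq) -x≤e

half-≤ : ∀ {x e} → 0ℚ ≤ℚ e → x + x ≤ℚ e → x ≤ℚ e
half-≤ {x} {e} 0≤e 2x≤e = ℚₚ.≤-trans (ℚₚ.≤-reflexive (halve x)) (ℚₚ.≤-trans (*-monoˡ 0≤½ 2x≤e)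
  (≤-via (½ * e) (sym (double e)) (0≤-* 0≤½ 0≤e)))
  where
  halve : ∀ x → x ≡ ½ * (x + x)
  halve = solve-∀ ℚ-ring
  double : ∀ e → ½ * e + ½ * e ≡ e
  double = solve-∀ ℚ-ring

sumOver-map : ∀ {m} (g : A → A′) (Z : A′ → ℚ) (v : Vec A m) → sumOver Z (map g v) ≡ sumOver (λ a → Z (g a)) v
sumOver-map g Z [] = refl
sumOver-map g Z (a ∷ v) = cong (λ z → Z (g a) + z) (sumOver-map g Z v)

countᵇ-map : ∀ {m} (g : A → A′) (P : A′ → Bool) (v : Vec A m) → countᵇ P (map g v) ≡ countᵇ (λ a → P (g a)) v
countᵇ-map g P [] = refl
countᵇ-map g P (a ∷ v) = cong (λ c → if P (g a) then suc c else c) (countᵇ-map g P v)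

-- 2 ^ q labels; 2 H groups of m sample points in each of the two data sets; a coefficient is large if its square is at
-- least τ = 1 / t; b is the inverse squared accuracy of the estimated coefficients.
module Algorithm (n k q b m t n₀ H : ℕ) (k≤n : k ≤ n) (m≡64b : ℕ→ℚ m ≡ (+ 64 / 1) * ℕ→ℚ b) (τ : ℚ) (0≤τ : 0ℚ ≤ℚ τ) (τt≡1 : τ * ℕ→ℚ t ≡ 1ℚ) where

  T B : ℚ
  T = ℕ→ℚ t
  B = ℕ→ℚ b

  open Thresholds k T τ (0≤ℕ→ℚ t) 0≤τ τt≡1 public
  open Matching k T τ (0≤ℕ→ℚ t) 0≤τ τt≡1 public

  -- The influence of a coordinate restricted to degree at most k.
  influence : (Vec Bool n → ℚ) → Fin n → ℚ
  influence a i = ∑ (bits n) (λ S → (𝟙 (lightᵇ S) * (a S * a S)) * 𝟙 (lookup S i))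

  -- For n < n₀ there may be no inactive coordinate to put in the place of an unmatched one, so all are kept active.
  activeᵇ : (Vec Bool n → ℚ) → Fin n → Bool
  activeᵇ a i = (n ℕ.<ᵇ n₀) ∨ does (1ℚ ℚₚ.≤? T * influence a i)

  active-covers : ∀ a → Covers a (activeᵇ a)
  active-covers a S sig i i∈S = trans (cong ((n ℕ.<ᵇ n₀) ∨_) (dec-true (1ℚ ℚₚ.≤? T * influence a i) influential)) (Boolₚ.∨-zeroʳ (n ℕ.<ᵇ n₀))
    where
    split-∧ : ∀ x y → x ∧ y ≡ true → x ≡ true × y ≡ true
    split-∧ true true refl = refl , refl
    from-does : ∀ {x} (d : Dec (1ℚ ≤ℚ x)) → does d ≡ true → 1ℚ ≤ℚ x
    from-does (yes p) _ = p
    term : ∀ W → 0ℚ ≤ℚ (𝟙 (lightᵇ W) * (a W * a W)) * 𝟙 (lookup W i)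
    term W = 0≤-* (0≤-* (0≤𝟙 (lightᵇ W)) (0≤-sq (a W))) (0≤𝟙 (lookup W i))
    influential : 1ℚ ≤ℚ T * influence a i
    influential = ℚₚ.≤-trans (from-does (1ℚ ℚₚ.≤? T * (a S * a S)) (proj₂ (split-∧ (lightᵇ S) (largeᵇ (a S)) sig)))
      (*-monoˡ (0≤ℕ→ℚ t) (subst (_≤ℚ influence a i)
        (trans (cong₂ (λ x y → (𝟙 x * (a S * a S)) * 𝟙 y) (proj₁ (split-∧ (lightᵇ S) (largeᵇ (a S)) sig)) i∈S)
          (trans (ℚₚ.*-identityʳ (1ℚ * (a S * a S))) (ℚₚ.*-identityˡ (a S * a S))))
        (∑-term n term S)))

  -- The low-degree influences add up to at most k, since each set is counted once per element, and
  -- an active coordinate takes at least 1/t of this.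
  active-count : ∀ a → ∑ (bits n) (λ S → a S * a S) ≤ℚ 1ℚ → (n ℕ.<ᵇ n₀) ≡ false → weight (tabulate (activeᵇ a)) ≤ t ℕ.* k
  active-count a total big = ℕ→ℚ-cancel (begin
    ℕ→ℚ (weight (tabulate (activeᵇ a)))
      ≡⟨ sym (∑-lookup (tabulate (activeᵇ a))) ⟩
    ∑ (fins n) (λ i → 𝟙 (lookup (tabulate (activeᵇ a)) i))
      ≤⟨ ∑-mono (fins n) indicator ⟩
    ∑ (fins n) (λ i → T * influence a i)
      ≡⟨ ∫-*ˡ 1ℚ (fins n) T (influence a) ⟩
    T * ∑ (fins n) (influence a)
      ≡⟨ cong (T *_) (trans (∫-swap 1ℚ 1ℚ (fins n) (bits n) (λ i S → (𝟙 (lightᵇ S) * (a S * a S)) * 𝟙 (lookup S i)))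
           (∫-cong 1ℚ (bits n) (λ S → trans (∫-*ˡ 1ℚ (fins n) (𝟙 (lightᵇ S) * (a S * a S)) (λ i → 𝟙 (lookup S i))) (cong ((𝟙 (lightᵇ S) * (a S * a S)) *_) (∑-lookup S))))) ⟩
    T * ∑ (bits n) (λ S → (𝟙 (lightᵇ S) * (a S * a S)) * ℕ→ℚ (weight S))
      ≤⟨ *-monoˡ (0≤ℕ→ℚ t) (∑-mono (bits n) light-weight) ⟩
    T * ∑ (bits n) (λ S → (a S * a S) * ℕ→ℚ k)
      ≡⟨ cong (T *_) (∫-*ʳ 1ℚ (bits n) (ℕ→ℚ k) (λ S → a S * a S)) ⟩
    T * (∑ (bits n) (λ S → a S * a S) * ℕ→ℚ k)
      ≤⟨ *-monoˡ (0≤ℕ→ℚ t) (*-monoʳ (0≤ℕ→ℚ k) total) ⟩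
    T * (1ℚ * ℕ→ℚ k)
      ≡⟨ trans (cong (T *_) (ℚₚ.*-identityˡ (ℕ→ℚ k))) (sym (ℕ→ℚ-* t k)) ⟩
    ℕ→ℚ (t ℕ.* k) ∎)
    where
    open ℚₚ.≤-Reasoning
    decided : ∀ {x} (d : Dec (1ℚ ≤ℚ x)) → 0ℚ ≤ℚ x → 𝟙 (does d) ≤ℚ x
    decided (yes p) _ = p
    decided (no _) 0≤x = 0≤x
    indicator : ∀ i → 𝟙 (lookup (tabulate (activeᵇ a)) i) ≤ℚ T * influence a i
    indicator i = subst (_≤ℚ T * influence a i)
      (cong 𝟙 (sym (trans (lookup∘tabulate (activeᵇ a) i) (cong (_∨ does (1ℚ ℚₚ.≤? T * influence a i)) big))))
      (decided (1ℚ ℚₚ.≤? T * influence a i) (0≤-* (0≤ℕ→ℚ t) (∑-nonneg (bits n) (λ S → 0≤-* (0≤-* (0≤𝟙 (lightᵇ S)) (0≤-sq (a S))) (0≤𝟙 (lookup S i))))))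
    light-weight : ∀ S → (𝟙 (lightᵇ S) * (a S * a S)) * ℕ→ℚ (weight S) ≤ℚ (a S * a S) * ℕ→ℚ k
    light-weight S with lightᵇ S in eq
    ... | true = subst (λ z → z * ℕ→ℚ (weight S) ≤ℚ (a S * a S) * ℕ→ℚ k) (sym (ℚₚ.*-identityˡ (a S * a S)))
                   (*-monoˡ (0≤-sq (a S)) (ℕ→ℚ-mono (ℕₚ.≤ᵇ⇒≤ (weight S) k (subst Data.Bool.T (sym eq) _))))
    ... | false = subst (_≤ℚ (a S * a S) * ℕ→ℚ k) (sym (vanish (a S * a S) (ℕ→ℚ (weight S)))) (0≤-* (0≤-sq (a S)) (0≤ℕ→ℚ k))
      where
      vanish : ∀ x y → (0ℚ * x) * y ≡ 0ℚ
      vanish = solve-∀ ℚ-ring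

  Sample : ℕ → Set
  Sample L = Vec (Vec (Vec Bool L × Bool) m) (2 ℕ.* H)

  score : Vec Bool L → Vec Bool L × Bool → ℚ
  score U (y , c) = χ U y * sg c

  -- Tolerance for the squared error of a sum of m samples: 256 = 2(64 + 64), one 64 for sampling
  -- and one for replacing a folded coefficient by its top part.
  wide : ℚ
  wide = (+ 256 / 1) * ℕ→ℚ m

  -- The prediction is the folded top part of g alone, because only top parts can be compared set by
  -- set afterwards. Fewer than H bad groups out of 2H means that a strict majority agrees.
  Fits : Vec (Fin L) n → Vec Bool n → Sample L → BoolFun n → Set
  Fits φ s D g = ∀ U → weight U ≤ k → countᵇ (farᵇ wide (score U) (fold φ s U (top (spectrum g)))) D ℕ.< H

  -- Injectivity is demanded of the candidate as well: the hidden f has it with high probability,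
  -- and the matching needs it on both sides.
  Consistent : Vec (Fin (width q)) n → Vec Bool n → Vec Bool n → Sample (width q) → Sample (width (suc q)) → BoolFun n → Set
  Consistent φ s s₂ D D₂ g =
    InjectiveOn (activeᵇ (spectrum g)) φ × Fits φ s D g × Fits (zipWith (joinLabel q) s φ) s₂ D₂ g

  fits? : (φ : Vec (Fin L) n) → ∀ s D g → Dec (Fits φ s D g)
  fits? φ s D g = allBits? λ U → (weight U ℕ.≤? k) →-dec (_ ℕ.<? H)

  consistent? : ∀ φ s s₂ D D₂ g → Dec (Consistent φ s s₂ D D₂ g)
  consistent? φ s s₂ D D₂ g =
    (Finₚ.all? λ i → Finₚ.all? λ j → (activeᵇ (spectrum g) i Boolₚ.≟ true) →-dec ((activeᵇ (spectrum g) j Boolₚ.≟ true) →-dec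
      ((lookup φ i Fin.≟ lookup φ j) →-dec (i Fin.≟ j))))
    ×-dec (fits? φ s D g ×-dec fits? (zipWith (joinLabel q) s φ) s₂ D₂ g)

  module Soundness (0<m : 0 ℕ.< m) (b≤t : b ≤ t) (room : t ℕ.* k ℕ.+ k ≤ n₀) where

    private
      0≤B : 0ℚ ≤ℚ B
      0≤B = 0≤ℕ→ℚ b

      0<M : 0ℚ < ℕ→ℚ m
      0<M = ℚₚ.<-≤-trans (ℚₚ.positive⁻¹ 1ℚ) (ℕ→ℚ-mono 0<m)

    Bτ≤1 : B * τ ≤ℚ 1ℚ
    Bτ≤1 = ℚₚ.≤-trans (*-monoʳ 0≤τ (ℕ→ℚ-mono b≤t)) (ℚₚ.≤-reflexive (trans (ℚₚ.*-comm T τ) τt≡1))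

    not-far : ∀ {bound} {L} (Z : Vec Bool L × Bool → ℚ) z (v : Vec (Vec Bool L × Bool) m) → farᵇ bound Z z v ≡ false →
      (sumOver Z v - ℕ→ℚ m * z) * (sumOver Z v - ℕ→ℚ m * z) ≤ℚ bound
    not-far {bound} Z z v = invert ((sumOver Z v - ℕ→ℚ m * z) * (sumOver Z v - ℕ→ℚ m * z) ℚₚ.≤? bound)
      where
      invert : ∀ {x} (d : Dec (x ≤ℚ bound)) → not (does d) ≡ false → x ≤ℚ bound
      invert (yes p) _ = p

    -- Two strict majorities of groups share a group, whose empirical mean is close to both predictions.
    fits-close : ∀ (φ : Vec (Fin L) n) s D f g → Fits φ s D f → Fits φ s D g → ∀ U → weight U ≤ k →
      B * ((fold φ s U (top (spectrum f)) - fold φ s U (top (spectrum g))) * (fold φ s U (top (spectrum f)) - fold φ s U (top (spectrum g)))) ≤ℚ (+ 16 / 1)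
    fits-close φ s D f g fits-f fits-g U light = shared (common-good (farᵇ wide (score U) x) (farᵇ wide (score U) y) D
        (ℕₚ.<-≤-trans (ℕₚ.+-mono-<-≤ (fits-f U light) (ℕₚ.<⇒≤ (fits-g U light))) (ℕₚ.≤-reflexive (cong (H ℕ.+_) (sym (ℕₚ.+-identityʳ H))))))
      where
      open ℚₚ.≤-Reasoning
      M x y : ℚ
      M = ℕ→ℚ m
      x = fold φ s U (top (spectrum f))
      y = fold φ s U (top (spectrum g))
      regroup : ∀ M B x y → (+ 64 / 1) * (M * (B * ((x - y) * (x - y)))) ≡ (M * ((+ 64 / 1) * B)) * ((x - y) * (x - y))
      regroup = solve-∀ ℚ-ring
      telescope : ∀ Y M x y → (M * M) * ((x - y) * (x - y)) ≡ ((Y - M * y) + - (Y - M * x)) * ((Y - M * y) + - (Y - M * x))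
      telescope = solve-∀ ℚ-ring
      neg-sq : ∀ x → (- x) * (- x) ≡ x * x
      neg-sq = solve-∀ ℚ-ring
      collect : ∀ M → (1ℚ + 1ℚ) * ((+ 256 / 1) * M + (+ 256 / 1) * M) ≡ (+ 64 / 1) * (M * (+ 16 / 1))
      collect = solve-∀ ℚ-ring
      shared : (∃ λ v → farᵇ wide (score U) x v ≡ false × farᵇ wide (score U) y v ≡ false) → B * ((x - y) * (x - y)) ≤ℚ (+ 16 / 1)
      shared (v , good-f , good-g) = ℚₚ.*-cancelˡ-≤-pos M {{Data.Rational.positive 0<M}} (ℚₚ.*-cancelˡ-≤-pos (+ 64 / 1) (begin
        (+ 64 / 1) * (M * (B * ((x - y) * (x - y))))
          ≡⟨ trans (regroup M B x y) (cong (λ z → (M * z) * ((x - y) * (x - y))) (sym m≡64b)) ⟩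
        (M * M) * ((x - y) * (x - y))
          ≡⟨ telescope Y M x y ⟩
        ((Y - M * y) + - (Y - M * x)) * ((Y - M * y) + - (Y - M * x))
          ≤⟨ sq-sum (Y - M * y) (- (Y - M * x)) ⟩
        (1ℚ + 1ℚ) * ((Y - M * y) * (Y - M * y) + (- (Y - M * x)) * (- (Y - M * x)))
          ≡⟨ cong (λ z → (1ℚ + 1ℚ) * ((Y - M * y) * (Y - M * y) + z)) (neg-sq (Y - M * x)) ⟩
        (1ℚ + 1ℚ) * ((Y - M * y) * (Y - M * y) + (Y - M * x) * (Y - M * x))
          ≤⟨ *-monoˡ (ℚₚ.nonNegative⁻¹ (1ℚ + 1ℚ)) (ℚₚ.+-mono-≤ (not-far {wide} (score U) y v good-g) (not-far {wide} (score U) x v good-f)) ⟩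
        (1ℚ + 1ℚ) * (wide + wide)
          ≡⟨ collect M ⟩
        (+ 64 / 1) * (M * (+ 16 / 1)) ∎))
        where
        Y : ℚ
        Y = sumOver (score U) v

    small-or-room : ∀ f g → (∀ i → activeᵇ (spectrum f) i ≡ true × activeᵇ (spectrum g) i ≡ true) ⊎ k ℕ.+ weight (tabulate (activeᵇ (spectrum g))) ≤ n
    small-or-room f g = decide (n ℕ.<ᵇ n₀) refl
      where
      decide : ∀ c → (n ℕ.<ᵇ n₀) ≡ c →
        (∀ i → activeᵇ (spectrum f) i ≡ true × activeᵇ (spectrum g) i ≡ true) ⊎ k ℕ.+ weight (tabulate (activeᵇ (spectrum g))) ≤ n
      decide true small = inj₁ (λ i → cong (_∨ does (1ℚ ℚₚ.≤? T * influence (spectrum f) i)) small ,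
                                      cong (_∨ does (1ℚ ℚₚ.≤? T * influence (spectrum g) i)) small)
      decide false big = inj₂ (ℕₚ.≤-trans (ℕₚ.≤-reflexive (ℕₚ.+-comm k (weight (tabulate (activeᵇ (spectrum g))))))
        (ℕₚ.≤-trans (ℕₚ.+-monoˡ-≤ k (active-count (spectrum g) (ℚₚ.≤-reflexive (spectrum-total g)) big))
        (ℕₚ.≤-trans room (ℕₚ.≮⇒≥ (λ n<n₀ → true≢false (trans (sym (Equivalence.to Boolₚ.T-≡ (ℕₚ.<⇒<ᵇ n<n₀))) big))))))

    transfer : ∀ φ s s₂ D D₂ f g → Consistent φ s s₂ D D₂ f → Consistent φ s s₂ D D₂ g →
      (ι : Vec (Fin n) k) → InjectiveVec ι → Σ (Vec (Fin n) k) λ ι′ → InjectiveVec ι′ ×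
        (∀ V → B * ((spectrum f (push ι V) - spectrum g (push ι′ V)) * (spectrum f (push ι V) - spectrum g (push ι′ V))) ≤ℚ (+ 54 / 1))
    transfer φ s s₂ D D₂ f g (inj-f , fits-f , fits₂-f) (inj-g , fits-g , fits₂-g) ι ι-inj =
      proj₁ partner , proj₁ (proj₂ partner) ,
      Transfer.coefficients-close B 0≤B Bτ≤1 φ s ψ s₂ determines (spectrum f) (spectrum g) C C′
        (active-covers (spectrum f)) (active-covers (spectrum g)) inj-f inj-g
        (fits-close φ s D f g fits-f fits-g) (fits-close ψ s₂ D₂ f g fits₂-f fits₂-g)
        ι (proj₁ partner) ι-inj (proj₁ (proj₂ partner)) (proj₂ (proj₂ partner))
      where
      ψ : Vec (Fin (width (suc q))) n
      ψ = zipWith (joinLabel q) s φ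
      C C′ : Fin n → Bool
      C = activeᵇ (spectrum f)
      C′ = activeᵇ (spectrum g)
      determines : ∀ i j → lookup ψ i ≡ lookup ψ j → lookup φ i ≡ lookup φ j × lookup s i ≡ lookup s j
      determines i j eq = proj₂ both , proj₁ both
        where
        both : lookup s i ≡ lookup s j × lookup φ i ≡ lookup φ j
        both = joinLabel-injective q (lookup s i) (lookup s j) (lookup φ i) (lookup φ j)
          (trans (sym (lookup-zipWith (joinLabel q) i s φ)) (trans eq (lookup-zipWith (joinLabel q) j s φ)))
      partner : Σ (Vec (Fin n) k) λ ι′ → InjectiveVec ι′ × (∀ r → Matched C C′ ψ (lookup ι r) (lookup ι′ r) ⊎ Unmatched C C′ ψ (lookup ι r) (lookup ι′ r))
      partner = pair-up C C′ ψ (λ i j Ai Aj eq → inj-f i j Ai Aj (proj₁ (determines i j eq))) (small-or-room f g) ι ι-inj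

-- The probability that f is consistent with its own data

∑-fin-term : ∀ L {F : Fin L → ℚ} → (∀ i → 0ℚ ≤ℚ F i) → ∀ i → F i ≤ℚ ∑ (fins L) F
∑-fin-term L {F} 0≤F i = subst (_≤ℚ ∑ (fins L) F) (∑-fin-point L i F) (∑-mono (fins L) pointwise)
  where
  pointwise : ∀ j → F j * 𝟙 (i ≟ᵇ j) ≤ℚ F j
  pointwise j = subst (F j * 𝟙 (i ≟ᵇ j) ≤ℚ_) (ℚₚ.*-identityʳ (F j)) (*-monoˡ (0≤F j) (𝟙≤1 (i ≟ᵇ j)))

label-collision : ∀ (R : Tree (Fin L)) → IsProb R → ∀ {p} → (∀ w → 𝔼 R (λ v → 𝟙 (v ≟ᵇ w)) ≤ℚ p) →
  ∀ n (i j : Fin n) → i ≢ j → 𝔼 (vec R n) (λ φ → 𝟙 (lookup φ i ≟ᵇ lookup φ j)) ≤ℚ p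
label-collision R R-prob R-point (suc n) zero zero i≢j = ⊥-elim (i≢j refl)
label-collision R R-prob R-point (suc n) zero (suc j) i≢j =
  ℚₚ.≤-trans (ℚₚ.≤-reflexive (trans (∫-vec ½ R n _) (∫-swap ½ ½ R (vec R n) (λ w φ → 𝟙 (w ≟ᵇ lookup φ j)))))
    (𝔼-≤const (vec R n) (IsProb-vec R R-prob n) (λ φ → R-point (lookup φ j)))
label-collision R R-prob R-point (suc n) (suc i) zero i≢j =
  ℚₚ.≤-trans (ℚₚ.≤-reflexive (trans (∫-vec ½ R n _) (∫-swap ½ ½ R (vec R n) (λ w φ → 𝟙 (lookup φ i ≟ᵇ w)))))
    (𝔼-≤const (vec R n) (IsProb-vec R R-prob n) (λ φ → ℚₚ.≤-trans
      (𝔼-mono R (λ w → 𝟙-≟ᵇ-mono (lookup φ i) w w (lookup φ i) sym)) (R-point (lookup φ i))))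
label-collision R R-prob R-point (suc n) (suc i) (suc j) i≢j =
  ℚₚ.≤-trans (ℚₚ.≤-reflexive (∫-vec ½ R n _))
    (𝔼-≤const R R-prob (λ _ → label-collision R R-prob R-point n i j (λ eq → i≢j (cong suc eq))))

module Success (n k q b m t n₀ H : ℕ) (k≤n : k ≤ n) (m≡64b : ℕ→ℚ m ≡ (+ 64 / 1) * ℕ→ℚ b) (τ : ℚ) (0≤τ : 0ℚ ≤ℚ τ) (τt≡1 : τ * ℕ→ℚ t ≡ 1ℚ)
               (0<m : 0 ℕ.< m) (b≤t : b ≤ t) (room : t ℕ.* k ℕ.+ k ≤ n₀) where
  open Algorithm n k q b m t n₀ H k≤n m≡64b τ 0≤τ τt≡1
  open Soundness 0<m b≤t room using (not-far)
  open Deviation B (0≤ℕ→ℚ b)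

  M near p : ℚ
  M = ℕ→ℚ m
  near = (+ 64 / 1) * ℕ→ℚ m
  p = ½ ^ℚ q

  private
    0<M : 0ℚ < M
    0<M = ℚₚ.<-≤-trans (ℚₚ.positive⁻¹ 1ℚ) (ℕ→ℚ-mono 0<m)

  at : Vec (Fin L) n → Vec Bool n → Vec Bool L → Point n
  at φ s y = s ⊕ gather φ y

  signal : BoolFun n → Vec (Fin L) n → Vec Bool n → Vec Bool L → Vec Bool L → ℚ
  signal f φ s U y = χ U y * sg (f (at φ s y))

  missᵇ : BoolFun n → Vec (Fin L) n → Vec Bool n → Vec Bool L → Vec (Vec Bool L) m → Bool
  missᵇ f φ s U = farᵇ near (signal f φ s U) (fold φ s U (spectrum f))

  Rows : ℕ → Set
  Rows L = Vec (Vec (Vec Bool L) m) (2 ℕ.* H)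

  -- Summed over U, these count the low-weight label sets for which at least half of the groups
  -- miss; a count below 1 is zero.
  samplingTerm : BoolFun n → Vec (Fin L) n → Vec Bool n → Rows L → Vec Bool L → ℚ
  samplingTerm f φ s r U = 𝟙 (weight U ℕ.<ᵇ suc k) * 𝟙 (H ℕ.≤ᵇ countᵇ (missᵇ f φ s U) r)

  sampling : BoolFun n → Vec (Fin L) n → Vec Bool n → Rows L → ℚ
  sampling {L} f φ s r = ∑ (bits L) (samplingTerm f φ s r)

  collisionTerm : (Fin n → Bool) → Vec (Fin L) n → Fin n → Fin n → ℚ
  collisionTerm A φ i j = (𝟙 (A i) * 𝟙 (A j)) * (𝟙 (not (i ≟ᵇ j)) * 𝟙 (lookup φ i ≟ᵇ lookup φ j))

  collisions : (Fin n → Bool) → Vec (Fin L) n → ℚ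
  collisions A φ = ∑ (fins n) (λ i → ∑ (fins n) (collisionTerm A φ i))

  0≤samplingTerm : ∀ f (φ : Vec (Fin L) n) s r U → 0ℚ ≤ℚ samplingTerm f φ s r U
  0≤samplingTerm f φ s r U = 0≤-* (0≤𝟙 (weight U ℕ.<ᵇ suc k)) (0≤𝟙 (H ℕ.≤ᵇ countᵇ (missᵇ f φ s U) r))

  0≤sampling : ∀ f (φ : Vec (Fin L) n) s r → 0ℚ ≤ℚ sampling f φ s r
  0≤sampling {L} f φ s r = ∑-nonneg (bits L) (0≤samplingTerm f φ s r)

  0≤collisionTerm : ∀ A (φ : Vec (Fin L) n) i j → 0ℚ ≤ℚ collisionTerm A φ i j
  0≤collisionTerm A φ i j = 0≤-* (0≤-* (0≤𝟙 (A i)) (0≤𝟙 (A j))) (0≤-* (0≤𝟙 (not (i ≟ᵇ j))) (0≤𝟙 (lookup φ i ≟ᵇ lookup φ j)))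

  0≤collisions : ∀ A (φ : Vec (Fin L) n) → 0ℚ ≤ℚ collisions A φ
  0≤collisions A φ = ∑-nonneg (fins n) (λ i → ∑-nonneg (fins n) (0≤collisionTerm A φ i))

  no-collisions : ∀ A (φ : Vec (Fin L) n) → collisions A φ < 1ℚ → InjectiveOn A φ
  no-collisions A φ few i j Ai Aj eq = decide (i Fin.≟ j)
    where
    one : i ≢ j → collisionTerm A φ i j ≡ 1ℚ
    one i≢j = trans (cong₂ (λ x y → (𝟙 x * 𝟙 y) * (𝟙 (not (i ≟ᵇ j)) * 𝟙 (lookup φ i ≟ᵇ lookup φ j))) Ai Aj)
      (cong₂ (λ x y → (1ℚ * 1ℚ) * (𝟙 (not x) * 𝟙 y)) (dec-false (i Fin.≟ j) i≢j) (dec-true (lookup φ i Fin.≟ lookup φ j) eq))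
    decide : Dec (i ≡ j) → i ≡ j
    decide (yes i≡j) = i≡j
    decide (no i≢j) = ⊥-elim (ℚₚ.<-irrefl refl (ℚₚ.≤-<-trans (ℚₚ.≤-trans (ℚₚ.≤-reflexive (sym (one i≢j)))
      (ℚₚ.≤-trans (∑-fin-term n (0≤collisionTerm A φ i) j) (∑-fin-term n (λ i → ∑-nonneg (fins n) (0≤collisionTerm A φ i)) i))) few))

  answered : BoolFun n → Vec (Fin L) n → Vec Bool n → Rows L → Sample L
  answered f φ s r = map (map (answer (λ y → f (at φ s y)))) r

  near-wide : ∀ f (φ : Vec (Fin L) n) s U v →
    B * ((fold φ s U (spectrum f) - fold φ s U (top (spectrum f))) * (fold φ s U (spectrum f) - fold φ s U (top (spectrum f)))) ≤ℚ 1ℚ →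
    farᵇ wide (score U) (fold φ s U (top (spectrum f))) (map (answer (λ y → f (at φ s y))) v) ≡ true → missᵇ f φ s U v ≡ true
  near-wide f φ s U v dev is-far = decide (missᵇ f φ s U v) refl
    where
    open ℚₚ.≤-Reasoning
    w : Vec (Vec Bool _ × Bool) m
    w = map (answer (λ y → f (at φ s y))) v
    μ z Y : ℚ
    μ = fold φ s U (spectrum f)
    z = fold φ s U (top (spectrum f))
    Y = sumOver (signal f φ s U) v
    invert : ∀ {x bound} (d : Dec (x ≤ℚ bound)) → not (does d) ≡ false → x ≤ℚ bound
    invert (yes le) _ = le
    telescope : ∀ Y M μ z → (Y - M * z) ≡ (Y - M * μ) + M * (μ - z)
    telescope = solve-∀ ℚ-ring
    regroup : ∀ M B e → (M * e) * (M * e) ≡ (M * M) * (e * e)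
    regroup = solve-∀ ℚ-ring
    regroup′ : ∀ M B e → (M * ((+ 64 / 1) * B)) * (e * e) ≡ ((+ 64 / 1) * M) * (B * (e * e))
    regroup′ = solve-∀ ℚ-ring
    collect : ∀ M → (1ℚ + 1ℚ) * ((+ 64 / 1) * M + ((+ 64 / 1) * M) * 1ℚ) ≡ (+ 256 / 1) * M
    collect = solve-∀ ℚ-ring
    bound : (Y - M * μ) * (Y - M * μ) ≤ℚ near → (sumOver (score U) w - M * z) * (sumOver (score U) w - M * z) ≤ℚ wide
    bound Y-near = begin
      (sumOver (score U) w - M * z) * (sumOver (score U) w - M * z)
        ≡⟨ cong (λ x → x * x) (trans (cong (_- M * z) (sumOver-map (answer (λ y → f (at φ s y))) (score U) v)) (telescope Y M μ z)) ⟩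
      ((Y - M * μ) + M * (μ - z)) * ((Y - M * μ) + M * (μ - z))
        ≤⟨ sq-sum (Y - M * μ) (M * (μ - z)) ⟩
      (1ℚ + 1ℚ) * ((Y - M * μ) * (Y - M * μ) + (M * (μ - z)) * (M * (μ - z)))
        -- Here m = 64 b enters: it turns M² (μ - z)² into 64 M times B (μ - z)², and the last
        -- factor is at most 1.
        ≡⟨ cong (λ x → (1ℚ + 1ℚ) * ((Y - M * μ) * (Y - M * μ) + x)) (trans (regroup M B (μ - z))
             (trans (cong (λ x → (M * x) * ((μ - z) * (μ - z))) m≡64b) (regroup′ M B (μ - z)))) ⟩
      (1ℚ + 1ℚ) * ((Y - M * μ) * (Y - M * μ) + ((+ 64 / 1) * M) * (B * ((μ - z) * (μ - z))))
        ≤⟨ *-monoˡ (ℚₚ.nonNegative⁻¹ (1ℚ + 1ℚ)) (ℚₚ.+-mono-≤ Y-near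
             (*-monoˡ (0≤-* (ℚₚ.nonNegative⁻¹ (+ 64 / 1)) (0≤ℕ→ℚ m)) dev)) ⟩
      (1ℚ + 1ℚ) * ((+ 64 / 1) * M + ((+ 64 / 1) * M) * 1ℚ)
        ≡⟨ collect M ⟩
      wide ∎
    decide : ∀ c → missᵇ f φ s U v ≡ c → missᵇ f φ s U v ≡ true
    decide true miss = miss
    decide false miss = true≢false (trans (sym is-far)
      (cong not (dec-true ((sumOver (score U) w - M * z) * (sumOver (score U) w - M * z) ℚₚ.≤? wide)
        (bound (invert ((Y - M * μ) * (Y - M * μ) ℚₚ.≤? near) miss)))))

  fits : ∀ f (φ : Vec (Fin L) n) s r → deviation φ s (spectrum f) < 1ℚ → sampling f φ s r < 1ℚ → Fits φ s (answered f φ s r) f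
  fits {L} f φ s r dev samp U light = ℕₚ.≤-<-trans
    (ℕₚ.≤-trans (ℕₚ.≤-reflexive (countᵇ-map (map (answer (λ y → f (at φ s y)))) (farᵇ wide (score U) (fold φ s U (top (spectrum f)))) r))
      (countᵇ-mono (λ v → near-wide f φ s U v (deviation<1 φ s (spectrum f) dev U light)) r))
    (ℕₚ.≰⇒> few)
    where
    few : ¬ (H ≤ countᵇ (missᵇ f φ s U) r)
    few H≤ = ℚₚ.<-irrefl refl (ℚₚ.≤-<-trans (ℚₚ.≤-trans (ℚₚ.≤-reflexive (sym (cong₂ (λ x y → 𝟙 x * 𝟙 y)
        (Equivalence.to Boolₚ.T-≡ (ℕₚ.<⇒<ᵇ (s≤s light))) (Equivalence.to Boolₚ.T-≡ (ℕₚ.≤⇒≤ᵇ H≤)))))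
      (∑-term L (0≤samplingTerm f φ s r) U)) samp)

  merge : Vec (Fin (width q)) n → Vec Bool n → Vec (Fin (width (suc q))) n
  merge φ s = zipWith (joinLabel q) s φ

  -- All bad events as one sum of nonnegative terms, each below 1 when its event is absent. Its mean
  -- does the work of the union bound and Markov's inequality together.
  failure : BoolFun n → Vec (Fin (width q)) n → Vec Bool n → Vec Bool n → Rows (width q) → Rows (width (suc q)) → ℚ
  failure f φ s s₂ r r₂ =
    (deviation φ s (spectrum f) + (deviation (merge φ s) s₂ (spectrum f) + collisions (activeᵇ (spectrum f)) φ))
    + (sampling f φ s r + sampling f (merge φ s) s₂ r₂)

  0≤failure : ∀ f φ s s₂ r r₂ → 0ℚ ≤ℚ failure f φ s s₂ r r₂
  0≤failure f φ s s₂ r r₂ = 0≤-+ (0≤-+ (0≤deviation φ s (spectrum f)) (0≤-+ (0≤deviation (merge φ s) s₂ (spectrum f)) (0≤collisions (activeᵇ (spectrum f)) φ)))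
    (0≤-+ (0≤sampling f φ s r) (0≤sampling f (merge φ s) s₂ r₂))

  consistent : ∀ f φ s s₂ r r₂ → failure f φ s s₂ r r₂ < 1ℚ →
    Consistent φ s s₂ (answered f φ s r) (answered f (merge φ s) s₂ r₂) f
  consistent f φ s s₂ r r₂ small =
    no-collisions (activeᵇ (spectrum f)) φ (ℚₚ.≤-<-trans (≤-via ((d₁ + d₂) + (s₁ + s₃)) (to-c d₁ d₂ c s₁ s₃) (0≤-+ (0≤-+ 0≤d₁ 0≤d₂) (0≤-+ 0≤s₁ 0≤s₃))) small) ,
    fits f φ s r
      (ℚₚ.≤-<-trans (≤-via ((d₂ + c) + (s₁ + s₃)) (to-d₁ d₁ d₂ c s₁ s₃) (0≤-+ (0≤-+ 0≤d₂ 0≤c) (0≤-+ 0≤s₁ 0≤s₃))) small)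
      (ℚₚ.≤-<-trans (≤-via ((d₁ + (d₂ + c)) + s₃) (to-s₁ d₁ d₂ c s₁ s₃) (0≤-+ (0≤-+ 0≤d₁ (0≤-+ 0≤d₂ 0≤c)) 0≤s₃)) small) ,
    fits f (merge φ s) s₂ r₂
      (ℚₚ.≤-<-trans (≤-via ((d₁ + c) + (s₁ + s₃)) (to-d₂ d₁ d₂ c s₁ s₃) (0≤-+ (0≤-+ 0≤d₁ 0≤c) (0≤-+ 0≤s₁ 0≤s₃))) small)
      (ℚₚ.≤-<-trans (≤-via ((d₁ + (d₂ + c)) + s₁) (to-s₃ d₁ d₂ c s₁ s₃) (0≤-+ (0≤-+ 0≤d₁ (0≤-+ 0≤d₂ 0≤c)) 0≤s₁)) small)
    where
    d₁ d₂ c s₁ s₃ : ℚ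
    d₁ = deviation φ s (spectrum f)
    d₂ = deviation (merge φ s) s₂ (spectrum f)
    c = collisions (activeᵇ (spectrum f)) φ
    s₁ = sampling f φ s r
    s₃ = sampling f (merge φ s) s₂ r₂
    0≤d₁ : 0ℚ ≤ℚ d₁
    0≤d₁ = 0≤deviation φ s (spectrum f)
    0≤d₂ : 0ℚ ≤ℚ d₂
    0≤d₂ = 0≤deviation (merge φ s) s₂ (spectrum f)
    0≤c : 0ℚ ≤ℚ c
    0≤c = 0≤collisions (activeᵇ (spectrum f)) φ
    0≤s₁ : 0ℚ ≤ℚ s₁
    0≤s₁ = 0≤sampling f φ s r
    0≤s₃ : 0ℚ ≤ℚ s₃
    0≤s₃ = 0≤sampling f (merge φ s) s₂ r₂
    to-c : ∀ a b c d e → (a + (b + c)) + (d + e) ≡ c + ((a + b) + (d + e))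
    to-c = solve-∀ ℚ-ring
    to-d₁ : ∀ a b c d e → (a + (b + c)) + (d + e) ≡ a + ((b + c) + (d + e))
    to-d₁ = solve-∀ ℚ-ring
    to-d₂ : ∀ a b c d e → (a + (b + c)) + (d + e) ≡ b + ((a + c) + (d + e))
    to-d₂ = solve-∀ ℚ-ring
    to-s₁ : ∀ a b c d e → (a + (b + c)) + (d + e) ≡ d + ((a + (b + c)) + e)
    to-s₁ = solve-∀ ℚ-ring
    to-s₃ : ∀ a b c d e → (a + (b + c)) + (d + e) ≡ e + ((a + (b + c)) + d)
    to-s₃ = solve-∀ ℚ-ring

  rows : ∀ L → Tree (Rows L)
  rows L = vec (vec (bits L) m) (2 ℕ.* H)

  rows-prob : ∀ L → IsProb (rows L)
  rows-prob L = IsProb-vec (vec (bits L) m) (IsProb-vec (bits L) (IsProb-bits L) m) (2 ℕ.* H)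

  miss-rare : ∀ f (φ : Vec (Fin L) n) s U → (+ 64 / 1) * 𝔼 (vec (bits L) m) (λ v → 𝟙 (missᵇ f φ s U v)) ≤ℚ 1ℚ
  miss-rare {L} f φ s U = ℚₚ.*-cancelˡ-≤-pos M {{Data.Rational.positive 0<M}} (begin
    M * ((+ 64 / 1) * 𝔼 (vec (bits L) m) (λ v → 𝟙 (missᵇ f φ s U v)))
      ≡⟨ regroup M (𝔼 (vec (bits L) m) (λ v → 𝟙 (missᵇ f φ s U v))) ⟩
    𝔼 (vec (bits L) m) (λ v → 𝟙 (missᵇ f φ s U v)) * near
      ≡⟨ cong (λ μ → 𝔼 (vec (bits L) m) (λ v → 𝟙 (farᵇ near (signal f φ s U) μ v)) * near) (sym (fold-spectrum (λ x → sg (f x)) φ s U)) ⟩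
    𝔼 (vec (bits L) m) (λ v → 𝟙 (farᵇ near (signal f φ s U) (𝔼 (bits L) (signal f φ s U)) v)) * near
      ≤⟨ chebyshev (bits L) (IsProb-bits L) (signal f φ s U) unit m near (0≤-* (ℚₚ.nonNegative⁻¹ (+ 64 / 1)) (0≤ℕ→ℚ m)) ⟩
    M
      ≡⟨ sym (ℚₚ.*-identityʳ M) ⟩
    M * 1ℚ ∎)
    where
    open ℚₚ.≤-Reasoning
    regroup : ∀ M e → M * ((+ 64 / 1) * e) ≡ e * ((+ 64 / 1) * M)
    regroup = solve-∀ ℚ-ring
    interchange : ∀ x y → (x * y) * (x * y) ≡ (x * x) * (y * y)
    interchange = solve-∀ ℚ-ring
    unit : ∀ y → signal f φ s U y * signal f φ s U y ≡ 1ℚ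
    unit y = trans (interchange (χ U y) (sg (f (at φ s y)))) (cong₂ _*_ (χ-sq U y) (sg-sq (f (at φ s y))))

  -- Union bound over the label sets of size at most k, each failing with probability at most
  -- 16^(-H).
  𝔼-sampling : ∀ f (φ : Vec (Fin L) n) s → 24 ℕ.* suc L ^ k ≤ 16 ^ H → 𝔼 (rows L) (sampling f φ s) ≤ℚ (+ 1 / 24)
  𝔼-sampling {L} f φ s enough = ℚₚ.*-cancelʳ-≤-pos X {{Data.Rational.positive 0<X}} (begin
    𝔼 (rows L) (sampling f φ s) * X
      ≡⟨ cong (_* X) (trans (∫-swap ½ 1ℚ (rows L) (bits L) (samplingTerm f φ s))
           (∫-cong 1ℚ (bits L) (λ U → ∫-*ˡ ½ (rows L) (𝟙 (weight U ℕ.<ᵇ suc k)) (λ r → 𝟙 (H ℕ.≤ᵇ countᵇ (missᵇ f φ s U) r))))) ⟩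
    ∑ (bits L) (λ U → 𝟙 (weight U ℕ.<ᵇ suc k) * bad U) * X
      ≡⟨ trans (sym (∫-*ʳ 1ℚ (bits L) X (λ U → 𝟙 (weight U ℕ.<ᵇ suc k) * bad U)))
           (∫-cong 1ℚ (bits L) (λ U → ℚₚ.*-assoc (𝟙 (weight U ℕ.<ᵇ suc k)) (bad U) X)) ⟩
    ∑ (bits L) (λ U → 𝟙 (weight U ℕ.<ᵇ suc k) * (bad U * X))
      ≤⟨ ∑-mono (bits L) (λ U → *-monoˡ (0≤𝟙 (weight U ℕ.<ᵇ suc k))
           (majority (vec (bits L) m) (IsProb-vec (bits L) (IsProb-bits L) m) (missᵇ f φ s U) (miss-rare f φ s U) H)) ⟩
    ∑ (bits L) (λ U → 𝟙 (weight U ℕ.<ᵇ suc k) * 1ℚ)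
      ≡⟨ ∫-cong 1ℚ (bits L) (λ U → ℚₚ.*-identityʳ (𝟙 (weight U ℕ.<ᵇ suc k))) ⟩
    ∑ (bits L) (λ U → 𝟙 (weight U ℕ.<ᵇ suc k))
      ≤⟨ ball-size L k ⟩
    ℕ→ℚ (suc L ^ k)
      ≡⟨ rescale (ℕ→ℚ (suc L ^ k)) ⟩
    (+ 1 / 24) * ((+ 24 / 1) * ℕ→ℚ (suc L ^ k))
      ≤⟨ *-monoˡ (ℚₚ.nonNegative⁻¹ (+ 1 / 24)) (ℚₚ.≤-trans (ℚₚ.≤-reflexive (sym (ℕ→ℚ-* 24 (suc L ^ k)))) (ℕ→ℚ-mono enough)) ⟩
    (+ 1 / 24) * X ∎)
    where
    open ℚₚ.≤-Reasoning
    X : ℚ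
    X = ℕ→ℚ (16 ^ H)
    0<X : 0ℚ < X
    0<X = ℚₚ.<-≤-trans (ℚₚ.positive⁻¹ 1ℚ) (ℕ→ℚ-mono (ℕₚ.m^n>0 16 H))
    bad : Vec Bool L → ℚ
    bad U = 𝔼 (rows L) (λ r → 𝟙 (H ℕ.≤ᵇ countᵇ (missᵇ f φ s U) r))
    rescale : ∀ x → x ≡ (+ 1 / 24) * ((+ 24 / 1) * x)
    rescale = solve-∀ ℚ-ring

  active≤n₀ : ∀ f → weight (tabulate (activeᵇ (spectrum f))) ≤ n₀
  active≤n₀ f = decide (n ℕ.<ᵇ n₀) refl
    where
    decide : ∀ c → (n ℕ.<ᵇ n₀) ≡ c → weight (tabulate (activeᵇ (spectrum f))) ≤ n₀
    decide true small = ℕₚ.≤-trans (weight≤ (tabulate (activeᵇ (spectrum f)))) (ℕₚ.<⇒≤ (ℕₚ.<ᵇ⇒< n n₀ (subst Data.Bool.T (sym small) _)))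
    decide false big = ℕₚ.≤-trans (active-count (spectrum f) (ℚₚ.≤-reflexive (spectrum-total f)) big)
      (ℕₚ.≤-trans (ℕₚ.m≤m+n (t ℕ.* k) k) room)

  𝔼-collisions : ∀ f → 𝔼 (vec (label q) n) (collisions (activeᵇ (spectrum f))) ≤ℚ (ℕ→ℚ n₀ * ℕ→ℚ n₀) * p
  𝔼-collisions f = begin
    𝔼 labels (collisions act)
      ≡⟨ trans (∫-swap ½ 1ℚ labels (fins n) (λ φ i → ∑ (fins n) (collisionTerm act φ i)))
           (∫-cong 1ℚ (fins n) (λ i → ∫-swap ½ 1ℚ labels (fins n) (λ φ → collisionTerm act φ i))) ⟩
    ∑ (fins n) (λ i → ∑ (fins n) (λ j → 𝔼 labels (λ φ → collisionTerm act φ i j)))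
      ≤⟨ ∑-mono (fins n) (λ i → ∑-mono (fins n) (λ j → pair i j)) ⟩
    ∑ (fins n) (λ i → ∑ (fins n) (λ j → (𝟙 (act i) * 𝟙 (act j)) * p))
      ≡⟨ ∫-cong 1ℚ (fins n) (λ i → trans (∫-*ʳ 1ℚ (fins n) p (λ j → 𝟙 (act i) * 𝟙 (act j))) (cong (_* p) (trans (∫-*ˡ 1ℚ (fins n) (𝟙 (act i)) (λ j → 𝟙 (act j))) (cong (𝟙 (act i) *_) total)))) ⟩
    ∑ (fins n) (λ i → (𝟙 (act i) * c) * p)
      ≡⟨ trans (∫-*ʳ 1ℚ (fins n) p (λ i → 𝟙 (act i) * c)) (cong (_* p) (trans (∫-*ʳ 1ℚ (fins n) c (λ i → 𝟙 (act i))) (cong (_* c) total))) ⟩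
    (c * c) * p
      ≤⟨ *-monoʳ (0≤½^ q) (sq-mono (0≤ℕ→ℚ (weight (tabulate act))) (ℕ→ℚ-mono (active≤n₀ f))) ⟩
    (ℕ→ℚ n₀ * ℕ→ℚ n₀) * p ∎
    where
    open ℚₚ.≤-Reasoning
    labels : Tree (Vec (Fin (width q)) n)
    labels = vec (label q) n
    act : Fin n → Bool
    act = activeᵇ (spectrum f)
    c : ℚ
    c = ℕ→ℚ (weight (tabulate act))
    total : ∑ (fins n) (λ j → 𝟙 (act j)) ≡ c
    total = trans (∫-cong 1ℚ (fins n) (λ j → cong 𝟙 (sym (lookup∘tabulate act j)))) (∑-lookup (tabulate act))
    distinct : ∀ i j → 𝔼 labels (λ φ → 𝟙 (not (i ≟ᵇ j)) * 𝟙 (lookup φ i ≟ᵇ lookup φ j)) ≤ℚ p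
    distinct i j = ℚₚ.≤-trans (ℚₚ.≤-reflexive (∫-*ˡ ½ labels (𝟙 (not (i ≟ᵇ j))) (λ φ → 𝟙 (lookup φ i ≟ᵇ lookup φ j)))) (decide (i Fin.≟ j))
      where
      e : ℚ
      e = 𝔼 labels (λ φ → 𝟙 (lookup φ i ≟ᵇ lookup φ j))
      decide : (d : Dec (i ≡ j)) → 𝟙 (not (does d)) * e ≤ℚ p
      decide (yes _) = subst (_≤ℚ p) (sym (ℚₚ.*-zeroˡ e)) (0≤½^ q)
      decide (no i≢j) = subst (_≤ℚ p) (sym (ℚₚ.*-identityˡ e)) (label-collision (label q) (label-prob q) (label-point q) n i j i≢j)
    pair : ∀ i j → 𝔼 labels (λ φ → collisionTerm act φ i j) ≤ℚ (𝟙 (act i) * 𝟙 (act j)) * p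
    pair i j = ℚₚ.≤-trans (ℚₚ.≤-reflexive (∫-*ˡ ½ labels (𝟙 (act i) * 𝟙 (act j)) (λ φ → 𝟙 (not (i ≟ᵇ j)) * 𝟙 (lookup φ i ≟ᵇ lookup φ j))))
      (*-monoˡ (0≤-* (0≤𝟙 (act i)) (0≤𝟙 (act j))) (distinct i j))

-- The query algorithm and the quality of its output

module Output (n k q b m t n₀ H : ℕ) (k≤n : k ≤ n) (m≡64b : ℕ→ℚ m ≡ (+ 64 / 1) * ℕ→ℚ b) (τ : ℚ) (0≤τ : 0ℚ ≤ℚ τ) (τt≡1 : τ * ℕ→ℚ t ≡ 1ℚ)
              (0<m : 0 ℕ.< m) (b≤t : b ≤ t) (room : t ℕ.* k ℕ.+ k ≤ n₀) where
  open Algorithm n k q b m t n₀ H k≤n m≡64b τ 0≤τ τt≡1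
  open Soundness 0<m b≤t room using (transfer)
  open Success n k q b m t n₀ H k≤n m≡64b τ 0≤τ τt≡1 0<m b≤t room
  open Deviation B (0≤ℕ→ℚ b)

  Result : Set
  Result = ℚ × (Point k → Bool)

  default : Result
  default = 0ℚ , λ _ → true

  -- The first consistent g found by the search is optimised in place of f; the search makes no
  -- queries.
  report : ∀ {P : BoolFun n → Set} → Dec (Any P (allFuns n)) → Result
  report (yes found) = Optimum.value o , Optimum.table o
    where
    o : Optimum k (proj₁ (Any.satisfied found))
    o = optimum k≤n (proj₁ (Any.satisfied found))
  report (no _) = default

  Draw : Set
  Draw = Vec (Fin (width q)) n × Vec Bool n × Vec Bool n × Rows (width q) × Rows (width (suc q))

  draw : Tree Draw
  draw = vec (label q) n >>=ᵗ λ φ → bits n >>=ᵗ λ s → bits n >>=ᵗ λ s₂ → rows (width q) >>=ᵗ λ r →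
    mapᵗ (λ r₂ → φ , s , s₂ , r , r₂) (rows (width (suc q)))

  play : Draw → QAlg n Result
  play (φ , s , s₂ , r , r₂) =
    askAll (at φ s) r λ D → askAll (at (merge φ s) s₂) r₂ λ D₂ →
      ret (report (Any.any? (consistent? φ s s₂ D D₂) (allFuns n)))

  algorithm : QAlg n Result
  algorithm = flipCoins draw default play

  algorithm-queries : numQueries algorithm ≤ 2 ℕ.* H ℕ.* m ℕ.+ (2 ℕ.* H ℕ.* m ℕ.+ 0)
  algorithm-queries = queries-flipCoins draw default play λ (φ , s , s₂ , r , r₂) →
    queries-askAll (at φ s) r _ λ D → queries-askAll (at (merge φ s) s₂) r₂ _ λ D₂ → z≤n

  𝔼-draw : (F : Draw → ℚ) → 𝔼 draw F ≡ 𝔼 (vec (label q) n) (λ φ → 𝔼 (bits n) (λ s → 𝔼 (bits n) (λ s₂ →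
    𝔼 (rows (width q)) (λ r → 𝔼 (rows (width (suc q))) (λ r₂ → F (φ , s , s₂ , r , r₂))))))
  𝔼-draw F = trans (∫-bind ½ (vec (label q) n) _ F) (∫-cong ½ (vec (label q) n) λ φ →
    trans (∫-bind ½ (bits n) _ F) (∫-cong ½ (bits n) λ s →
    trans (∫-bind ½ (bits n) _ F) (∫-cong ½ (bits n) λ s₂ →
    trans (∫-bind ½ (rows (width q)) _ F) (∫-cong ½ (rows (width q)) λ r →
    ∫-bind ½ (rows (width (suc q))) _ F))))

  draw-prob : IsProb draw
  draw-prob = IsProb-bind (vec (label q) n) _ (IsProb-vec (label q) (label-prob q) n) λ φ →
    IsProb-bind (bits n) _ (IsProb-bits n) λ s → IsProb-bind (bits n) _ (IsProb-bits n) λ s₂ →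
    IsProb-bind (rows (width q)) _ (rows-prob (width q)) λ r → IsProb-bind (rows (width (suc q))) _ (rows-prob (width (suc q))) λ _ → refl

  module Quality (ε E : ℚ) (0<E : 0ℚ < E) (1≤Eε : 1ℚ ≤ℚ E * ε) (0≤ε : 0ℚ ≤ℚ ε)
                 (B≡ : B ≡ (+ 256 / 1) * (ℕ→ℚ (2 ^ k) * (E * E))) (f : BoolFun n) where

    o : Optimum k f
    o = optimum k≤n f

    best : ℚ
    best = Optimum.value o

    -- A decidable form of `Good` with the maximum fixed as `best`, needed because the success event
    -- must be given by a Boolean selector.
    Accurate : Result → Set
    Accurate (c , h) = (Data.Rational.∣ c - best ∣ ≤ℚ ε) ×
      Any (λ ι → InjectiveVec ι × (Data.Rational.∣ best - juntaCorr f ι h ∣ ≤ℚ ε)) (allVecs n k)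

    accurate? : ∀ x → Dec (Accurate x)
    accurate? (c , h) = (Data.Rational.∣ c - best ∣ ℚₚ.≤? ε) ×-dec
      Any.any? (λ ι → injectiveVec? ι ×-dec (Data.Rational.∣ best - juntaCorr f ι h ∣ ℚₚ.≤? ε)) (allVecs n k)

    accurate-good : ∀ x → does (accurate? x) ≡ true → Good n k ε f x
    accurate-good x eq = from x (accurate? x) eq
      where
      located : ∀ c h → Data.Rational.∣ c - best ∣ ≤ℚ ε → (∃ λ ι → InjectiveVec ι × (Data.Rational.∣ best - juntaCorr f ι h ∣ ≤ℚ ε)) →
        Good n k ε f (c , h)
      located c h near-best (ι , ι-inj , close) = best , optimum-isMax f o , near-best , lookup ι , (λ {r} {r′} → ι-inj r r′) , close
      from : ∀ x (d : Dec (Accurate x)) → does d ≡ true → Good n k ε f x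
      from (c , h) (yes (near-best , some)) _ = located c h near-best (Any.satisfied some)

    junta-transfer : ∀ φ s s₂ D D₂ g h → Consistent φ s s₂ D D₂ g → Consistent φ s s₂ D D₂ h → (ι : Vec (Fin n) k) → InjectiveVec ι →
      Σ (Vec (Fin n) k) λ ι′ → InjectiveVec ι′ × (∀ u → (juntaCorr g ι u - juntaCorr h ι′ u) + (juntaCorr g ι u - juntaCorr h ι′ u) ≤ℚ ε)
    junta-transfer φ s s₂ D D₂ g h g-ok h-ok ι ι-inj =
      ι′ , proj₁ (proj₂ partner) , λ u → juntaCorr-close g h ι ι′ u E ε 0<E 1≤Eε (λ V → subst (λ β → β * (gap V * gap V) ≤ℚ (+ 54 / 1)) B≡ (proj₂ (proj₂ partner) V))
      where
      partner : Σ (Vec (Fin n) k) λ ι′ → InjectiveVec ι′ ×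
        (∀ V → B * ((spectrum g (push ι V) - spectrum h (push ι′ V)) * (spectrum g (push ι V) - spectrum h (push ι′ V))) ≤ℚ (+ 54 / 1))
      partner = transfer φ s s₂ D D₂ g h g-ok h-ok ι ι-inj
      ι′ : Vec (Fin n) k
      ι′ = proj₁ partner
      gap : Vec Bool k → ℚ
      gap V = spectrum g (push ι V) - spectrum h (push ι′ V)

    -- Moving the optimum of f to g gives best - best′ ≤ ε/2, and moving that of g to f gives best′
    -- - J ≤ ε/2, where J is the correlation with f of the reported table. As J ≤ best, both
    -- required bounds follow.
    sandwich : ∀ (g : BoolFun n) (o′ : Optimum k g) →
      (Σ (Vec (Fin n) k) λ ι → InjectiveVec ι × (∀ u → (juntaCorr f (Optimum.coords o) u - juntaCorr g ι u) + (juntaCorr f (Optimum.coords o) u - juntaCorr g ι u) ≤ℚ ε)) →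
      (Σ (Vec (Fin n) k) λ ι → InjectiveVec ι × (∀ u → (juntaCorr g (Optimum.coords o′) u - juntaCorr f ι u) + (juntaCorr g (Optimum.coords o′) u - juntaCorr f ι u) ≤ℚ ε)) →
      Accurate (Optimum.value o′ , Optimum.table o′)
    sandwich g o′ (ι₁ , inj₁′ , close₁) (ι₂ , inj₂′ , close₂) =
      abs-≤ (half-≤ 0≤ε best′-best) (subst (_≤ℚ ε) (flip best best′) (half-≤ 0≤ε best-best′)) ,
      lose (allVecs-complete ι₂) (inj₂′ , abs-≤ best-J (ℚₚ.≤-trans (subst (_≤ℚ 0ℚ) (flip J best) J-best) 0≤ε))
      where
      best′ J : ℚ
      best′ = Optimum.value o′
      J = juntaCorr f ι₂ (Optimum.table o′)
      flip : ∀ x y → x - y ≡ - (y - x)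
      flip = solve-∀ ℚ-ring
      J≤best : J ≤ℚ best
      J≤best = Optimum.maximal o ι₂ inj₂′ (Optimum.table o′)
      double-mono : ∀ {x y} → x ≤ℚ y → x + x ≤ℚ y + y
      double-mono le = ℚₚ.+-mono-≤ le le
      best-best′ : (best - best′) + (best - best′) ≤ℚ ε
      best-best′ = ℚₚ.≤-trans (double-mono (ℚₚ.+-monoʳ-≤ best (ℚₚ.neg-antimono-≤ (Optimum.maximal o′ ι₁ inj₁′ (Optimum.table o)))))
        (close₁ (Optimum.table o))
      best′-J : (best′ - J) + (best′ - J) ≤ℚ ε
      best′-J = close₂ (Optimum.table o′)
      best′-best : (best′ - best) + (best′ - best) ≤ℚ ε
      best′-best = ℚₚ.≤-trans (double-mono (ℚₚ.+-monoʳ-≤ best′ (ℚₚ.neg-antimono-≤ J≤best))) best′-J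
      average : ∀ x y z → x - z ≡ ½ * (((x - y) + (x - y)) + ((y - z) + (y - z)))
      average = solve-∀ ℚ-ring
      double : ∀ e → ½ * (e + e) ≡ e
      double = solve-∀ ℚ-ring
      best-J : best - J ≤ℚ ε
      best-J = ℚₚ.≤-trans (ℚₚ.≤-reflexive (average best best′ J)) (ℚₚ.≤-trans (*-monoˡ 0≤½ (ℚₚ.+-mono-≤ best-best′ best′-J)) (ℚₚ.≤-reflexive (double ε)))
      J-best : J - best ≤ℚ 0ℚ
      J-best = ℚₚ.≤-trans (ℚₚ.+-monoˡ-≤ (- best) J≤best) (ℚₚ.≤-reflexive (ℚₚ.+-inverseʳ best))

    consistent-accurate : ∀ φ s s₂ D D₂ g → Consistent φ s s₂ D D₂ f → Consistent φ s s₂ D D₂ g →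
      Accurate (Optimum.value (optimum k≤n g) , Optimum.table (optimum k≤n g))
    consistent-accurate φ s s₂ D D₂ g f-ok g-ok = sandwich g o′
      (junta-transfer φ s s₂ D D₂ f g f-ok g-ok (Optimum.coords o) (Optimum.coords-inj o))
      (junta-transfer φ s s₂ D D₂ g f g-ok f-ok (Optimum.coords o′) (Optimum.coords-inj o′))
      where
      o′ : Optimum k g
      o′ = optimum k≤n g

    report-accurate : ∀ φ s s₂ D D₂ → f ∈ allFuns n → Consistent φ s s₂ D D₂ f →
      (d : Dec (Any (Consistent φ s s₂ D D₂) (allFuns n))) → Accurate (report d)
    report-accurate φ s s₂ D D₂ f∈ f-ok (yes found) =
      consistent-accurate φ s s₂ D D₂ (proj₁ (Any.satisfied found)) f-ok (proj₂ (Any.satisfied found))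
    report-accurate φ s s₂ D D₂ f∈ f-ok (no none) = ⊥-elim (none (lose f∈ f-ok))

    selector : Result → Bool
    selector x = does (accurate? x)

    -- If the failure is below 1, then f is consistent, so the search finds some g and its answer is
    -- accurate. Otherwise the left side is not positive.
    play-succeeds : f ∈ allFuns n → ∀ φ s s₂ r r₂ → 1ℚ - failure f φ s s₂ r r₂ ≤ℚ prob f selector (play (φ , s , s₂ , r , r₂))
    play-succeeds f∈ φ s s₂ r r₂ = subst (1ℚ - failure f φ s s₂ r r₂ ≤ℚ_)
      (sym (trans (prob-askAll f selector (at φ s) r _) (prob-askAll f selector (at (merge φ s) s₂) r₂ _))) outcome
      where
      D : Sample (width q)
      D = answered f φ s r
      D₂ : Sample (width (suc q))
      D₂ = answered f (merge φ s) s₂ r₂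
      x : Result
      x = report (Any.any? (consistent? φ s s₂ D D₂) (allFuns n))
      e : ℚ
      e = failure f φ s s₂ r r₂
      complement : ∀ x → 1ℚ ≡ (1ℚ - x) + x
      complement = solve-∀ ℚ-ring
      indicator : ∀ c → 0ℚ ≤ℚ (if c then 1ℚ else 0ℚ)
      indicator true = 0≤1
      indicator false = ℚₚ.≤-refl
      decide : Dec (e < 1ℚ) → 1ℚ - e ≤ℚ (if selector x then 1ℚ else 0ℚ)
      decide (yes small) = subst (λ c → 1ℚ - e ≤ℚ (if c then 1ℚ else 0ℚ))
        (sym (dec-true (accurate? x) (report-accurate φ s s₂ D D₂ f∈ (consistent f φ s s₂ r r₂ small) (Any.any? (consistent? φ s s₂ D D₂) (allFuns n)))))
        (≤-via e (complement e) (0≤failure f φ s s₂ r r₂))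
      decide (no big) = ℚₚ.≤-trans (ℚₚ.+-monoʳ-≤ 1ℚ (ℚₚ.neg-antimono-≤ (ℚₚ.≮⇒≥ big))) (indicator (selector x))
      outcome : 1ℚ - e ≤ℚ prob f selector (ret x)
      outcome = decide (e ℚₚ.<? 1ℚ)

  module Probability
    (dev-small : 4B * ((ℕ→ℚ (suc k) * ℕ→ℚ (suc k)) * p) + (4B * 4B) * ((ℕ→ℚ (3 ^ k) * ℕ→ℚ (3 ^ k)) * (τ + p)) ≤ℚ (+ 1 / 12))
    (coll-small : (ℕ→ℚ n₀ * ℕ→ℚ n₀) * p ≤ℚ (+ 1 / 24))
    (ball : 24 ℕ.* suc (width q) ^ k ≤ 16 ^ H) (ball₂ : 24 ℕ.* suc (width (suc q)) ^ k ≤ 16 ^ H) (f : BoolFun n) where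

    private
      a : Vec Bool n → ℚ
      a = spectrum f
      total : ∑ (bits n) (λ S → a S * a S) ≤ℚ 1ℚ
      total = ℚₚ.≤-reflexive (spectrum-total f)
      labels : Tree (Vec (Fin (width q)) n)
      labels = vec (label q) n
      labels-prob : IsProb labels
      labels-prob = IsProb-vec (label q) (label-prob q) n

      d₁ : Vec (Fin (width q)) n → Vec Bool n → ℚ
      d₁ φ s = deviation φ s a
      d₂ : Vec (Fin (width (suc q))) n → Vec Bool n → ℚ
      d₂ ψ s₂ = deviation ψ s₂ a
      c : Vec (Fin (width q)) n → ℚ
      c φ = collisions (activeᵇ a) φ

      ½^-mono : (½ ^ℚ suc q) ≤ℚ p
      ½^-mono = half-≤ (0≤½^ q) (ℚₚ.≤-reflexive (halves p))
        where
        halves : ∀ x → ½ * x + ½ * x ≡ x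
        halves = solve-∀ ℚ-ring

      𝔼-rows : ∀ φ s s₂ → 𝔼 (rows (width q)) (λ r → 𝔼 (rows (width (suc q))) (λ r₂ → failure f φ s s₂ r r₂))
        ≤ℚ (d₁ φ s + (d₂ (merge φ s) s₂ + c φ)) + ((+ 1 / 24) + (+ 1 / 24))
      𝔼-rows φ s s₂ = begin
        𝔼 R₁ (λ r → 𝔼 R₂ (λ r₂ → base + (sampling f φ s r + sampling f (merge φ s) s₂ r₂)))
          ≡⟨ ∫-cong ½ R₁ (λ r → trans (shift R₂ (rows-prob (width (suc q))) base _)
               (cong (λ z → base + z) (shift R₂ (rows-prob (width (suc q))) (sampling f φ s r) (sampling f (merge φ s) s₂)))) ⟩
        𝔼 R₁ (λ r → base + (sampling f φ s r + 𝔼 R₂ (sampling f (merge φ s) s₂)))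
          ≡⟨ trans (shift R₁ (rows-prob (width q)) base _) (cong (λ z → base + z)
               (trans (∫-+ ½ R₁ (sampling f φ s) (λ _ → 𝔼 R₂ (sampling f (merge φ s) s₂)))
                 (cong (λ z → 𝔼 R₁ (sampling f φ s) + z) (𝔼-const R₁ (rows-prob (width q)) (𝔼 R₂ (sampling f (merge φ s) s₂)))))) ⟩
        base + (𝔼 R₁ (sampling f φ s) + 𝔼 R₂ (sampling f (merge φ s) s₂))
          ≤⟨ ℚₚ.+-monoʳ-≤ base (ℚₚ.+-mono-≤ (𝔼-sampling f φ s ball) (𝔼-sampling f (merge φ s) s₂ ball₂)) ⟩
        base + ((+ 1 / 24) + (+ 1 / 24)) ∎
        where
        open ℚₚ.≤-Reasoning
        base : ℚ
        base = d₁ φ s + (d₂ (merge φ s) s₂ + c φ)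
        R₁ : Tree (Rows (width q))
        R₁ = rows (width q)
        R₂ : Tree (Rows (width (suc q)))
        R₂ = rows (width (suc q))
        shift : ∀ {A : Set} (u : Tree A) → IsProb u → ∀ x (F : A → ℚ) → 𝔼 u (λ y → x + F y) ≡ x + 𝔼 u F
        shift u u-prob x F = trans (∫-+ ½ u (λ _ → x) F) (cong (λ z → z + 𝔼 u F) (𝔼-const u u-prob x))

      𝔼-first : 𝔼 labels (λ φ → 𝔼 (bits n) (λ s → 𝔼 (bits n) (λ s₂ → d₁ φ s))) ≤ℚ (+ 1 / 12)
      𝔼-first = ℚₚ.≤-trans (ℚₚ.≤-reflexive (∫-cong ½ labels (λ φ → ∫-cong ½ (bits n) (λ s → 𝔼-const (bits n) (IsProb-bits n) (d₁ φ s)))))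
        (ℚₚ.≤-trans (𝔼-deviation (label q) (label-prob q) p (0≤½^ q) (label-point q) a total) dev-small)

      𝔼-second : 𝔼 labels (λ φ → 𝔼 (bits n) (λ s → 𝔼 (bits n) (λ s₂ → d₂ (merge φ s) s₂))) ≤ℚ (+ 1 / 12)
      -- Over random φ and s the merged labelling is uniform with 2^(q+1) labels, and s₂ is
      -- independent of it, so the same deviation bound applies.
      𝔼-second = ℚₚ.≤-trans (ℚₚ.≤-reflexive (trans (∫-swap ½ ½ labels (bits n) (λ φ s → 𝔼 (bits n) (d₂ (merge φ s))))
          (∫-zipWith ½ (joinLabel q) flips (label q) n (λ ψ → 𝔼 (bits n) (d₂ ψ)))))
        (ℚₚ.≤-trans (𝔼-deviation (label (suc q)) (label-prob (suc q)) p (0≤½^ q) (λ w → ℚₚ.≤-trans (label-point (suc q) w) ½^-mono) a total) dev-small)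

      𝔼-third : 𝔼 labels (λ φ → 𝔼 (bits n) (λ s → 𝔼 (bits n) (λ s₂ → c φ))) ≤ℚ (+ 1 / 24)
      𝔼-third = ℚₚ.≤-trans (ℚₚ.≤-reflexive (∫-cong ½ labels (λ φ → trans (∫-cong ½ (bits n) (λ s → 𝔼-const (bits n) (IsProb-bits n) (c φ)))
          (𝔼-const (bits n) (IsProb-bits n) (c φ)))))
        (ℚₚ.≤-trans (𝔼-collisions f) coll-small)

      𝔼³ : (Vec (Fin (width q)) n → Vec Bool n → Vec Bool n → ℚ) → ℚ
      𝔼³ F = 𝔼 labels (λ φ → 𝔼 (bits n) (λ s → 𝔼 (bits n) (F φ s)))

      𝔼³-+ : ∀ F G → 𝔼³ (λ φ s s₂ → F φ s s₂ + G φ s s₂) ≡ 𝔼³ F + 𝔼³ G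
      𝔼³-+ F G = trans (∫-cong ½ labels (λ φ → trans (∫-cong ½ (bits n) (λ s → ∫-+ ½ (bits n) (F φ s) (G φ s)))
        (∫-+ ½ (bits n) (λ s → 𝔼 (bits n) (F φ s)) (λ s → 𝔼 (bits n) (G φ s)))))
        (∫-+ ½ labels (λ φ → 𝔼 (bits n) (λ s → 𝔼 (bits n) (F φ s))) (λ φ → 𝔼 (bits n) (λ s → 𝔼 (bits n) (G φ s))))

      𝔼³-const : ∀ x → 𝔼³ (λ _ _ _ → x) ≡ x
      𝔼³-const x = trans (∫-cong ½ labels (λ φ → trans (∫-cong ½ (bits n) (λ s → 𝔼-const (bits n) (IsProb-bits n) x))
        (𝔼-const (bits n) (IsProb-bits n) x))) (𝔼-const labels labels-prob x)

      failure′ : Draw → ℚ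
      failure′ (φ , s , s₂ , r , r₂) = failure f φ s s₂ r r₂

    𝔼-failure : 𝔼 draw failure′ ≤ℚ (+ 1 / 3)
    𝔼-failure = begin
      𝔼 draw failure′
        ≡⟨ 𝔼-draw failure′ ⟩
      𝔼³ (λ φ s s₂ → 𝔼 (rows (width q)) (λ r → 𝔼 (rows (width (suc q))) (λ r₂ → failure f φ s s₂ r r₂)))
        ≤⟨ 𝔼-mono labels (λ φ → 𝔼-mono (bits n) (λ s → 𝔼-mono (bits n) (𝔼-rows φ s))) ⟩
      𝔼³ (λ φ s s₂ → (d₁ φ s + (d₂ (merge φ s) s₂ + c φ)) + ((+ 1 / 24) + (+ 1 / 24)))
        ≡⟨ trans (𝔼³-+ (λ φ s s₂ → d₁ φ s + (d₂ (merge φ s) s₂ + c φ)) (λ _ _ _ → (+ 1 / 24) + (+ 1 / 24)))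
             (cong₂ _+_ (trans (𝔼³-+ (λ φ s _ → d₁ φ s) (λ φ s s₂ → d₂ (merge φ s) s₂ + c φ))
               (cong (λ z → 𝔼³ (λ φ s _ → d₁ φ s) + z) (𝔼³-+ (λ φ s s₂ → d₂ (merge φ s) s₂) (λ φ _ _ → c φ))))
               (𝔼³-const ((+ 1 / 24) + (+ 1 / 24)))) ⟩
      (𝔼³ (λ φ s _ → d₁ φ s) + (𝔼³ (λ φ s s₂ → d₂ (merge φ s) s₂) + 𝔼³ (λ φ _ _ → c φ))) + ((+ 1 / 24) + (+ 1 / 24))
        ≤⟨ ℚₚ.+-monoˡ-≤ ((+ 1 / 24) + (+ 1 / 24)) (ℚₚ.+-mono-≤ 𝔼-first (ℚₚ.+-mono-≤ 𝔼-second 𝔼-third)) ⟩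
      ((+ 1 / 12) + ((+ 1 / 12) + (+ 1 / 24))) + ((+ 1 / 24) + (+ 1 / 24))
        -- The failure probabilities add up to 7/24.
        ≤⟨ ≤-via (+ 1 / 24) refl (ℚₚ.nonNegative⁻¹ (+ 1 / 24)) ⟩
      + 1 / 3 ∎
      where open ℚₚ.≤-Reasoning

    success : ∀ ε E (0<E : 0ℚ < E) (1≤Eε : 1ℚ ≤ℚ E * ε) (0≤ε : 0ℚ ≤ℚ ε) (B≡ : B ≡ (+ 256 / 1) * (ℕ→ℚ (2 ^ k) * (E * E))) →
      f ∈ allFuns n → ProbAtLeast f (Good n k ε f) algorithm (+ 2 / 3)
    success ε E 0<E 1≤Eε 0≤ε B≡ f∈ = selector , accurate-good , (begin
      + 2 / 3
        ≡⟨⟩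
      1ℚ - (+ 1 / 3)
        ≤⟨ ℚₚ.+-monoʳ-≤ 1ℚ (ℚₚ.neg-antimono-≤ 𝔼-failure) ⟩
      1ℚ - 𝔼 draw failure′
        ≡⟨ sym (trans (∫-+ ½ draw (λ _ → 1ℚ) (λ ω → - failure′ ω)) (cong₂ _+_ draw-prob (negate failure′))) ⟩
      𝔼 draw (λ ω → 1ℚ - failure′ ω)
        ≤⟨ 𝔼-mono draw (λ (φ , s , s₂ , r , r₂) → play-succeeds f∈ φ s s₂ r r₂) ⟩
      𝔼 draw (λ ω → prob f selector (play ω))
        ≤⟨ prob-flipCoins f selector draw default play ⟩
      prob f selector algorithm ∎)
      where
      open Quality ε E 0<E 1≤Eε 0≤ε B≡ f
      open ℚₚ.≤-Reasoning
      minus-one : ∀ x → - x ≡ (- 1ℚ) * x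
      minus-one = solve-∀ ℚ-ring
      negate : ∀ (F : Draw → ℚ) → 𝔼 draw (λ ω → - F ω) ≡ - 𝔼 draw F
      negate F = trans (∫-cong ½ draw (λ ω → minus-one (F ω))) (trans (∫-*ˡ ½ draw (- 1ℚ) F) (sym (minus-one (𝔼 draw F))))

-- Parameters

-- Opaque, so that products by large numerals stay unevaluated.
opaque
  numeral : ℕ → ℕ
  numeral c = c

  numeral-≡ : ∀ c → numeral c ≡ c
  numeral-≡ c = refl

opaque
  pow : ℕ → ℕ
  pow x = 2 ^ x

  pow-def : ∀ x → pow x ≡ 2 ^ x
  pow-def x = refl

≤-witness : ∀ {x y} z → y ≡ x ℕ.+ z → x ≤ y
≤-witness {x} z refl = ℕₚ.m≤m+n x z

suc≤2^ : ∀ x → suc x ≤ 2 ^ x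
suc≤2^ zero = ℕₚ.≤-refl
suc≤2^ (suc x) = ℕₚ.+-mono-≤ (ℕₚ.m^n>0 2 x) (ℕₚ.≤-trans (suc≤2^ x) (ℕₚ.≤-reflexive (sym (ℕₚ.+-identityʳ (2 ^ x)))))

suc≤pow : ∀ x → suc x ≤ pow x
suc≤pow x = subst (suc x ≤_) (sym (pow-def x)) (suc≤2^ x)

≤pow : ∀ x → x ≤ pow x
≤pow x = ℕₚ.≤-trans (ℕₚ.n≤1+n x) (suc≤pow x)

pow-+ : ∀ x y → pow x ℕ.* pow y ≡ pow (x ℕ.+ y)
pow-+ x y = trans (cong₂ ℕ._*_ (pow-def x) (pow-def y)) (trans (sym (ℕₚ.^-distribˡ-+-* 2 x y)) (sym (pow-def (x ℕ.+ y))))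

pow-mono : ∀ {x y} → x ≤ y → pow x ≤ pow y
pow-mono {x} {y} x≤y = subst₂ _≤_ (sym (pow-def x)) (sym (pow-def y)) (ℕₚ.^-monoʳ-≤ 2 x≤y)

½^-2^ : ∀ x → (½ ^ℚ x) * ℕ→ℚ (2 ^ x) ≡ 1ℚ
½^-2^ zero = refl
½^-2^ (suc x) = trans (cong ((½ * (½ ^ℚ x)) *_) (ℕ→ℚ-* 2 (2 ^ x)))
  (trans (interchange (½ ^ℚ x) (ℕ→ℚ (2 ^ x))) (½^-2^ x))
  where
  interchange : ∀ u v → (½ * u) * ((+ 2 / 1) * v) ≡ u * v
  interchange = solve-∀ ℚ-ring

½^-antitone : ∀ x y → (½ ^ℚ (x ℕ.+ y)) ≤ℚ (½ ^ℚ y)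
½^-antitone zero y = ℚₚ.≤-refl
½^-antitone (suc x) y = ℚₚ.≤-trans (≤-via (½ * h) (split h) (0≤-* 0≤½ (0≤½^ (x ℕ.+ y)))) (½^-antitone x y)
  where
  h : ℚ
  h = ½ ^ℚ (x ℕ.+ y)
  split : ∀ h → h ≡ ½ * h + ½ * h
  split = solve-∀ ℚ-ring

scaled≤pow : ∀ c e {x y} → c ≤ 2 ^ e → x ≤ pow y → numeral c ℕ.* x ≤ pow (e ℕ.+ y)
scaled≤pow c e {x} {y} c≤ x≤ = ℕₚ.≤-trans
  (ℕₚ.*-mono-≤ {numeral c} {pow e} {x} {pow y} (subst₂ _≤_ (sym (numeral-≡ c)) (sym (pow-def e)) c≤) x≤)
  (ℕₚ.≤-reflexive (pow-+ e y))

product≤pow : ∀ {u v x y} → u ≤ pow x → v ≤ pow y → u ℕ.* v ≤ pow (x ℕ.+ y)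
product≤pow {x = x} {y} u≤ v≤ = ℕₚ.≤-trans (ℕₚ.*-mono-≤ u≤ v≤) (ℕₚ.≤-reflexive (pow-+ x y))

small-product : ∀ c x y → numeral c ℕ.* x ≤ pow y → ℕ→ℚ c * (ℕ→ℚ x * (½ ^ℚ y)) ≤ℚ 1ℚ
small-product c x y le = ℚₚ.≤-trans (ℚₚ.≤-reflexive (sym (ℚₚ.*-assoc (ℕ→ℚ c) (ℕ→ℚ x) (½ ^ℚ y))))
  (ℚₚ.≤-trans (*-monoʳ (0≤½^ y) (ℚₚ.≤-trans (ℚₚ.≤-reflexive (sym (trans (ℕ→ℚ-* (numeral c) x) (cong (λ z → ℕ→ℚ z * ℕ→ℚ x) (numeral-≡ c))))) (ℕ→ℚ-mono (subst (numeral c ℕ.* x ≤_) (pow-def y) le))))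
    (ℚₚ.≤-reflexive (trans (ℚₚ.*-comm (ℕ→ℚ (2 ^ y)) (½ ^ℚ y)) (½^-2^ y))))

opaque
  -- ⌊1/ε⌋ + 1 for ε > 0, and the junk value 1 otherwise.
  reciprocal : ℚ → ℕ
  reciprocal (Data.Rational.mkℚ (+ suc a) d-1 _) = suc (suc d-1 ℕ./ suc a)
  reciprocal _ = 1

  reciprocal-bounds : ∀ ε → 0ℚ < ε → (1ℚ ≤ℚ ℕ→ℚ (reciprocal ε) * ε) × (ℕ→ℚ (reciprocal ε) * ε ≤ℚ 1ℚ + ε)
  reciprocal-bounds (Data.Rational.mkℚ ℤ.-[1+ _ ] d-1 _) (Data.Rational.*<* ())
  reciprocal-bounds (Data.Rational.mkℚ (+ zero) d-1 _) (Data.Rational.*<* (ℤ.+<+ ()))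
  reciprocal-bounds ε@(Data.Rational.mkℚ (+ suc a) d-1 coprime) _ = lower , upper
    where
    open ℚₚ.≤-Reasoning
    d x : ℕ
    d = suc d-1
    x = d ℕ./ suc a
    D N X : ℚ
    D = ℕ→ℚ d
    N = ℕ→ℚ (suc a)
    X = ℕ→ℚ x
    0<D : 0ℚ < D
    0<D = ℚₚ.<-≤-trans (ℚₚ.positive⁻¹ 1ℚ) (ℕ→ℚ-mono {1} {d} (s≤s z≤n))
    εD≡N : ε * D ≡ N
    εD≡N = ℚₚ.toℚᵘ-injective (ℚᵘₚ.≃-trans (ℚₚ.toℚᵘ-homo-* ε D)
      (ℚᵘₚ.≃-trans (ℚᵘₚ.*-congˡ {ℚᵘ.mkℚᵘ (+ suc a) d-1} (ℚₚ.toℚᵘ-fromℚᵘ (ℚᵘ.mkℚᵘ (+ d) 0)))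
      (ℚᵘₚ.≃-trans (ℚᵘ.*≡* (trans (ℤₚ.*-identityʳ (+ suc a ℤ.* + d)) (cong (λ z → + suc a ℤ.* + suc z) (sym (ℕₚ.*-identityʳ d-1)))))
      (ℚᵘₚ.≃-sym (ℚₚ.toℚᵘ-fromℚᵘ (ℚᵘ.mkℚᵘ (+ suc a) 0))))))
    division : d ≡ d ℕ.% suc a ℕ.+ x ℕ.* suc a
    division = m≡m%n+[m/n]*n d (suc a)
    lower : 1ℚ ≤ℚ ℕ→ℚ (suc x) * ε
    lower = ℚₚ.*-cancelʳ-≤-pos D {{Data.Rational.positive 0<D}} (begin
      1ℚ * D                   ≡⟨ ℚₚ.*-identityˡ D ⟩
      D                        ≤⟨ ℕ→ℚ-mono (ℕₚ.≤-trans (ℕₚ.≤-reflexive division) (ℕₚ.+-monoˡ-≤ (x ℕ.* suc a) (ℕₚ.<⇒≤ (m%n<n d (suc a))))) ⟩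
      ℕ→ℚ (suc x ℕ.* suc a)    ≡⟨ ℕ→ℚ-* (suc x) (suc a) ⟩
      ℕ→ℚ (suc x) * N          ≡⟨ cong (ℕ→ℚ (suc x) *_) (sym εD≡N) ⟩
      ℕ→ℚ (suc x) * (ε * D)    ≡⟨ sym (ℚₚ.*-assoc (ℕ→ℚ (suc x)) ε D) ⟩
      (ℕ→ℚ (suc x) * ε) * D    ∎)
    Xε≤1 : X * ε ≤ℚ 1ℚ
    Xε≤1 = ℚₚ.*-cancelʳ-≤-pos D {{Data.Rational.positive 0<D}} (begin
      (X * ε) * D              ≡⟨ ℚₚ.*-assoc X ε D ⟩
      X * (ε * D)              ≡⟨ cong (X *_) εD≡N ⟩
      X * N                    ≡⟨ sym (ℕ→ℚ-* x (suc a)) ⟩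
      ℕ→ℚ (x ℕ.* suc a)        ≤⟨ ℕ→ℚ-mono (ℕₚ.≤-trans (ℕₚ.m≤n+m (x ℕ.* suc a) (d ℕ.% suc a)) (ℕₚ.≤-reflexive (sym division))) ⟩
      D                        ≡⟨ sym (ℚₚ.*-identityˡ D) ⟩
      1ℚ * D                   ∎)
    expand : ∀ X ε → (1ℚ + X) * ε ≡ X * ε + ε
    expand = solve-∀ ℚ-ring
    upper : ℕ→ℚ (suc x) * ε ≤ℚ 1ℚ + ε
    upper = ℚₚ.≤-trans (ℚₚ.≤-reflexive (trans (cong (_* ε) (ℕ→ℚ-suc x)) (expand X ε))) (ℚₚ.+-monoˡ-≤ ε Xε≤1)

opaque
  unfolding reciprocal

  reciprocal-positive : ∀ ε → 0 ℕ.< reciprocal ε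
  reciprocal-positive (Data.Rational.mkℚ (+ suc a) d-1 _) = s≤s z≤n
  reciprocal-positive (Data.Rational.mkℚ (+ zero) d-1 _) = s≤s z≤n
  reciprocal-positive (Data.Rational.mkℚ ℤ.-[1+ _ ] d-1 _) = s≤s z≤n

-- E is an integer slightly above 1/ε. The exponents are linear in k and E because E is bounded
-- crudely by 2^E; this is affordable since the number of labels enters the query count only through
-- its logarithm, in H.
module Parameters (k E : ℕ) where
  opaque
    b : ℕ
    b = numeral 256 ℕ.* (2 ^ k ℕ.* (E ℕ.* E))

    b-def : b ≡ numeral 256 ℕ.* (2 ^ k ℕ.* (E ℕ.* E))
    b-def = refl

  opaque
    m : ℕ
    m = numeral 64 ℕ.* b

    m-def : m ≡ numeral 64 ℕ.* b
    m-def = refl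

  opaque
    t′ : ℕ
    -- Chosen for 768 b² 9^k ≤ 2^t′, given b ≤ 2^(8 + k + 2E): the exponent is 10 + 2(8 + k + 2E) +
    -- 4k.
    t′ = 26 ℕ.+ (6 ℕ.* k ℕ.+ 4 ℕ.* E)

    t′-def : t′ ≡ 26 ℕ.+ (6 ℕ.* k ℕ.+ 4 ℕ.* E)
    t′-def = refl

  opaque
    t : ℕ
    t = pow t′

    t-def : t ≡ pow t′
    t-def = refl

    τ : ℚ
    τ = ½ ^ℚ t′

    τ-def : τ ≡ ½ ^ℚ t′
    τ-def = refl

    n₀ : ℕ
    -- At most t k coordinates are active, and k more must be available: (t + 1) k ≤ 2 t 2^k.
    n₀ = pow (t′ ℕ.+ (k ℕ.+ 1))

    n₀-def : n₀ ≡ pow (t′ ℕ.+ (k ℕ.+ 1))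
    n₀-def = refl

  opaque
    q : ℕ
    -- Chosen for 24 n₀² ≤ 2^q, so that active coordinates rarely collide.
    q = 2 ℕ.* (t′ ℕ.+ (k ℕ.+ 1)) ℕ.+ 5

    q-def : q ≡ 2 ℕ.* (t′ ℕ.+ (k ℕ.+ 1)) ℕ.+ 5
    q-def = refl

  opaque
    H : ℕ
    -- Both data sets have fewer than 2^(q+2) labels, so 24 times the number of low-weight label
    -- sets is at most 2^(5 + (q+2)k), which 16^H exceeds.
    H = (q ℕ.+ 2) ℕ.* k ℕ.+ 2

    H-def : H ≡ (q ℕ.+ 2) ℕ.* k ℕ.+ 2
    H-def = refl

  0≤τ : 0ℚ ≤ℚ τ
  0≤τ = subst (0ℚ ≤ℚ_) (sym τ-def) (0≤½^ t′)

  τt≡1 : τ * ℕ→ℚ t ≡ 1ℚ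
  τt≡1 = trans (cong₂ (λ x y → x * ℕ→ℚ y) τ-def (trans t-def (pow-def t′))) (½^-2^ t′)

  private
    c : ℕ
    c = 8 ℕ.+ (k ℕ.+ (E ℕ.+ E))

    p β κ ω : ℚ
    p = ½ ^ℚ q
    β = ℕ→ℚ b
    κ = ℕ→ℚ (suc k)
    ω = ℕ→ℚ (3 ^ k)

  m≡64b : ℕ→ℚ m ≡ (+ 64 / 1) * ℕ→ℚ b
  m≡64b = trans (cong ℕ→ℚ m-def) (trans (ℕ→ℚ-* (numeral 64) b) (cong (λ z → ℕ→ℚ z * ℕ→ℚ b) (numeral-≡ 64)))

  b≡ : ℕ→ℚ b ≡ (+ 256 / 1) * (ℕ→ℚ (2 ^ k) * (ℕ→ℚ E * ℕ→ℚ E))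
  b≡ = trans (cong ℕ→ℚ b-def) (trans (ℕ→ℚ-* (numeral 256) (2 ^ k ℕ.* (E ℕ.* E))) (cong₂ _*_ (cong ℕ→ℚ (numeral-≡ 256))
    (trans (ℕ→ℚ-* (2 ^ k) (E ℕ.* E)) (cong (ℕ→ℚ (2 ^ k) *_) (ℕ→ℚ-* E E)))))

  b≤pow : b ≤ pow c
  b≤pow = subst (_≤ pow c) (sym b-def) (scaled≤pow 256 8 (ℕₚ.≤ᵇ⇒≤ 256 256 _) (product≤pow (ℕₚ.≤-reflexive (sym (pow-def k))) (product≤pow (≤pow E) (≤pow E))))

  b≤t : b ≤ t
  b≤t = ℕₚ.≤-trans b≤pow (ℕₚ.≤-trans (pow-mono (≤-witness (18 ℕ.+ (5 ℕ.* k ℕ.+ 2 ℕ.* E)) (trans t′-def (exponents k E)))) (ℕₚ.≤-reflexive (sym t-def)))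
    where
    exponents : ∀ k E → 26 ℕ.+ (6 ℕ.* k ℕ.+ 4 ℕ.* E) ≡ (8 ℕ.+ (k ℕ.+ (E ℕ.+ E))) ℕ.+ (18 ℕ.+ (5 ℕ.* k ℕ.+ 2 ℕ.* E))
    exponents = ℕ-Ring.solve-∀

  0<m : 0 ℕ.< E → 0 ℕ.< m
  0<m 0<E = subst (0 ℕ.<_) (sym m-def) (ℕₚ.*-mono-≤ (ℕₚ.≤-trans (ℕₚ.≤ᵇ⇒≤ 1 64 _) (ℕₚ.≤-reflexive (sym (numeral-≡ 64))))
    (subst (0 ℕ.<_) (sym b-def) (ℕₚ.*-mono-≤ (ℕₚ.≤-trans (ℕₚ.≤ᵇ⇒≤ 1 256 _) (ℕₚ.≤-reflexive (sym (numeral-≡ 256)))) (ℕₚ.*-mono-≤ (ℕₚ.m^n>0 2 k) (ℕₚ.*-mono-≤ 0<E 0<E)))))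

  room : t ℕ.* k ℕ.+ k ≤ n₀
  room = ℕₚ.≤-trans (ℕₚ.≤-reflexive (ℕₚ.+-comm (t ℕ.* k) k)) (ℕₚ.≤-trans
    (ℕₚ.*-mono-≤ {suc t} {t ℕ.+ t} (ℕₚ.+-monoˡ-≤ t (subst (1 ≤_) (sym t-def) (ℕₚ.≤-trans (s≤s z≤n) (suc≤pow t′)))) (≤pow k))
    (ℕₚ.≤-reflexive (trans (regroup t (pow k)) (trans (cong₂ ℕ._*_ t-def (trans (cong (pow k ℕ.*_) (sym (pow-def 1))) (pow-+ k 1))) (trans (pow-+ t′ (k ℕ.+ 1)) (sym n₀-def))))))
    where
    regroup : ∀ t K → (t ℕ.+ t) ℕ.* K ≡ t ℕ.* (K ℕ.* 2)
    regroup = ℕ-Ring.solve-∀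

  coll-small : (ℕ→ℚ n₀ * ℕ→ℚ n₀) * p ≤ℚ (+ 1 / 24)
  coll-small = ℚₚ.≤-trans (ℚₚ.≤-reflexive (trans (cong (_* p) (sym (ℕ→ℚ-* n₀ n₀))) (rescale (ℕ→ℚ (n₀ ℕ.* n₀) * p))))
    (ℚₚ.≤-trans (*-monoˡ (ℚₚ.nonNegative⁻¹ (+ 1 / 24)) (small-product 24 (n₀ ℕ.* n₀) q count)) (ℚₚ.≤-reflexive (ℚₚ.*-identityʳ (+ 1 / 24))))
    where
    rescale : ∀ x → x ≡ (+ 1 / 24) * ((+ 24 / 1) * x)
    rescale = solve-∀ ℚ-ring
    y : ℕ
    y = t′ ℕ.+ (k ℕ.+ 1)
    exponents : ∀ y → 5 ℕ.+ (y ℕ.+ y) ≡ 2 ℕ.* y ℕ.+ 5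
    exponents = ℕ-Ring.solve-∀
    count : numeral 24 ℕ.* (n₀ ℕ.* n₀) ≤ pow q
    count = ℕₚ.≤-trans (scaled≤pow 24 5 (ℕₚ.≤ᵇ⇒≤ 24 32 _) (product≤pow {n₀} {n₀} {y} {y} (ℕₚ.≤-reflexive n₀-def) (ℕₚ.≤-reflexive n₀-def)))
      (ℕₚ.≤-reflexive (cong pow (trans (exponents y) (sym q-def))))

  p≤τ : p ≤ℚ τ
  p≤τ = subst₂ (λ y z → (½ ^ℚ y) ≤ℚ z) (sym (trans q-def (exponents t′ k))) (sym τ-def) (½^-antitone (t′ ℕ.+ (2 ℕ.* k ℕ.+ 7)) t′)
    where
    exponents : ∀ y k → 2 ℕ.* (y ℕ.+ (k ℕ.+ 1)) ℕ.+ 5 ≡ (y ℕ.+ (2 ℕ.* k ℕ.+ 7)) ℕ.+ y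
    exponents = ℕ-Ring.solve-∀

  deep-small : ((+ 4 / 1) * β) * ((κ * κ) * p) ≤ℚ (+ 1 / 24)
  deep-small = ℚₚ.≤-trans (ℚₚ.≤-reflexive (trans (regroup β κ p)
      (cong (λ z → (+ 1 / 24) * ((+ 96 / 1) * (z * p))) (trans (cong (β *_) (sym (ℕ→ℚ-* (suc k) (suc k)))) (sym (ℕ→ℚ-* b (suc k ℕ.* suc k)))))))
    (ℚₚ.≤-trans (*-monoˡ (ℚₚ.nonNegative⁻¹ (+ 1 / 24)) (small-product 96 (b ℕ.* (suc k ℕ.* suc k)) q count)) (ℚₚ.≤-reflexive (ℚₚ.*-identityʳ (+ 1 / 24))))
    where
    regroup : ∀ β κ p → ((+ 4 / 1) * β) * ((κ * κ) * p) ≡ (+ 1 / 24) * ((+ 96 / 1) * ((β * (κ * κ)) * p))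
    regroup = solve-∀ ℚ-ring
    exponents : ∀ y k → 2 ℕ.* (y ℕ.+ (k ℕ.+ 1)) ℕ.+ 5 ≡ (7 ℕ.+ (y ℕ.+ (k ℕ.+ k))) ℕ.+ y
    exponents = ℕ-Ring.solve-∀
    count : numeral 96 ℕ.* (b ℕ.* (suc k ℕ.* suc k)) ≤ pow q
    count = ℕₚ.≤-trans (scaled≤pow 96 7 (ℕₚ.≤ᵇ⇒≤ 96 128 _) (product≤pow {b} {suc k ℕ.* suc k} {t′} {k ℕ.+ k}
        (ℕₚ.≤-trans b≤t (ℕₚ.≤-reflexive t-def)) (product≤pow {suc k} {suc k} {k} {k} (suc≤pow k) (suc≤pow k))))
      (pow-mono (≤-witness t′ (trans q-def (exponents t′ k))))

  3^≤ : 3 ^ k ≤ pow (2 ℕ.* k)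
  3^≤ = ℕₚ.≤-trans (ℕₚ.^-monoˡ-≤ k {3} {4} (ℕₚ.m≤m+n 3 1)) (ℕₚ.≤-reflexive (trans (ℕₚ.^-*-assoc 2 2 k) (sym (pow-def (2 ℕ.* k)))))

  faint-sum-small : (((+ 4 / 1) * β) * ((+ 4 / 1) * β)) * ((ω * ω) * (τ + p)) ≤ℚ (+ 1 / 24)
  faint-sum-small = ℚₚ.≤-trans (*-monoˡ (0≤-sq ((+ 4 / 1) * β)) (*-monoˡ (0≤-sq ω) (ℚₚ.+-monoʳ-≤ τ p≤τ)))
    (ℚₚ.≤-trans (ℚₚ.≤-reflexive (trans (regroup β ω τ)
      (cong₂ (λ z y → (+ 1 / 24) * ((+ 768 / 1) * (z * y))) (trans (cong₂ _*_ (sym (ℕ→ℚ-* b b)) (sym (ℕ→ℚ-* (3 ^ k) (3 ^ k)))) (sym (ℕ→ℚ-* (b ℕ.* b) (3 ^ k ℕ.* 3 ^ k)))) τ-def)))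
    (ℚₚ.≤-trans (*-monoˡ (ℚₚ.nonNegative⁻¹ (+ 1 / 24)) (small-product 768 ((b ℕ.* b) ℕ.* (3 ^ k ℕ.* 3 ^ k)) t′ count)) (ℚₚ.≤-reflexive (ℚₚ.*-identityʳ (+ 1 / 24)))))
    where
    regroup : ∀ β ω τ → (((+ 4 / 1) * β) * ((+ 4 / 1) * β)) * ((ω * ω) * (τ + τ)) ≡ (+ 1 / 24) * ((+ 768 / 1) * (((β * β) * (ω * ω)) * τ))
    regroup = solve-∀ ℚ-ring
    exponents : ∀ k E → 10 ℕ.+ (((8 ℕ.+ (k ℕ.+ (E ℕ.+ E))) ℕ.+ (8 ℕ.+ (k ℕ.+ (E ℕ.+ E)))) ℕ.+ (2 ℕ.* k ℕ.+ 2 ℕ.* k)) ≡ 26 ℕ.+ (6 ℕ.* k ℕ.+ 4 ℕ.* E)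
    exponents = ℕ-Ring.solve-∀
    count : numeral 768 ℕ.* ((b ℕ.* b) ℕ.* (3 ^ k ℕ.* 3 ^ k)) ≤ pow t′
    count = ℕₚ.≤-trans (scaled≤pow 768 10 (ℕₚ.≤ᵇ⇒≤ 768 1024 _) (product≤pow {b ℕ.* b} {3 ^ k ℕ.* 3 ^ k} {c ℕ.+ c} {2 ℕ.* k ℕ.+ 2 ℕ.* k}
        (product≤pow {b} {b} {c} {c} b≤pow b≤pow) (product≤pow {3 ^ k} {3 ^ k} {2 ℕ.* k} {2 ℕ.* k} 3^≤ 3^≤)))
      (ℕₚ.≤-reflexive (cong pow (trans (exponents k E) (sym t′-def))))

  dev-small : ((+ 4 / 1) * β) * ((κ * κ) * p) + (((+ 4 / 1) * β) * ((+ 4 / 1) * β)) * ((ω * ω) * (τ + p)) ≤ℚ (+ 1 / 12)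
  dev-small = ℚₚ.≤-trans (ℚₚ.+-mono-≤ deep-small faint-sum-small) (ℚₚ.≤-reflexive {(+ 1 / 24) + (+ 1 / 24)} refl)

  private
    pow-^ : ∀ x y → pow x ^ y ≡ pow (x ℕ.* y)
    pow-^ x y = trans (cong (_^ y) (pow-def x)) (trans (ℕₚ.^-*-assoc 2 x y) (sym (pow-def (x ℕ.* y))))

    ball-bound : ∀ x → suc x ≤ pow (q ℕ.+ 2) → 24 ℕ.* suc x ^ k ≤ 16 ^ H
    ball-bound x le = ℕₚ.≤-trans (ℕₚ.≤-reflexive (cong (ℕ._* suc x ^ k) (sym (numeral-≡ 24))))
      (ℕₚ.≤-trans (scaled≤pow 24 5 {suc x ^ k} {z} (ℕₚ.≤ᵇ⇒≤ 24 32 _) (ℕₚ.≤-trans (ℕₚ.^-monoˡ-≤ k le) (ℕₚ.≤-reflexive (pow-^ (q ℕ.+ 2) k))))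
      (ℕₚ.≤-trans (pow-mono {5 ℕ.+ z} {4 ℕ.* H} (≤-witness (3 ℕ.* z ℕ.+ 3) (trans (cong (4 ℕ.*_) H-def) (exponents z)))) (ℕₚ.≤-reflexive (trans (pow-def (4 ℕ.* H)) (sym (ℕₚ.^-*-assoc 2 4 H))))))
      where
      z : ℕ
      z = (q ℕ.+ 2) ℕ.* k
      exponents : ∀ y → 4 ℕ.* (y ℕ.+ 2) ≡ (5 ℕ.+ y) ℕ.+ (3 ℕ.* y ℕ.+ 3)
      exponents = ℕ-Ring.solve-∀

    suc-pow : ∀ x → suc (width x) ≤ pow (x ℕ.+ 1)
    suc-pow x = ℕₚ.≤-trans (ℕₚ.≤-reflexive (cong suc (trans (width-2^ x) (sym (pow-def x)))))
      (ℕₚ.≤-trans (ℕₚ.+-monoˡ-≤ (pow x) (ℕₚ.≤-trans (s≤s z≤n) (suc≤pow x)))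
        (ℕₚ.≤-reflexive (trans (double (pow x)) (trans (cong (pow x ℕ.*_) (sym (pow-def 1))) (pow-+ x 1)))))
      where
      double : ∀ y → y ℕ.+ y ≡ y ℕ.* 2
      double = ℕ-Ring.solve-∀

  ball : 24 ℕ.* suc (width q) ^ k ≤ 16 ^ H
  ball = ball-bound (width q) (ℕₚ.≤-trans (suc-pow q) (pow-mono (ℕₚ.+-monoʳ-≤ q {1} {2} (s≤s z≤n))))

  ball₂ : 24 ℕ.* suc (width (suc q)) ^ k ≤ 16 ^ H
  ball₂ = ball-bound (width (suc q)) (ℕₚ.≤-trans (suc-pow (suc q)) (ℕₚ.≤-reflexive (cong pow (sym (ℕₚ.+-suc q 1)))))

  -- The 4 H m queries contain 2^k once, through m = 64 · 256 · 2^k E². With S = k + 1 + E, the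
  -- bound q + 2 ≤ 61 S gives H ≤ 63 S², so the remaining factor has degree 4 in S.
  query-count : 2 ℕ.* H ℕ.* m ℕ.+ (2 ℕ.* H ℕ.* m ℕ.+ 0) ≤ 2 ^ k ℕ.* (numeral 4194304 ℕ.* (((k ℕ.+ 1) ℕ.+ E) ^ 4))
  query-count = ℕₚ.≤-trans
    (ℕₚ.≤-reflexive (trans (cong (λ x → 2 ℕ.* H ℕ.* x ℕ.+ (2 ℕ.* H ℕ.* x ℕ.+ 0)) (trans m-def (cong (numeral 64 ℕ.*_) b-def)))
      (collect (numeral 64) (numeral 256) H (2 ^ k) E)))
    (ℕₚ.*-monoʳ-≤ (2 ^ k) (ℕₚ.≤-trans (ℕₚ.*-monoʳ-≤ (4 ℕ.* (numeral 64 ℕ.* numeral 256)) (ℕₚ.*-mono-≤ H≤ (ℕₚ.*-mono-≤ E≤S E≤S)))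
      (ℕₚ.≤-trans (ℕₚ.≤-reflexive (regroup (4 ℕ.* (numeral 64 ℕ.* numeral 256)) (numeral 63) S)) (ℕₚ.*-monoˡ-≤ (S ^ 4) constants))))
    where
    S : ℕ
    S = (k ℕ.+ 1) ℕ.+ E
    E≤S : E ≤ S
    E≤S = ℕₚ.m≤n+m E (k ℕ.+ 1)
    1≤S : 1 ≤ S
    1≤S = ℕₚ.≤-trans (ℕₚ.m≤n+m 1 k) (ℕₚ.m≤m+n (k ℕ.+ 1) E)
    k≤S : k ≤ S
    k≤S = ℕₚ.≤-trans (ℕₚ.m≤m+n k 1) (ℕₚ.m≤m+n (k ℕ.+ 1) E)
    labels≤ : q ℕ.+ 2 ≤ 61 ℕ.* S
    labels≤ = ≤-witness (47 ℕ.* k ℕ.+ 53 ℕ.* E) (trans (exponents k E) (cong (λ z → z ℕ.+ 2 ℕ.+ (47 ℕ.* k ℕ.+ 53 ℕ.* E))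
        (sym (trans q-def (cong (λ z → 2 ℕ.* (z ℕ.+ (k ℕ.+ 1)) ℕ.+ 5) t′-def)))))
      where
      exponents : ∀ k E → 61 ℕ.* ((k ℕ.+ 1) ℕ.+ E) ≡ (2 ℕ.* ((26 ℕ.+ (6 ℕ.* k ℕ.+ 4 ℕ.* E)) ℕ.+ (k ℕ.+ 1)) ℕ.+ 5) ℕ.+ 2 ℕ.+ (47 ℕ.* k ℕ.+ 53 ℕ.* E)
      exponents = ℕ-Ring.solve-∀
    H≤ : H ≤ numeral 63 ℕ.* (S ℕ.* S)
    H≤ = ℕₚ.≤-trans (ℕₚ.≤-reflexive H-def) (ℕₚ.≤-trans (ℕₚ.+-mono-≤ (ℕₚ.*-mono-≤ labels≤ k≤S) (ℕₚ.*-monoʳ-≤ 2 (ℕₚ.*-mono-≤ 1≤S 1≤S)))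
      (ℕₚ.≤-reflexive (trans (sum S) (cong (ℕ._* (S ℕ.* S)) (sym (numeral-≡ 63))))))
      where
      sum : ∀ S → 61 ℕ.* S ℕ.* S ℕ.+ 2 ℕ.* (S ℕ.* S) ≡ 63 ℕ.* (S ℕ.* S)
      sum = ℕ-Ring.solve-∀
    collect : ∀ x y H K E → 2 ℕ.* H ℕ.* (x ℕ.* (y ℕ.* (K ℕ.* (E ℕ.* E)))) ℕ.+ (2 ℕ.* H ℕ.* (x ℕ.* (y ℕ.* (K ℕ.* (E ℕ.* E)))) ℕ.+ 0)
      ≡ K ℕ.* (4 ℕ.* (x ℕ.* y) ℕ.* (H ℕ.* (E ℕ.* E)))
    collect = ℕ-Ring.solve-∀
    regroup : ∀ z w S → z ℕ.* (w ℕ.* (S ℕ.* S) ℕ.* (S ℕ.* S)) ≡ z ℕ.* w ℕ.* (S ℕ.* (S ℕ.* (S ℕ.* (S ℕ.* 1))))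
    regroup = ℕ-Ring.solve-∀
    opaque
      unfolding numeral
      constants : 4 ℕ.* (numeral 64 ℕ.* numeral 256) ℕ.* numeral 63 ≤ numeral 4194304
      -- 2^16 · 63 is at most 2^22.
      constants = ℕₚ.≤ᵇ⇒≤ (4 ℕ.* (64 ℕ.* 256) ℕ.* 63) 4194304 _

-- The final algorithm and its query bound

ℕ→ℚ-^ : ∀ x y → ℕ→ℚ (x ^ y) ≡ ℕ→ℚ x ^ℚ y
ℕ→ℚ-^ x zero = refl
ℕ→ℚ-^ x (suc y) = trans (ℕ→ℚ-* x (x ^ y)) (cong (ℕ→ℚ x *_) (ℕ→ℚ-^ x y))

0≤^ℚ : ∀ {x} y → 0ℚ ≤ℚ x → 0ℚ ≤ℚ (x ^ℚ y)
0≤^ℚ zero 0≤x = 0≤1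
0≤^ℚ (suc y) 0≤x = 0≤-* 0≤x (0≤^ℚ y 0≤x)

^ℚ-mono : ∀ {x z} y → 0ℚ ≤ℚ x → x ≤ℚ z → (x ^ℚ y) ≤ℚ (z ^ℚ y)
^ℚ-mono zero 0≤x x≤z = ℚₚ.≤-refl
^ℚ-mono (suc y) 0≤x x≤z = *-mono 0≤x (0≤^ℚ y (ℚₚ.≤-trans 0≤x x≤z)) x≤z (^ℚ-mono y 0≤x x≤z)

module _ (n k : ℕ) (ε : ℚ) (k≤n : k ≤ n) where
  open Parameters k (reciprocal ε)

  juntaAlgorithm : QAlg n (ℚ × (Point k → Bool))
  juntaAlgorithm = Output.algorithm n k q b m t n₀ H k≤n m≡64b τ 0≤τ τt≡1 (0<m (reciprocal-positive ε)) b≤t room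

  juntaAlgorithm-queries : numQueries juntaAlgorithm ≤ 2 ^ k ℕ.* (numeral 4194304 ℕ.* (((k ℕ.+ 1) ℕ.+ reciprocal ε) ^ 4))
  juntaAlgorithm-queries = ℕₚ.≤-trans
    (Output.algorithm-queries n k q b m t n₀ H k≤n m≡64b τ 0≤τ τt≡1 (0<m (reciprocal-positive ε)) b≤t room) query-count

  juntaAlgorithm-success : 0ℚ < ε → (f : BoolFun n) → f ∈ allFuns n → ProbAtLeast f (Good n k ε f) juntaAlgorithm (+ 2 / 3)
  juntaAlgorithm-success 0<ε f f∈ =
    Output.Probability.success n k q b m t n₀ H k≤n m≡64b τ 0≤τ τt≡1 (0<m (reciprocal-positive ε)) b≤t room
      dev-small coll-small ball ball₂ f ε (ℕ→ℚ (reciprocal ε))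
      (ℚₚ.<-≤-trans (ℚₚ.positive⁻¹ 1ℚ) (ℕ→ℚ-mono (reciprocal-positive ε)))
      (proj₁ (reciprocal-bounds ε 0<ε)) (ℚₚ.<⇒≤ 0<ε) b≡ f∈

-- For k > n there are no k distinct coordinates and nothing to approximate, so a fixed answer is
-- given without queries.
chooseAlgorithm : ∀ n k (ε : ℚ) → Dec (k ≤ n) → QAlg n (ℚ × (Point k → Bool))
chooseAlgorithm n k ε (yes k≤n) = juntaAlgorithm n k ε k≤n
chooseAlgorithm n k ε (no _) = ret (0ℚ , λ _ → true)

chooseAlgorithm-queries : ∀ n k ε d → numQueries (chooseAlgorithm n k ε d) ≤ 2 ^ k ℕ.* (numeral 4194304 ℕ.* (((k ℕ.+ 1) ℕ.+ reciprocal ε) ^ 4))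
chooseAlgorithm-queries n k ε (yes k≤n) = juntaAlgorithm-queries n k ε k≤n
chooseAlgorithm-queries n k ε (no _) = z≤n

-- The bound in k + 1 + 1/ε is multiplied by ε⁴ to avoid division. Since Eε ≤ 1 + ε, rounding 1/ε up
-- costs at most a factor 2 in the base, hence 16 in the constant.
queries-polynomial : ∀ N k ε → 0ℚ < ε → N ≤ 2 ^ k ℕ.* (numeral 4194304 ℕ.* (((k ℕ.+ 1) ℕ.+ reciprocal ε) ^ 4)) →
  ℕ→ℚ N * (ε ^ℚ 4) ≤ℚ ℕ→ℚ (2 ^ k) * ℕ→ℚ (numeral 4194304 ℕ.* numeral 16) * (((ℕ→ℚ k + 1ℚ) * ε + 1ℚ) ^ℚ 4)
queries-polynomial N k ε 0<ε N≤ = begin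
  ℕ→ℚ N * (ε ^ℚ 4)
    ≤⟨ *-monoʳ (0≤^ℚ 4 0≤ε) (ℕ→ℚ-mono N≤) ⟩
  ℕ→ℚ (2 ^ k ℕ.* (numeral 4194304 ℕ.* (S ^ 4))) * (ε ^ℚ 4)
    ≡⟨ cong (_* (ε ^ℚ 4)) (trans (ℕ→ℚ-* (2 ^ k) (numeral 4194304 ℕ.* (S ^ 4))) (cong (K *_) (trans (ℕ→ℚ-* (numeral 4194304) (S ^ 4)) (cong (C *_) (ℕ→ℚ-^ S 4))))) ⟩
  (K * (C * (s ^ℚ 4))) * (ε ^ℚ 4)
    ≡⟨ regroup K C s ε ⟩
  (K * C) * ((s * ε) ^ℚ 4)
    ≤⟨ *-monoˡ (0≤-* (0≤ℕ→ℚ (2 ^ k)) (0≤ℕ→ℚ (numeral 4194304))) (^ℚ-mono 4 (0≤-* (0≤ℕ→ℚ S) 0≤ε) sε≤2Y) ⟩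
  (K * C) * ((Y + Y) ^ℚ 4)
    ≡⟨ double K C Y ⟩
  (K * (C * (+ 16 / 1))) * (Y ^ℚ 4)
    ≡⟨ cong (λ z → (K * z) * (Y ^ℚ 4)) (sym (trans (ℕ→ℚ-* (numeral 4194304) (numeral 16)) (cong (λ z → C * ℕ→ℚ z) (numeral-≡ 16)))) ⟩
  K * ℕ→ℚ (numeral 4194304 ℕ.* numeral 16) * (Y ^ℚ 4) ∎
  where
  open ℚₚ.≤-Reasoning
  S E : ℕ
  E = reciprocal ε
  S = (k ℕ.+ 1) ℕ.+ E
  K C s κ Y : ℚ
  K = ℕ→ℚ (2 ^ k)
  C = ℕ→ℚ (numeral 4194304)
  s = ℕ→ℚ S
  κ = ℕ→ℚ k
  Y = (κ + 1ℚ) * ε + 1ℚ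
  0≤ε : 0ℚ ≤ℚ ε
  0≤ε = ℚₚ.<⇒≤ 0<ε
  regroup : ∀ K C s ε → (K * (C * (s * (s * (s * (s * 1ℚ)))))) * (ε * (ε * (ε * (ε * 1ℚ))))
    ≡ (K * C) * ((s * ε) * ((s * ε) * ((s * ε) * ((s * ε) * 1ℚ))))
  regroup = solve-∀ ℚ-ring
  double : ∀ K C Y → (K * C) * ((Y + Y) * ((Y + Y) * ((Y + Y) * ((Y + Y) * 1ℚ)))) ≡ (K * (C * (+ 16 / 1))) * (Y * (Y * (Y * (Y * 1ℚ))))
  double = solve-∀ ℚ-ring
  distribute : ∀ κ e ε → ((κ + 1ℚ) + e) * ε ≡ (κ + 1ℚ) * ε + e * ε
  distribute = solve-∀ ℚ-ring
  slack : ∀ κ ε → ((κ + 1ℚ) * ε + 1ℚ) + ((κ + 1ℚ) * ε + 1ℚ) ≡ ((κ + 1ℚ) * ε + (1ℚ + ε)) + (κ * ε + 1ℚ)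
  slack = solve-∀ ℚ-ring
  sε≤2Y : s * ε ≤ℚ Y + Y
  sε≤2Y = begin
    s * ε
      ≡⟨ cong (_* ε) (trans (ℕ→ℚ-+ (k ℕ.+ 1) E) (cong (_+ ℕ→ℚ E) (ℕ→ℚ-+ k 1))) ⟩
    ((κ + 1ℚ) + ℕ→ℚ E) * ε
      ≡⟨ distribute κ (ℕ→ℚ E) ε ⟩
    (κ + 1ℚ) * ε + ℕ→ℚ E * ε
      ≤⟨ ℚₚ.+-monoʳ-≤ ((κ + 1ℚ) * ε) (proj₂ (reciprocal-bounds ε 0<ε)) ⟩
    (κ + 1ℚ) * ε + (1ℚ + ε)
      ≤⟨ ≤-via (κ * ε + 1ℚ) (slack κ ε) (0≤-+ (0≤-* (0≤ℕ→ℚ k) 0≤ε) 0≤1) ⟩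
    Y + Y ∎

chooseAlgorithm-success : ∀ n k ε → 0ℚ < ε → k ≤ n → (f : BoolFun n) → ∀ d → ProbAtLeast f (Good n k ε f) (chooseAlgorithm n k ε d) (+ 2 / 3)
chooseAlgorithm-success n k ε 0<ε k≤n f (no k≰n) = ⊥-elim (k≰n k≤n)
chooseAlgorithm-success n k ε 0<ε _ f (yes k≤n) = transport (allFuns-complete n f)
  where
  transport : (Σ (BoolFun n) λ g → g ∈ allFuns n × (∀ x → f x ≡ g x)) → ProbAtLeast f (Good n k ε f) (juntaAlgorithm n k ε k≤n) (+ 2 / 3)
  transport (g , g∈ , f≗g) = pull (juntaAlgorithm-success n k ε k≤n 0<ε g g∈)
    where
    pull : ProbAtLeast g (Good n k ε g) (juntaAlgorithm n k ε k≤n) (+ 2 / 3) → ProbAtLeast f (Good n k ε f) (juntaAlgorithm n k ε k≤n) (+ 2 / 3)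
    pull (S , sound , likely) = S , (λ o eq → Good-cong {ε = ε} f g f≗g o (sound o eq)) ,
      subst ((+ 2 / 3) ≤ℚ_) (sym (prob-cong f g f≗g S (juntaAlgorithm n k ε k≤n))) likely

theorem1p3 : Σ ((n k : ℕ) → ℚ → QAlg n (ℚ × (Point k → Bool))) λ A →
    (Σ ℕ λ C → Σ ℕ λ d →
    ∀ (n k : ℕ) (ε : ℚ) → 0ℚ < ε →
    ℕ→ℚ (numQueries (A n k ε)) * (ε ^ℚ d)
    ≤ℚ ℕ→ℚ (2 ^ k) * ℕ→ℚ C * (((ℕ→ℚ k + 1ℚ) * ε + 1ℚ) ^ℚ d))
    ×
    (∀ (n k : ℕ) (ε : ℚ) → 0ℚ < ε → k ≤ n → (f : BoolFun n) →
    ProbAtLeast f (Good n k ε f) (A n k ε) (+ 2 / 3))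
theorem1p3 =
  (λ n k ε → chooseAlgorithm n k ε (k ℕ.≤? n)) ,
  (numeral 4194304 ℕ.* numeral 16 , 4 , λ n k ε 0<ε →
    queries-polynomial (numQueries (chooseAlgorithm n k ε (k ℕ.≤? n))) k ε 0<ε (chooseAlgorithm-queries n k ε (k ℕ.≤? n))) ,
  (λ n k ε 0<ε k≤n f → chooseAlgorithm-success n k ε 0<ε k≤n f (k ℕ.≤? n))
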